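{- Let $R$ be an integral domain with $\operatorname{char} R\neq 2$. Let $\mathcal{A}_1$ and $\mathcal{A}_2$ be central real hyperplane arrangements, and suppose that $\mathcal{A}_1$ is generic in codimension $2$. If $\mathrm{gr}\mathrm{VG}^\bullet(\mathcal{A}_1)_R$ and $\mathrm{gr}\mathrm{VG}^\bullet(\mathcal{A}_2)_R$ are isomorphic as graded $R$-algebras, then the sets of signed circuits of $\mathcal{A}_1$ and $\mathcal{A}_2$ are isomorphic.
   Context: A central real arrangement $\mathcal{A}=\{H_1,\dots,H_n\}$ is a finite set of distinct linear hyperplanes in $V=\mathbb{R}^\ell$, $H_i=\alpha_i^{ -1}(0)$ with chosen $\alpha_i\in V^*$; $H_i^\pm=\alpha_i^{ -1}(\mathbb{R}_{\gtrless 0})$. Chambers $\mathrm{ch}(\mathcal{A})$ are the connected components of $V\setminus\bigcup_i H_i$. $\mathrm{VG}(\mathcal{A})_R$ is the $R$-algebra of all functions $\mathrm{ch}(\mathcal{A})\to R$ (pointwise operations). The Heaviside function $x_i^+$ is $1$ on chambers in $H_i^+$ and $0$ elsewhere. The filtration: $\mathrm{Fil}^{ -1}=0$, and $\mathrm{Fil}^k$ ($k\ge0$) is the set of $G(x_1^+,\dots,x_n^+)$ with $G\in R[z_1,\dots,z_n]$ of degree $\le k$. The graded VG algebra is $\mathrm{gr}\mathrm{VG}^\bullet(\mathcal{A})_R=\bigoplus_{k\ge0}\mathrm{Fil}^k/\mathrm{Fil}^{k-1}$ with multiplication induced from $\mathrm{VG}(\mathcal{A})$. A circuit is a minimal subset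 $I\subseteq[n]$ with $\{\alpha_i\}_{i\in I}$ linearly dependent; for such $I$ and a nontrivial relation $\sum_{i\in I}\lambda_i\alpha_i=0$ the sign vector $(\operatorname{sgn}\lambda_1,\dots,\operatorname{sgn}\lambda_n)\in\{+,-,0\}^n$ (with $\lambda_i=0$ for $i\notin I$) is a signed circuit; the set of all signed circuits is denoted $\mathcal{C}(\mathcal{A})$. Two sets of signed circuits $\mathcal{C}_1\subseteq\{+,-,0\}^{n}$, $\mathcal{C}_2\subseteq\{+,-,0\}^{n}$ are isomorphic if there is a permutation $\pi$ of $[n]$ and signs $\varepsilon_1,\dots,\varepsilon_n\in\{\pm1\}$ such that $(\sigma_i)_i\mapsto(\varepsilon_i\sigma_{\pi(i)})_i$ maps $\mathcal{C}_2$ bijectively onto $\mathcal{C}_1$. $\mathcal{A}$ is generic in codimension $2$ if every codimension-$2$ intersection of hyperplanes of $\mathcal{A}$ is contained in exactly two hyperplanes of $\mathcal{A}$. -}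

module Defs where

open import Level using (Level; _⊔_) renaming (zero to 0ℓ)
open import Data.Nat as ℕ using (ℕ; zero; suc)
open import Data.Fin using (Fin) renaming (zero to fzero; suc to fsuc)
open import Data.Fin.Subset using (Subset; _∈_; _∉_; _⊂_)
open import Data.Bool using (Bool; true; false; if_then_else_)
open import Data.List using (List; []; _∷_)
open import Data.Product using (Σ; ∃; ∃-syntax; _×_; _,_; proj₁; proj₂)
open import Data.Sum using (_⊎_)
open import Data.Empty using (⊥)
open import Data.Unit using (⊤)
open import Relation.Nullary using (¬_)
open import Relation.Binary.PropositionalEquality using (_≡_; _≢_)
open import Algebra.Bundles using (CommutativeRing)
open import Function.Bundles using (_↔_; Inverse)

big : ∀ {a} {A : Set a} → (A → A → A) → A → (n : ℕ) → (Fin n → A) → A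
big _∙_ e zero    f = e
big _∙_ e (suc n) f = f fzero ∙ big _∙_ e n (λ i → f (fsuc i))

-- The real numbers: an arbitrary model of the axioms of a complete
-- ordered field (all such models are isomorphic to ℝ).

record RealField : Set₁ where
  infixl 6 _+_
  infixl 7 _*_
  infix  4 _<_ _≤_
  field
    Carrier : Set
    0r 1r   : Carrier
    _+_ _*_ : Carrier → Carrier → Carrier
    -_      : Carrier → Carrier
    _<_     : Carrier → Carrier → Set
    +-assoc  : ∀ x y z → (x + y) + z ≡ x + (y + z)
    +-comm   : ∀ x y → x + y ≡ y + x
    +-idˡ    : ∀ x → 0r + x ≡ x
    -‿invˡ   : ∀ x → (- x) + x ≡ 0r
    *-assoc  : ∀ x y z → (x * y) * z ≡ x * (y * z)
    *-comm   : ∀ x y → x * y ≡ y * x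
    *-idˡ    : ∀ x → 1r * x ≡ x
    distribˡ : ∀ x y z → x * (y + z) ≡ (x * y) + (x * z)
    0≢1      : 0r ≢ 1r
    *-inv    : ∀ x → x ≢ 0r → ∃[ y ] (x * y ≡ 1r)
    <-irrefl : ∀ x → ¬ (x < x)
    <-trans  : ∀ {x y z} → x < y → y < z → x < z
    <-tri    : ∀ x y → x < y ⊎ x ≡ y ⊎ y < x
    +-mono-< : ∀ {x y} z → x < y → x + z < y + z
    *-pos    : ∀ {x y} → 0r < x → 0r < y → 0r < x * y
  _≤_ : Carrier → Carrier → Set
  x ≤ y = x < y ⊎ x ≡ y
  field
    sup : (P : Carrier → Set) → ∃ P → (∃[ b ] (∀ x → P x → x ≤ b)) →
          ∃[ s ] ((∀ x → P x → x ≤ s) × (∀ b → (∀ x → P x → x ≤ b) → s ≤ b))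

module Arrangements (𝕣 : RealField) where
  open RealField 𝕣 renaming (Carrier to ℝ)

  Σℝ : (n : ℕ) → (Fin n → ℝ) → ℝ
  Σℝ = big _+_ 0r

  -- H_i = α_i⁻¹(0), α_i ∈ V* written in coordinates of V = ℝ^ℓ
  record Arrangement : Set where
    field
      dim   : ℕ
      n     : ℕ
      α     : Fin n → Fin dim → ℝ
      α≢0   : ∀ i → ∃[ m ] (α i m ≢ 0r)
      distinct : ∀ i j → i ≢ j → ¬ (∃[ c ] (∀ m → α i m ≡ c * α j m))

    eval : Fin n → (Fin dim → ℝ) → ℝ
    eval i v = Σℝ dim (λ m → α i m * v m)

    -- Chambers: connected components of V ∖ ⋃ H_i, identified with the
    -- realizable full sign vectors (true = the chamber lies in H_i⁺).
    IsChamber : (Fin n → Bool) → Set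
    IsChamber s = ∃[ v ] (∀ i → (s i ≡ true → 0r < eval i v)
                                × (s i ≡ false → eval i v < 0r))

    Relation : Subset n → (Fin n → ℝ) → Set
    Relation J λ′ = (∀ i → i ∉ J → λ′ i ≡ 0r)
                  × (∀ m → Σℝ n (λ i → λ′ i * α i m) ≡ 0r)
                  × ¬ (∀ i → λ′ i ≡ 0r)

    Dependent : Subset n → Set
    Dependent J = ∃[ λ′ ] Relation J λ′

    IsCircuit : Subset n → Set
    IsCircuit I = Dependent I × (∀ J → J ⊂ I → ¬ Dependent J)

    GenericCodim2 : Set
    GenericCodim2 = ∀ i j k → i ≢ j → k ≢ i → k ≢ j →
      ¬ (∀ v → eval i v ≡ 0r → eval j v ≡ 0r → eval k v ≡ 0r)

  data Sign : Set where
    plus minus nil : Sign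

  data SgnOf : ℝ → Sign → Set where
    sgn+ : ∀ {x} → 0r < x → SgnOf x plus
    sgn- : ∀ {x} → x < 0r → SgnOf x minus
    sgn0 : ∀ {x} → x ≡ 0r → SgnOf x nil

  module _ (A : Arrangement) where
    open Arrangement A
    SignedCircuit : (Fin n → Sign) → Set
    SignedCircuit σ = ∃[ I ] (IsCircuit I ×
      ∃[ λ′ ] (Relation I λ′ × (∀ i → SgnOf (λ′ i) (σ i))))

  _·_ : Bool → Sign → Sign
  true  · s     = s
  false · plus  = minus
  false · minus = plus
  false · nil   = nil

  CircuitsIso : Arrangement → Arrangement → Set
  CircuitsIso A₁ A₂ =
    Σ (Fin (Arrangement.n A₁) ↔ Fin (Arrangement.n A₂)) λ π →
    Σ (Fin (Arrangement.n A₁) → Bool) λ ε →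
      ∀ (σ : Fin (Arrangement.n A₂) → Sign) →
        (SignedCircuit A₂ σ → SignedCircuit A₁ (λ i → ε i · σ (Inverse.to π i)))
        × (SignedCircuit A₁ (λ i → ε i · σ (Inverse.to π i)) → SignedCircuit A₂ σ)

module _ {c ℓ} (R : CommutativeRing c ℓ) where
  open CommutativeRing R

  IsIntegralDomain : Set (c ⊔ ℓ)
  IsIntegralDomain = ¬ (1# ≈ 0#) × (∀ x y → x * y ≈ 0# → x ≈ 0# ⊎ y ≈ 0#)

  CharNot2 : Set ℓ
  CharNot2 = ¬ (1# + 1# ≈ 0#)

module VG {c ℓ} (R : CommutativeRing c ℓ) (𝕣 : RealField) where
  open CommutativeRing R renaming (Carrier to Rc)
  open Arrangements 𝕣

  Poly : ℕ → Set c
  Poly n = List (Rc × (Fin n → ℕ))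

  totalDeg : ∀ {n} → (Fin n → ℕ) → ℕ
  totalDeg {n} e = big ℕ._+_ 0 n e

  DegLe : ∀ {n} → Poly n → ℕ → Set
  DegLe []            k = ⊤
  DegLe ((_ , e) ∷ G) k = totalDeg e ℕ.≤ k × DegLe G k

  pow : Rc → ℕ → Rc
  pow x zero    = 1#
  pow x (suc m) = x * pow x m

  evalPoly : ∀ {n} → Poly n → (Fin n → Rc) → Rc
  evalPoly []            z = 0#
  evalPoly {n} ((a , e) ∷ G) z = a * big _*_ 1# n (λ i → pow (z i) (e i)) + evalPoly G z

  module _ (A : Arrangement) where
    open Arrangement A

    -- representatives of elements of VG(A)_R: functions on sign vectors;
    -- only their values on chambers matter (see _≋_).
    VGel : Set c
    VGel = (Fin n → Bool) → Rc

    _≋_ : VGel → VGel → Set ℓ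
    f ≋ g = ∀ s → IsChamber s → f s ≈ g s

    x⁺ : Fin n → VGel
    x⁺ i s = if s i then 1# else 0#

    Fil : ℕ → VGel → Set (c ⊔ ℓ)
    Fil k f = ∃[ G ] (DegLe G k × (f ≋ (λ s → evalPoly G (λ i → x⁺ i s))))

    -- Fil^{k-1}  (with Fil^{-1} = 0)
    Fil⁻ : ℕ → VGel → Set (c ⊔ ℓ)
    Fil⁻ zero    f = Level.Lift (c ⊔ ℓ) (f ≋ (λ _ → 0#))
    Fil⁻ (suc k) f = Fil k f

    -- congruence modulo Fil^{k-1}: equality in Fil^k / Fil^{k-1}
    _∼[_]_ : VGel → ℕ → VGel → Set (c ⊔ ℓ)
    f ∼[ k ] g = Fil⁻ k (λ s → f s - g s)

    𝟙 𝟘 : VGel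
    𝟙 _ = 1#
    𝟘 _ = 0#

    _⊕_ _⊗_ : VGel → VGel → VGel
    (f ⊕ g) s = f s + g s
    (f ⊗ g) s = f s * g s

    _⊙_ : Rc → VGel → VGel
    (r ⊙ f) s = r * f s

  -- An isomorphism of graded R-algebras grVG(A₁)_R ≅ grVG(A₂)_R, written out
  -- degreewise on representatives: R-linear bijections
  -- Fil^k(A₁)/Fil^{k-1}(A₁) → Fil^k(A₂)/Fil^{k-1}(A₂), multiplicative on
  -- homogeneous elements and unital.
  record GradedIso (A₁ A₂ : Arrangement) : Set (c ⊔ ℓ) where
    field
      φ : (k : ℕ) → (f : VGel A₁) → Fil A₁ k f → VGel A₂
      φ-Fil : ∀ k f (p : Fil A₁ k f) → Fil A₂ k (φ k f p)
      φ-cong : ∀ k f g (p : Fil A₁ k f) (q : Fil A₁ k g) →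
        _∼[_]_ A₁ f k g → _∼[_]_ A₂ (φ k f p) k (φ k g q)
      φ-+ : ∀ k f g (p : Fil A₁ k f) (q : Fil A₁ k g) (pq : Fil A₁ k (_⊕_ A₁ f g)) →
        _∼[_]_ A₂ (φ k (_⊕_ A₁ f g) pq) k (_⊕_ A₂ (φ k f p) (φ k g q))
      φ-· : ∀ k r f (p : Fil A₁ k f) (rp : Fil A₁ k (_⊙_ A₁ r f)) →
        _∼[_]_ A₂ (φ k (_⊙_ A₁ r f) rp) k (_⊙_ A₂ r (φ k f p))
      φ-mult : ∀ j k f g (p : Fil A₁ j f) (q : Fil A₁ k g)
        (pq : Fil A₁ (j ℕ.+ k) (_⊗_ A₁ f g)) →
        _∼[_]_ A₂ (φ (j ℕ.+ k) (_⊗_ A₁ f g) pq) (j ℕ.+ k) (_⊗_ A₂ (φ j f p) (φ k g q))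
      φ-unit : ∀ (p : Fil A₁ 0 (𝟙 A₁)) → _∼[_]_ A₂ (φ 0 (𝟙 A₁) p) 0 (𝟙 A₂)
      φ-inj : ∀ k f (p : Fil A₁ k f) →
        _∼[_]_ A₂ (φ k f p) k (𝟘 A₂) → _∼[_]_ A₁ f k (𝟘 A₁)
      φ-surj : ∀ k g → Fil A₂ k g →
        ∃[ f ] Σ (Fil A₁ k f) λ p → _∼[_]_ A₂ (φ k f p) k g

-- Heaviside monomials are detected by cubes of chambers.  A lexicographic sequence of vectors yields
-- chambers C(ε), ε ∈ {±}^K, in which each sign is constant or follows one εₐ; the alternating sum of f
-- over C(ε) kills Fil^{K-1} and is computed on monomials by inspection.  Genericity supplies such squares
-- around every H_i ∩ H_j in A₁, so a class of degree one squares to zero only if it is a multiple of one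
-- generator.  Hence the isomorphism matches y_i with u_i x_{π i} for a bijection π and units u_i.
-- A signed circuit σ gives the relation Σ_b ± x_{I∖b} = 0 with signs ∏_{a≠b} σ_a.  Transporting it, the
-- cube functionals show that π I is dependent, hence (by symmetry) a circuit, and that its signs τ make
-- σ_i τ_i u_i constant on I.  So u_i = ± u_j along circuits; signs ε_i with ε_i u_i constant along circuits
-- then give τ = ± ε σ.
module Submission where

open import Defs
open import Algebra.Bundles using (CommutativeRing; RawRing)
import Algebra.Solver.Ring
open import Algebra.Solver.Ring.AlmostCommutativeRing using (fromCommutativeRing; _-Raw-AlmostCommutative⟶_)
open import Data.Bool using (Bool; true; false; not; if_then_else_)
open import Data.Empty using (⊥; ⊥-elim)
open import Data.Fin using (Fin; zero; suc; punchIn; remQuot; combine)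
open import Data.Fin.Properties using (any?; _≟_; suc-injective; punchInᵢ≢i; remQuot-combine)
open import Data.Fin.Subset using (Subset; _∈_; _∉_; _⊂_; _⊆_) renaming (_-_ to _∖_)
open import Data.Fin.Subset.Induction using (⊂-wellFounded)
open import Data.Fin.Subset.Properties using (_∈?_; anySubset?; _⊂?_; x∈p∧x≢y⇒x∈p-y; x∈p⇒p-x⊂p; ⊆-refl; ⊆-trans)
open import Data.List using (List; []; _∷_; _++_; tabulate)
open import Data.List.Properties using (++-assoc)
open import Data.Maybe using (Maybe; just; nothing)
import Data.Maybe.Properties as Maybeₚ
open import Data.Nat as ℕ using (ℕ; zero; suc)
import Data.Nat.Properties as ℕₚ
open import Data.Product using (Σ; ∃; ∃-syntax; _×_; _,_; proj₁; proj₂)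
open import Data.Sum using (_⊎_; inj₁; inj₂; [_,_]′)
import Data.Vec as Vec
import Data.Vec.Properties as Vecₚ
open import Function using (_∘_; case_of_)
open import Function.Bundles using (mk↔ₛ′)
open import Induction.WellFounded using (Acc; acc)
open import Level using (Level; _⊔_; lift)
open import Relation.Binary.PropositionalEquality as ≡ using (_≡_; _≢_)
open import Relation.Nullary using (¬_; Dec; yes; no; does; ¬?; contradiction; _×-dec_; _⊎-dec_)
open import Relation.Nullary.Decidable using (decidable-stable)
open import Relation.Unary using (Decidable)

-- Genericity makes the square-zero test conclusive. If three hyperplanes share a codimension-two
-- space, their circuit relation has coefficient `σ_i σ_j` at `x_i x_j`, so
-- `σ_1 x_1 + σ_2 x_2 + σ_3 x_3` also squares to zero in degree two without being a multiple of one
-- generator. The units `u_i` cannot be normalised one at a time: multiplying degree k by `t^k`, for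
-- a unit `t`, is a graded automorphism. Only their ratios along circuits are constrained, which is
-- why signs are compared on circuits and never generator by generator. Cubes stand in for a basis
-- or a presentation of the graded algebra. Each K-cube is a linear form on degree K with computable
-- values on products of generators, so a relation modulo lower degree becomes an equation in R. A
-- flag adapted to a circuit leaves just one or two terms of that equation.

module RingLemmas {c ℓ} (R : CommutativeRing c ℓ) where
  open CommutativeRing R hiding (zero)
  open import Algebra.Properties.Semiring.Mult.TCOptimised semiring using (×-homo-+; ×1-homo-*) renaming (_×_ to infixr 8 _⋆_)
  open import Algebra.Properties.Ring ring using (-‿distribˡ-*; -‿distribʳ-*; -‿involutive; -0#≈0#)
  open import Algebra.Properties.AbelianGroup +-abelianGroup using (⁻¹-∙-comm)
  open import Relation.Binary.Reasoning.Setoid setoid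

  -- Formal differences of naturals: coefficients on which equality can be computed,
  -- although equality in R cannot.
  private
    diffRing : RawRing _ _
    diffRing = record
      { Carrier = ℕ × ℕ
      ; _≈_ = _≡_
      ; _+_ = λ (a , b) (a′ , b′) → a ℕ.+ a′ , b ℕ.+ b′
      ; _*_ = λ (a , b) (a′ , b′) → a ℕ.* a′ ℕ.+ b ℕ.* b′ , a ℕ.* b′ ℕ.+ b ℕ.* a′
      ; -_ = λ (a , b) → b , a
      ; 0# = 0 , 0
      ; 1# = 1 , 0
      }

    difference : ℕ × ℕ → Carrier
    difference (a , b) = a ⋆ 1# - b ⋆ 1#

    -- Evaluates the literals (0 , 0) and (1 , 0) to 0# and 1# on the nose.
    ⟦_⟧ : ℕ × ℕ → Carrier
    ⟦ a , zero ⟧ = a ⋆ 1#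
    ⟦ a , suc b ⟧ = difference (a , suc b)

    ⟦⟧≈difference : ∀ x → ⟦ x ⟧ ≈ difference x
    ⟦⟧≈difference (a , zero) = sym (trans (+-congˡ -0#≈0#) (+-identityʳ _))
    ⟦⟧≈difference (a , suc b) = refl

    interchange : ∀ a b c d → (a + b) + (c + d) ≈ (a + c) + (b + d)
    interchange a b c d = begin
      (a + b) + (c + d) ≈⟨ +-assoc a b (c + d) ⟩
      a + (b + (c + d)) ≈⟨ +-congˡ (+-assoc b c d) ⟨
      a + ((b + c) + d) ≈⟨ +-congˡ (+-congʳ (+-comm b c)) ⟩
      a + ((c + b) + d) ≈⟨ +-congˡ (+-assoc c b d) ⟩
      a + (c + (b + d)) ≈⟨ +-assoc a c (b + d) ⟨
      (a + c) + (b + d) ∎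

    difference-+ : ∀ a b c d → (a + c) - (b + d) ≈ (a - b) + (c - d)
    difference-+ a b c d = trans (+-congˡ (sym (⁻¹-∙-comm b d))) (interchange a c (- b) (- d))

    difference-* : ∀ a b c d → (a * c + b * d) - (a * d + b * c) ≈ (a - b) * (c - d)
    difference-* a b c d = sym (begin
      (a - b) * (c - d) ≈⟨ distribʳ (c - d) a (- b) ⟩
      a * (c - d) + - b * (c - d) ≈⟨ +-cong (distribˡ a c (- d)) (distribˡ (- b) c (- d)) ⟩
      (a * c + a * - d) + (- b * c + - b * - d)
        ≈⟨ +-cong (+-congˡ (sym (-‿distribʳ-* a d)))
                  (+-cong (sym (-‿distribˡ-* b c))
                          (trans (sym (-‿distribˡ-* b (- d)))
                            (trans (-‿cong (sym (-‿distribʳ-* b d))) (-‿involutive (b * d))))) ⟩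
      (a * c - a * d) + (- (b * c) + b * d) ≈⟨ +-congˡ (+-comm _ _) ⟩
      (a * c - a * d) + (b * d - b * c) ≈⟨ difference-+ (a * c) (a * d) (b * d) (b * c) ⟨
      (a * c + b * d) - (a * d + b * c) ∎)

    morphism : diffRing -Raw-AlmostCommutative⟶ fromCommutativeRing R
    morphism = record
      { ⟦_⟧ = ⟦_⟧
      ; +-homo = λ x@(a , b) y@(a′ , b′) → begin
          ⟦ a ℕ.+ a′ , b ℕ.+ b′ ⟧ ≈⟨ ⟦⟧≈difference (a ℕ.+ a′ , b ℕ.+ b′) ⟩
          (a ℕ.+ a′) ⋆ 1# - (b ℕ.+ b′) ⋆ 1# ≈⟨ +-cong (×-homo-+ 1# a a′) (-‿cong (×-homo-+ 1# b b′)) ⟩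
          (a ⋆ 1# + a′ ⋆ 1#) - (b ⋆ 1# + b′ ⋆ 1#) ≈⟨ difference-+ _ _ _ _ ⟩
          difference x + difference y ≈⟨ +-cong (⟦⟧≈difference x) (⟦⟧≈difference y) ⟨
          ⟦ x ⟧ + ⟦ y ⟧ ∎
      ; *-homo = λ x@(a , b) y@(a′ , b′) → begin
          ⟦ a ℕ.* a′ ℕ.+ b ℕ.* b′ , a ℕ.* b′ ℕ.+ b ℕ.* a′ ⟧
            ≈⟨ ⟦⟧≈difference (a ℕ.* a′ ℕ.+ b ℕ.* b′ , a ℕ.* b′ ℕ.+ b ℕ.* a′) ⟩
          (a ℕ.* a′ ℕ.+ b ℕ.* b′) ⋆ 1# - (a ℕ.* b′ ℕ.+ b ℕ.* a′) ⋆ 1#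
            ≈⟨ +-cong (*-+-homo a a′ b b′) (-‿cong (*-+-homo a b′ b a′)) ⟩
          (a ⋆ 1# * a′ ⋆ 1# + b ⋆ 1# * b′ ⋆ 1#) - (a ⋆ 1# * b′ ⋆ 1# + b ⋆ 1# * a′ ⋆ 1#)
            ≈⟨ difference-* _ _ _ _ ⟩
          difference x * difference y ≈⟨ *-cong (⟦⟧≈difference x) (⟦⟧≈difference y) ⟨
          ⟦ x ⟧ * ⟦ y ⟧ ∎
      ; -‿homo = λ x@(a , b) → begin
          ⟦ b , a ⟧ ≈⟨ ⟦⟧≈difference (b , a) ⟩
          b ⋆ 1# - a ⋆ 1# ≈⟨ +-comm _ _ ⟩
          - (a ⋆ 1#) + b ⋆ 1# ≈⟨ +-congˡ (-‿involutive _) ⟨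
          - (a ⋆ 1#) + - - (b ⋆ 1#) ≈⟨ ⁻¹-∙-comm _ _ ⟩
          - difference x ≈⟨ -‿cong (⟦⟧≈difference x) ⟨
          - ⟦ x ⟧ ∎
      ; 0-homo = refl
      ; 1-homo = refl
      }
      where
      *-+-homo : ∀ a b c d → (a ℕ.* b ℕ.+ c ℕ.* d) ⋆ 1# ≈ a ⋆ 1# * b ⋆ 1# + c ⋆ 1# * d ⋆ 1#
      *-+-homo a b c d = trans (×-homo-+ 1# (a ℕ.* b) (c ℕ.* d)) (+-cong (×1-homo-* a b) (×1-homo-* c d))

    diff≟ : ∀ x y → Maybe (⟦ x ⟧ ≈ ⟦ y ⟧)
    diff≟ (a , b) (a′ , b′) with a ℕ.+ b′ ℕ.≟ a′ ℕ.+ b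
    ... | no _ = nothing
    ... | yes e = just (begin
      ⟦ a , b ⟧ ≈⟨ ⟦⟧≈difference (a , b) ⟩
      A - B ≈⟨ cancel A B B′ ⟨
      (A + B′) - (B + B′) ≈⟨ +-congʳ (trans (sym (×-homo-+ 1# a b′)) (trans (reflexive (≡.cong (_⋆ 1#) e)) (×-homo-+ 1# a′ b))) ⟩
      (A′ + B) - (B + B′) ≈⟨ +-congˡ (-‿cong (+-comm _ _)) ⟩
      (A′ + B) - (B′ + B) ≈⟨ cancel A′ B′ B ⟩
      A′ - B′ ≈⟨ ⟦⟧≈difference (a′ , b′) ⟨
      ⟦ a′ , b′ ⟧ ∎)
      where
      A = a ⋆ 1#
      B = b ⋆ 1#
      A′ = a′ ⋆ 1#
      B′ = b′ ⋆ 1#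
      cancel : ∀ x y z → (x + z) - (y + z) ≈ x - y
      cancel x y z = trans (difference-+ x y z z) (trans (+-congˡ (-‿inverseʳ z)) (+-identityʳ _))

  module Solver = Algebra.Solver.Ring diffRing (fromCommutativeRing R) morphism diff≟
  open Solver using (solve; _:=_; _:+_; _:*_; _:-_; :-_; con)

  -- Finite sums and products in a commutative ring.

  sg : Bool → Carrier
  sg b = if b then 1# else - 1#

  ∑ ∏ : (n : ℕ) → (Fin n → Carrier) → Carrier
  ∑ = big _+_ 0#
  ∏ = big _*_ 1#

  ∑-cong : ∀ n {f g} → (∀ i → f i ≈ g i) → ∑ n f ≈ ∑ n g
  ∑-cong zero    h = refl
  ∑-cong (suc n) h = +-cong (h zero) (∑-cong n (λ i → h (suc i)))

  ∏-cong : ∀ n {f g} → (∀ i → f i ≈ g i) → ∏ n f ≈ ∏ n g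
  ∏-cong zero    h = refl
  ∏-cong (suc n) h = *-cong (h zero) (∏-cong n (λ i → h (suc i)))

  ∑-zero : ∀ n {f} → (∀ i → f i ≈ 0#) → ∑ n f ≈ 0#
  ∑-zero zero    h = refl
  ∑-zero (suc n) h = trans (+-cong (h zero) (∑-zero n (λ i → h (suc i)))) (+-identityʳ 0#)

  ∏-one : ∀ n {f} → (∀ i → f i ≈ 1#) → ∏ n f ≈ 1#
  ∏-one zero    h = refl
  ∏-one (suc n) h = trans (*-cong (h zero) (∏-one n (λ i → h (suc i)))) (*-identityʳ 1#)

  ∏-zero : ∀ n {f} i → f i ≈ 0# → ∏ n f ≈ 0#
  ∏-zero (suc n) zero    h = trans (*-congʳ h) (zeroˡ _)
  ∏-zero (suc n) (suc i) h = trans (*-congˡ (∏-zero n i h)) (zeroʳ _)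

  ∑-+ : ∀ n f g → ∑ n (λ i → f i + g i) ≈ ∑ n f + ∑ n g
  ∑-+ zero    f g = sym (+-identityʳ 0#)
  ∑-+ (suc n) f g = trans (+-congˡ (∑-+ n _ _)) (interchange _ _ _ _)

  ∑-*ˡ : ∀ n a f → ∑ n (λ i → a * f i) ≈ a * ∑ n f
  ∑-*ˡ zero    a f = sym (zeroʳ a)
  ∑-*ˡ (suc n) a f = trans (+-congˡ (∑-*ˡ n a _)) (sym (distribˡ _ _ _))

  ∏-* : ∀ n f g → ∏ n (λ i → f i * g i) ≈ ∏ n f * ∏ n g
  ∏-* zero    f g = sym (*-identityʳ 1#)
  ∏-* (suc n) f g = trans (*-congˡ (∏-* n _ _))
    (solve 4 (λ a b c d → (a :* b) :* (c :* d) := (a :* c) :* (b :* d)) refl _ _ _ _)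

  ∑-only : ∀ n {f} k → (∀ i → i ≢ k → f i ≈ 0#) → ∑ n f ≈ f k
  ∑-only (suc n) zero    h = trans (+-congˡ (∑-zero n (λ i → h (suc i) λ ()))) (+-identityʳ _)
  ∑-only (suc n) (suc k) h = trans
    (+-cong (h zero λ ()) (∑-only n k (λ i i≢k → h (suc i) λ { ≡.refl → i≢k ≡.refl }))) (+-identityˡ _)

  ∑-swap : ∀ m n (f : Fin m → Fin n → Carrier) →
    ∑ m (λ i → ∑ n (f i)) ≈ ∑ n (λ j → ∑ m (λ i → f i j))
  ∑-swap zero    n f = sym (∑-zero n (λ _ → refl))
  ∑-swap (suc m) n f = trans (+-congˡ (∑-swap m n _)) (sym (∑-+ n _ _))

  ∑-two : ∀ m {f} i j → i ≢ j → (∀ k → k ≢ i → k ≢ j → f k ≈ 0#) → ∑ m f ≈ f i + f j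
  ∑-two (suc m) zero    zero    i≢j h = contradiction ≡.refl i≢j
  ∑-two (suc m) zero    (suc j) i≢j h = +-congˡ (∑-only m j (λ k ne → h (suc k) (λ ()) (ne ∘ suc-injective)))
  ∑-two (suc m) (suc i) zero    i≢j h = trans (+-congˡ (∑-only m i (λ k ne → h (suc k) (ne ∘ suc-injective) λ ()))) (+-comm _ _)
  ∑-two (suc m) (suc i) (suc j) i≢j h = trans
    (+-cong (h zero (λ ()) λ ()) (∑-two m i j (i≢j ∘ ≡.cong suc) (λ k ne ne′ → h (suc k) (ne ∘ suc-injective) (ne′ ∘ suc-injective))))
    (+-identityˡ _)

infixl 7 _⊛_
-- Booleans serve as the group of signs, with `true` as +; this is its multiplication.
_⊛_ : Bool → Bool → Bool
true  ⊛ b = b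
false ⊛ b = not b

-- Neither alternative has to be decidable by itself. This matters for equations in R, where only
-- the disjunctions supplied by the domain axiom are available.
find : ∀ {p q} n {P : Fin n → Set p} {Q : Fin n → Set q} →
  (∀ i → P i ⊎ Q i) → (∃ P) ⊎ (∀ i → Q i)
find zero    f = inj₂ λ ()
find (suc n) f with f zero | find n (λ i → f (suc i))
... | inj₁ p | _            = inj₁ (zero , p)
... | inj₂ _ | inj₁ (i , p) = inj₁ (suc i , p)
... | inj₂ q | inj₂ qs      = inj₂ λ { zero → q ; (suc i) → qs i }

-- Signs and linear algebra over the real field.

module RealLemmas (𝕣 : RealField) where
  open RealField 𝕣 renaming (Carrier to ℝ) public

  ℝ-ring : CommutativeRing _ _
  ℝ-ring = record
    { Carrier = ℝ ; _≈_ = _≡_ ; _+_ = _+_ ; _*_ = _*_ ; -_ = -_ ; 0# = 0r ; 1# = 1r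
    ; isCommutativeRing = record
      { *-comm = *-comm
      ; isRing = record
        { *-cong = ≡.cong₂ _*_
        ; *-assoc = *-assoc
        ; *-identity = *-idˡ , λ x → ≡.trans (*-comm x 1r) (*-idˡ x)
        ; distrib = distribˡ , λ x y z → ≡.trans (*-comm (y + z) x)
            (≡.trans (distribˡ x y z) (≡.cong₂ _+_ (*-comm x y) (*-comm x z)))
        ; +-isAbelianGroup = record
          { comm = +-comm
          ; isGroup = record
            { ⁻¹-cong = ≡.cong -_
            ; inverse = -‿invˡ , λ x → ≡.trans (+-comm x (- x)) (-‿invˡ x)
            ; isMonoid = record
              { identity = +-idˡ , λ x → ≡.trans (+-comm x 0r) (+-idˡ x)
              ; isSemigroup = record
                { assoc = +-assoc
                ; isMagma = record { isEquivalence = ≡.isEquivalence ; ∙-cong = ≡.cong₂ _+_ } } } } } } } }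

  open RingLemmas ℝ-ring public
  open CommutativeRing ℝ-ring public using ()
    renaming (zeroˡ to *-zeroˡ; zeroʳ to *-zeroʳ; +-identityʳ to +-idʳ; *-identityʳ to *-idʳ)
  open Solver using (solve; _:=_; _:+_; _:*_; _:-_; :-_; con)
  open ≡ using (refl; sym; trans; cong; cong₂; subst)
  open ≡.≡-Reasoning

  >⇒≢ : ∀ {x} → 0r < x → x ≢ 0r
  >⇒≢ p refl = <-irrefl _ p

  <⇒≢ : ∀ {x} → x < 0r → x ≢ 0r
  <⇒≢ p refl = <-irrefl _ p

  infix 4 _≟ℝ_
  -- Trichotomy decides real equality, and with it spans, dependence and circuits, in contrast to
  -- equality in R.
  _≟ℝ_ : ∀ x y → Dec (x ≡ y)
  x ≟ℝ y with <-tri x y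
  ... | inj₁ l        = no λ { refl → <-irrefl x l }
  ... | inj₂ (inj₁ e) = yes e
  ... | inj₂ (inj₂ l) = no λ { refl → <-irrefl x l }

  -0≡0 : - 0r ≡ 0r
  -0≡0 = solve 0 (:- con (0 , 0) := con (0 , 0)) refl

  neg⇒pos : ∀ {x} → x < 0r → 0r < - x
  neg⇒pos {x} l = subst (_< - x) (trans (+-comm x (- x)) (-‿invˡ x)) (subst (x + - x <_) (+-idˡ (- x)) (+-mono-< (- x) l))

  pos⇒neg : ∀ {x} → 0r < x → - x < 0r
  pos⇒neg {x} l = subst (- x <_) (trans (+-comm x (- x)) (-‿invˡ x)) (subst (_< x + - x) (+-idˡ (- x)) (+-mono-< (- x) l))

  -‿involutive : ∀ x → - - x ≡ x
  -‿involutive = solve 1 (λ x → :- :- x := x) refl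

  pos-cancel : ∀ {x} → 0r < - x → x < 0r
  pos-cancel {x} l = subst (_< 0r) (-‿involutive x) (pos⇒neg l)

  +-pos : ∀ {x y} → 0r < x → 0r ≤ y → 0r < x + y
  +-pos {x} {y} p (inj₁ q) = <-trans q (subst (_< x + y) (+-idˡ y) (+-mono-< y p))
  +-pos {x}     p (inj₂ refl) = subst (0r <_) (sym (+-idʳ x)) p

  1>0 : 0r < 1r
  1>0 with <-tri 0r 1r
  ... | inj₁ l        = l
  ... | inj₂ (inj₁ e) = contradiction e 0≢1
  ... | inj₂ (inj₂ l) = subst (0r <_) (trans (solve 1 (λ x → :- x :* :- x := x :* x) refl 1r) (*-idˡ 1r)) (*-pos (neg⇒pos l) (neg⇒pos l))

  HasSign : Bool → ℝ → Set
  HasSign true  x = 0r < x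
  HasSign false x = x < 0r

  sign⇒≢0 : ∀ b {x} → HasSign b x → x ≢ 0r
  sign⇒≢0 true  = >⇒≢
  sign⇒≢0 false = <⇒≢

  sign? : ∀ x → x ≡ 0r ⊎ ∃[ b ] HasSign b x
  sign? x with <-tri x 0r
  ... | inj₁ l        = inj₂ (false , l)
  ... | inj₂ (inj₁ e) = inj₁ e
  ... | inj₂ (inj₂ l) = inj₂ (true , l)

  ≢0⇒sign : ∀ {x} → x ≢ 0r → ∃[ b ] HasSign b x
  ≢0⇒sign {x} x≢0 with sign? x
  ... | inj₁ e = contradiction e x≢0
  ... | inj₂ s = s

  sign-unique : ∀ {b b′ x} → HasSign b x → HasSign b′ x → b ≡ b′
  sign-unique {true}  {true}  _ _ = refl
  sign-unique {false} {false} _ _ = refl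
  sign-unique {true}  {false} p q = ⊥-elim (<-irrefl _ (<-trans p q))
  sign-unique {false} {true}  p q = ⊥-elim (<-irrefl _ (<-trans p q))

  sign-neg : ∀ b {x} → HasSign b x → HasSign (not b) (- x)
  sign-neg true  = pos⇒neg
  sign-neg false = neg⇒pos

  sign-* : ∀ b b′ {x y} → HasSign b x → HasSign b′ y → HasSign (b ⊛ b′) (x * y)
  sign-* true  true  p q = *-pos p q
  sign-* true  false {x} {y} p q =
    pos-cancel (subst (0r <_) (solve 2 (λ x y → x :* :- y := :- (x :* y)) refl x y) (*-pos p (neg⇒pos q)))
  sign-* false true  {x} {y} p q =
    pos-cancel (subst (0r <_) (solve 2 (λ x y → :- x :* y := :- (x :* y)) refl x y) (*-pos (neg⇒pos p) q))
  sign-* false false {x} {y} p q =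
    subst (0r <_) (solve 2 (λ x y → :- x :* :- y := x :* y) refl x y) (*-pos (neg⇒pos p) (neg⇒pos q))

  ∑-nonneg : ∀ n {f} → (∀ i → 0r ≤ f i) → 0r ≤ ∑ n f
  ∑-nonneg zero    h = inj₂ refl
  ∑-nonneg (suc n) {f} h with h zero | ∑-nonneg n (λ i → h (suc i))
  ... | inj₁ p | q = inj₁ (+-pos p q)
  ... | inj₂ e | q = subst (0r ≤_) (trans (sym (+-idˡ _)) (cong (_+ ∑ n (f ∘ suc)) e)) q

  ∑-pos : ∀ n {f} i → 0r < f i → (∀ i → 0r ≤ f i) → 0r < ∑ n f
  ∑-pos (suc n) zero    p h = +-pos p (∑-nonneg n (λ i → h (suc i)))
  ∑-pos (suc n) {f} (suc i) p h = subst (0r <_) (+-comm _ (f zero)) (+-pos (∑-pos n i p (λ i → h (suc i))) (h zero))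

  ∑-neg : ∀ n f → ∑ n (λ i → - f i) ≡ - ∑ n f
  ∑-neg zero    f = sym -0≡0
  ∑-neg (suc n) f = trans (cong (- f zero +_) (∑-neg n (f ∘ suc))) (solve 2 (λ x y → :- x :+ :- y := :- (x :+ y)) refl _ _)

  sum-zero-pos : ∀ n {f} i → ∑ n f ≡ 0r → 0r < f i → ∃[ j ] f j < 0r
  sum-zero-pos n {f} i e p with find n {λ j → f j < 0r} {λ j → 0r ≤ f j} sgn
    where
    sgn : ∀ j → f j < 0r ⊎ 0r ≤ f j
    sgn j with <-tri (f j) 0r
    ... | inj₁ l        = inj₁ l
    ... | inj₂ (inj₁ e) = inj₂ (inj₂ (sym e))
    ... | inj₂ (inj₂ l) = inj₂ (inj₁ l)
  ... | inj₁ j = j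
  ... | inj₂ h = contradiction e (>⇒≢ (∑-pos n i p h))

  -- Converts linear relations into sign information: it is applied to a relation evaluated in a
  -- chamber and to one evaluated at a dual vector.
  sum-zero-sign : ∀ n {f} b i → ∑ n f ≡ 0r → HasSign b (f i) → ∃[ j ] HasSign (not b) (f j)
  sum-zero-sign n true  i e p = sum-zero-pos n i e p
  sum-zero-sign n {f} false i e p
    with sum-zero-pos n {λ i → - f i} i (trans (∑-neg n f) (trans (cong -_ e) -0≡0)) (neg⇒pos p)
  ... | j , q = j , subst (0r <_) (-‿involutive (f j)) (neg⇒pos q)

  bounded : ∀ m (f : Fin m → ℝ) → ∃[ M ] (∀ i → f i ≤ M)
  bounded zero    f = 0r , λ ()
  bounded (suc m) f with bounded m (f ∘ suc)
  ... | M , M-bounds with <-tri (f zero) M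
  ...   | inj₁ l        = M , λ { zero → inj₁ l ; (suc i) → M-bounds i }
  ...   | inj₂ (inj₁ e) = M , λ { zero → inj₂ e ; (suc i) → M-bounds i }
  ...   | inj₂ (inj₂ l) = f zero , λ { zero → inj₂ refl ; (suc i) → inj₁ (≤-<-trans (M-bounds i) l) }
    where
    ≤-<-trans : ∀ {x y z} → x ≤ y → y < z → x < z
    ≤-<-trans (inj₁ p)    q = <-trans p q
    ≤-<-trans (inj₂ refl) q = q

  difference-nonneg : ∀ {x y} → x ≤ y → 0r ≤ y + - x
  difference-nonneg {x} (inj₂ refl) = inj₂ (solve 1 (λ x → con (0 , 0) := x :- x) refl x)
  difference-nonneg {x} {y} (inj₁ l) = inj₁ (subst (_< y + - x) (solve 1 (λ x → x :- x := con (0 , 0)) refl x) (+-mono-< (- x) l))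

  dominates⁺ : ∀ {x} y → 0r < x → ∃[ M₀ ] (∀ M → M₀ ≤ M → 0r < M * x + y)
  dominates⁺ {x} y x>0 with *-inv x (>⇒≢ x>0)
  -- The threshold `x⁻¹ (x - y)` is the value of M at which `M x + y` equals `x`; a larger M adds a
  -- nonnegative multiple of `x`.
  ... | x⁻¹ , xx⁻¹≡1 = x⁻¹ * (x + - y) , λ M M₀≤M →
    subst (0r <_) (expand M) (+-pos x>0 (*-nonneg (difference-nonneg M₀≤M)))
    where
    *-nonneg : ∀ {z} → 0r ≤ z → 0r ≤ z * x
    *-nonneg (inj₁ p)    = inj₁ (*-pos p x>0)
    *-nonneg (inj₂ refl) = inj₂ (sym (*-zeroˡ x))
    expand : ∀ M → x + (M + - (x⁻¹ * (x + - y))) * x ≡ M * x + y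
    expand M = trans
      (solve 4 (λ x y i M → x :+ (M :- i :* (x :- y)) :* x := M :* x :+ (x :- (x :* i) :* (x :- y))) refl x y x⁻¹ M)
      (trans (cong (λ z → M * x + (x + - (z * (x + - y)))) xx⁻¹≡1)
        (solve 3 (λ x y M → M :* x :+ (x :- con (1 , 0) :* (x :- y)) := M :* x :+ y) refl x y M))

  dominates : ∀ b {x} y → HasSign b x → ∃[ M₀ ] (∀ M → M₀ ≤ M → HasSign b (M * x + y))
  dominates true  y p = dominates⁺ y p
  dominates false {x} y p = proj₁ opposite , λ M M₀≤M →
    subst (_< 0r) (factor M) (pos⇒neg (proj₂ opposite M M₀≤M))
    where
    opposite = dominates⁺ (- y) (neg⇒pos p)
    factor : ∀ M → - (M * - x + - y) ≡ M * x + y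
    factor M = solve 3 (λ M x y → :- (M :* :- x :+ :- y) := M :* x :+ y) refl M x y

  sign-sg : ∀ b → HasSign b (sg b)
  sign-sg true  = 1>0
  sign-sg false = pos⇒neg 1>0

  ⟪_,_⟫ : ∀ {d} → (Fin d → ℝ) → (Fin d → ℝ) → ℝ
  ⟪_,_⟫ {d} a v = ∑ d (λ m → a m * v m)

  ⟪⟫-congˡ : ∀ {d} {a b v : Fin d → ℝ} → (∀ m → a m ≡ b m) → ⟪ a , v ⟫ ≡ ⟪ b , v ⟫
  ⟪⟫-congˡ {d} h = ∑-cong d (λ m → cong (_* _) (h m))

  ⟪⟫-+ʳ : ∀ {d} (a v w : Fin d → ℝ) s t → ⟪ a , (λ m → s * v m + t * w m) ⟫ ≡ s * ⟪ a , v ⟫ + t * ⟪ a , w ⟫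
  ⟪⟫-+ʳ {d} a v w s t = begin
    ∑ d (λ m → a m * (s * v m + t * w m))
      ≡⟨ ∑-cong d (λ m → solve 5 (λ a v w s t → a :* (s :* v :+ t :* w) := s :* (a :* v) :+ t :* (a :* w)) refl (a m) (v m) (w m) s t) ⟩
    ∑ d (λ m → s * (a m * v m) + t * (a m * w m)) ≡⟨ ∑-+ d _ _ ⟩
    ∑ d (λ m → s * (a m * v m)) + ∑ d (λ m → t * (a m * w m)) ≡⟨ cong₂ _+_ (∑-*ˡ d s _) (∑-*ˡ d t _) ⟩
    s * ⟪ a , v ⟫ + t * ⟪ a , w ⟫ ∎

  ⟪⟫-comm : ∀ {d} (a v : Fin d → ℝ) → ⟪ a , v ⟫ ≡ ⟪ v , a ⟫
  ⟪⟫-comm {d} a v = ∑-cong d (λ m → *-comm _ _)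

  ⟪⟫-+ˡ : ∀ {d} (v a b : Fin d → ℝ) s t → ⟪ (λ m → s * a m + t * b m) , v ⟫ ≡ s * ⟪ a , v ⟫ + t * ⟪ b , v ⟫
  ⟪⟫-+ˡ v a b s t = trans (⟪⟫-comm _ v) (trans (⟪⟫-+ʳ v a b s t) (cong₂ (λ x y → s * x + t * y) (⟪⟫-comm v a) (⟪⟫-comm v b)))

  ⟪⟫-∑ : ∀ {d} n (c : Fin n → ℝ) (β : Fin n → Fin d → ℝ) v →
    ⟪ (λ m → ∑ n (λ i → c i * β i m)) , v ⟫ ≡ ∑ n (λ i → c i * ⟪ β i , v ⟫)
  ⟪⟫-∑ {d} n c β v = begin
    ∑ d (λ m → ∑ n (λ i → c i * β i m) * v m)
      ≡⟨ ∑-cong d (λ m → trans (*-comm _ _) (sym (∑-*ˡ n (v m) _))) ⟩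
    ∑ d (λ m → ∑ n (λ i → v m * (c i * β i m))) ≡⟨ ∑-swap d n _ ⟩
    ∑ n (λ i → ∑ d (λ m → v m * (c i * β i m)))
      ≡⟨ ∑-cong n (λ i → trans (∑-cong d (λ m → solve 3 (λ v c b → v :* (c :* b) := c :* (b :* v)) refl (v m) (c i) (β i m))) (∑-*ˡ d (c i) _)) ⟩
    ∑ n (λ i → c i * ⟪ β i , v ⟫) ∎

  basis : ∀ {d} → Fin d → Fin d → ℝ
  basis k m = if does (m ≟ k) then 1r else 0r

  basis-on : ∀ {d} (k : Fin d) → basis k k ≡ 1r
  basis-on k with k ≟ k
  ... | yes _ = refl
  ... | no ¬e = contradiction refl ¬e

  basis-off : ∀ {d} (k i : Fin d) → i ≢ k → basis k i ≡ 0r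
  basis-off k i i≢k with i ≟ k
  ... | yes e = contradiction e i≢k
  ... | no _  = refl

  ⟪⟫-basis : ∀ {d} (a : Fin d → ℝ) k → ⟪ a , basis k ⟫ ≡ a k
  ⟪⟫-basis {d} a k = trans (∑-only d k (λ i i≢k → trans (cong (a i *_) (basis-off k i i≢k)) (*-zeroʳ _)))
    (trans (cong (a k *_) (basis-on k)) (*-idʳ _))

  Separated InSpan : ∀ {d} n → (Fin n → Fin d → ℝ) → (Fin d → ℝ) → Set
  Separated n β γ = ∃[ w ] ((∀ i → ⟪ β i , w ⟫ ≡ 0r) × ⟪ γ , w ⟫ ≡ 1r)
  InSpan n β γ = Σ (Fin n → ℝ) λ c → (∀ m → γ m ≡ ∑ n (λ i → c i * β i m))

  separated-or-inSpan : ∀ {d} n (β : Fin n → Fin d → ℝ) γ → Separated n β γ ⊎ InSpan n β γ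
  separated-or-inSpan {d} zero β γ with any? (λ m → ¬? (γ m ≟ℝ 0r))
  ... | yes (m , γm≢0) with *-inv (γ m) γm≢0
  -- The summand with coefficient 0 only brings the vector into the two-term form of `⟪⟫-+ʳ`.
  ...   | t , γm*t≡1 = inj₁ ((λ k → t * basis m k + 0r * basis m k) , (λ ()) ,
          trans (⟪⟫-+ʳ γ (basis m) (basis m) t 0r)
            (trans (solve 2 (λ t b → t :* b :+ con (0 , 0) :* b := b :* t) refl t _) (trans (cong (_* t) (⟪⟫-basis γ m)) γm*t≡1)))
  separated-or-inSpan {d} zero β γ | no ¬∃ = inj₂ ((λ ()) , λ m → decidable-stable (γ m ≟ℝ 0r) (λ γm≢0 → ¬∃ (m , γm≢0)))
  separated-or-inSpan (suc n) β γ with separated-or-inSpan n (β ∘ suc) (β zero)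
  ... | inj₂ (c , β₀∈span) with separated-or-inSpan n (β ∘ suc) γ
  ...   | inj₁ (w , βw≡0 , γw≡1) = inj₁ (w , vanish , γw≡1)
    where
    vanish : ∀ i → ⟪ β i , w ⟫ ≡ 0r
    vanish (suc i) = βw≡0 i
    vanish zero = trans (⟪⟫-congˡ β₀∈span) (trans (⟪⟫-∑ n c (β ∘ suc) w)
      (∑-zero n (λ i → trans (cong (c i *_) (βw≡0 i)) (*-zeroʳ _))))
  ...   | inj₂ (c′ , γ∈span) = inj₂ ((λ { zero → 0r ; (suc i) → c′ i }) ,
            λ m → trans (γ∈span m) (solve 2 (λ b s → s := con (0 , 0) :* b :+ s) refl (β zero m) _))
  separated-or-inSpan (suc n) β γ | inj₁ (w₁ , βw₁≡0 , β₀w₁≡1)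
    with separated-or-inSpan n (β ∘ suc) (λ m → 1r * γ m + - ⟪ γ , w₁ ⟫ * β zero m)
  ... | inj₁ (w , βw≡0 , γ′w≡1) = inj₁ (w′ , vanish , one)
    where
    t = - ⟪ β zero , w ⟫
    w′ = λ m → 1r * w m + t * w₁ m
    vanish : ∀ i → ⟪ β i , w′ ⟫ ≡ 0r
    vanish (suc i) = trans (⟪⟫-+ʳ (β (suc i)) w w₁ 1r t) (trans (cong₂ (λ x y → 1r * x + t * y) (βw≡0 i) (βw₁≡0 i))
      (solve 1 (λ t → con (1 , 0) :* con (0 , 0) :+ t :* con (0 , 0) := con (0 , 0)) refl t))
    vanish zero = trans (⟪⟫-+ʳ (β zero) w w₁ 1r t) (trans (cong (λ y → 1r * ⟪ β zero , w ⟫ + t * y) β₀w₁≡1)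
      (solve 1 (λ b → con (1 , 0) :* b :+ :- b :* con (1 , 0) := con (0 , 0)) refl ⟪ β zero , w ⟫))
    -- The two corrections are adjoint: `w′` pairs with `γ` exactly as `w` pairs with the reduced
    -- `γ`.
    one : ⟪ γ , w′ ⟫ ≡ 1r
    one = trans (⟪⟫-+ʳ γ w w₁ 1r t) (trans
      (solve 3 (λ g b h → con (1 , 0) :* g :+ :- b :* h := con (1 , 0) :* g :+ :- h :* b) refl ⟪ γ , w ⟫ ⟪ β zero , w ⟫ ⟪ γ , w₁ ⟫)
      (trans (sym (⟪⟫-+ˡ w γ (β zero) 1r (- ⟪ γ , w₁ ⟫))) γ′w≡1))
  ... | inj₂ (c , γ′∈span) = inj₂ ((λ { zero → ⟪ γ , w₁ ⟫ ; (suc i) → c i }) , λ m →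
          trans (solve 3 (λ g h b → g := h :* b :+ (con (1 , 0) :* g :+ :- h :* b)) refl (γ m) ⟪ γ , w₁ ⟫ (β zero m))
            (cong (⟪ γ , w₁ ⟫ * β zero m +_) (γ′∈span m)))

-- Dependence, dual vectors and circuits of an arrangement.

module Matroid (𝕣 : RealField) (A : Arrangements.Arrangement 𝕣) where
  open RealLemmas 𝕣
  open Arrangements 𝕣
  open Arrangement A
  open Solver using (solve; _:=_; _:+_; _:*_; _:-_; :-_; con)
  open ≡ using (refl; sym; trans; cong; cong₂)

  SeparatedOver InSpanOver : ∀ {p} (P : Fin n → Set p) → (Fin dim → ℝ) → Set p
  SeparatedOver P γ = ∃[ w ] ((∀ i → P i → eval i w ≡ 0r) × ⟪ γ , w ⟫ ≡ 1r)
  InSpanOver P γ = Σ (Fin n → ℝ) λ c → (∀ i → ¬ P i → c i ≡ 0r) × (∀ m → γ m ≡ ∑ n (λ i → c i * α i m))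

  -- Vectors outside `P` are replaced by 0 instead of being deleted, so the index set stays `Fin n`;
  -- their coefficients, which are then arbitrary, are reset to 0.
  separatedOver-or-inSpanOver : ∀ {p} {P : Fin n → Set p} → Decidable P → ∀ γ →
    SeparatedOver P γ ⊎ InSpanOver P γ
  separatedOver-or-inSpanOver {P = P} P? γ with separated-or-inSpan n masked γ
    where
    masked : Fin n → Fin dim → ℝ
    masked i m = if does (P? i) then α i m else 0r
  ... | inj₁ (w , vanish , one) = inj₁ (w , (λ i p → unmask i p (vanish i)) , one)
    where
    unmask : ∀ i → P i → ⟪ (λ m → if does (P? i) then α i m else 0r) , w ⟫ ≡ 0r → eval i w ≡ 0r
    unmask i p e with P? i
    ... | yes _ = e
    ... | no ¬p = contradiction p ¬p
  ... | inj₂ (c , γ∈span) = inj₂ ((λ i → if does (P? i) then c i else 0r) , outside ,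
          λ m → trans (γ∈span m) (∑-cong n (λ i → move i m)))
    where
    outside : ∀ i → ¬ P i → (if does (P? i) then c i else 0r) ≡ 0r
    outside i ¬p with P? i
    ... | yes p = contradiction p ¬p
    ... | no _  = refl
    move : ∀ i m → c i * (if does (P? i) then α i m else 0r) ≡ (if does (P? i) then c i else 0r) * α i m
    move i m with P? i
    ... | yes _ = refl
    ... | no _  = trans (*-zeroʳ _) (sym (*-zeroˡ _))

  relation-eval : ∀ {J c} → Relation J c → ∀ v → ∑ n (λ i → c i * eval i v) ≡ 0r
  relation-eval {c = c} (_ , rel , _) v =
    trans (sym (⟪⟫-∑ n c α v)) (∑-zero dim (λ m → trans (cong (_* v m) (rel m)) (*-zeroˡ _)))

  relation-neg : ∀ {J c} → Relation J c → Relation J (λ i → - c i)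
  relation-neg {J} {c} (supp , rel , nontriv) =
      (λ i i∉J → trans (cong -_ (supp i i∉J)) -0≡0)
    , (λ m → trans (trans (∑-cong n (λ i → solve 2 (λ c a → :- c :* a := :- (c :* a)) refl (c i) (α i m))) (∑-neg n _))
               (trans (cong -_ (rel m)) -0≡0))
    , λ triv → nontriv (λ i → trans (sym (-‿involutive (c i))) (trans (cong -_ (triv i)) -0≡0))

  -- A dual basis of `J`. It certifies independence and also supplies the vectors of the flags from
  -- which cubes are built.
  DualVectors : Subset n → Set
  DualVectors J = ∀ x → x ∈ J → ∃[ w ] ((∀ i → i ∈ J × i ≢ x → eval i w ≡ 0r) × eval x w ≡ 1r)

  -- If no element of `J` lies in the span of the others, the separating vectors are the dual ones.
  -- If `x` does, its expression `c` minus the basis vector at `x` is a relation, nontrivial because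
  -- `c` vanishes at `x` and leaves the coefficient -1 there.
  dependent-or-dualVectors : ∀ J → Dependent J ⊎ DualVectors J
  dependent-or-dualVectors J with find n {λ x → x ∈ J × InSpanOver (λ i → i ∈ J × i ≢ x) (α x)} split
    where
    split : ∀ x → (x ∈ J × InSpanOver (λ i → i ∈ J × i ≢ x) (α x)) ⊎
      (x ∈ J → SeparatedOver (λ i → i ∈ J × i ≢ x) (α x))
    split x with x ∈? J | separatedOver-or-inSpanOver (λ i → (i ∈? J) ×-dec ¬? (i ≟ x)) (α x)
    ... | no x∉J | _       = inj₂ λ x∈J → contradiction x∈J x∉J
    ... | yes _  | inj₁ s  = inj₂ λ _ → s
    ... | yes x∈J | inj₂ s = inj₁ (x∈J , s)
  ... | inj₂ duals = inj₂ duals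
  ... | inj₁ (x , x∈J , c , supp , span) = inj₁ (μ , supp′ , rel , λ triv → μx≢0 (triv x))
    where
    μ : Fin n → ℝ
    μ i = c i + - basis x i
    supp′ : ∀ i → i ∉ J → μ i ≡ 0r
    supp′ i i∉J = trans (cong₂ (λ a b → a + - b) (supp i (λ (i∈J , _) → i∉J i∈J))
        (basis-off x i (λ { refl → i∉J x∈J })))
      (solve 0 (con (0 , 0) :- con (0 , 0) := con (0 , 0)) refl)
    rel : ∀ m → ∑ n (λ i → μ i * α i m) ≡ 0r
    rel m = trans (∑-cong n (λ i → solve 3 (λ c b a → (c :- b) :* a := c :* a :+ (:- (a :* b))) refl (c i) (basis x i) (α i m)))
      (trans (∑-+ n _ _) (trans (cong₂ _+_ (sym (span m)) (trans (∑-neg n _) (cong -_ (⟪⟫-basis (λ i → α i m) x))))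
        (solve 1 (λ a → a :- a := con (0 , 0)) refl _)))
    μx≢0 : μ x ≢ 0r
    μx≢0 e = 0≢1 (trans (sym (trans (cong -_ e) -0≡0))
      (trans (cong₂ (λ a b → - (a + - b)) (supp x (λ (_ , x≢x) → x≢x refl)) (basis-on x))
             (solve 0 (:- (con (0 , 0) :- con (1 , 0)) := con (1 , 0)) refl)))

  dualVectors⇒independent : ∀ {J} → DualVectors J → ¬ Dependent J
  dualVectors⇒independent {J} duals (c , rel@(supp , _ , nontriv)) = nontriv c≡0
    where
    c≡0 : ∀ x → c x ≡ 0r
    c≡0 x with x ∈? J
    ... | no x∉J  = supp x x∉J
    ... | yes x∈J with duals x x∈J
    ...   | w , vanish , one = trans (sym (*-idʳ (c x))) (trans (cong (c x *_) (sym one))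
            (trans (sym (∑-only n x off)) (relation-eval rel w)))
      where
      off : ∀ i → i ≢ x → c i * eval i w ≡ 0r
      off i i≢x with i ∈? J
      ... | yes i∈J = trans (cong (c i *_) (vanish i (i∈J , i≢x))) (*-zeroʳ _)
      ... | no i∉J  = trans (cong (_* eval i w) (supp i i∉J)) (*-zeroˡ _)

  dependent? : ∀ J → Dec (Dependent J)
  dependent? J with dependent-or-dualVectors J
  ... | inj₁ dep   = yes dep
  ... | inj₂ duals = no (dualVectors⇒independent duals)

  circuit-support : ∀ {I c} → IsCircuit I → Relation I c → ∀ x → x ∈ I → c x ≢ 0r
  circuit-support {I} {c} (_ , minimal) (supp , rel , nontriv) x x∈I cx≡0 =
    minimal (I ∖ x) (x∈p⇒p-x⊂p x∈I) (c , supp′ , rel , nontriv)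
    where
    supp′ : ∀ i → i ∉ I ∖ x → c i ≡ 0r
    supp′ i i∉I∖x with i ≟ x
    ... | yes refl = cx≡0
    ... | no i≢x   = supp i (λ i∈I → i∉I∖x (x∈p∧x≢y⇒x∈p-y i∈I i≢x))

  -- Needed for the choice of signs, which runs through the pairs of indices lying on a common
  -- circuit.
  circuit? : ∀ I → Dec (IsCircuit I)
  circuit? I with dependent? I | anySubset? (λ J → (J ⊂? I) ×-dec dependent? J)
  ... | no indep | _                      = no (indep ∘ proj₁)
  ... | yes _    | yes (J , J⊂I , dep)    = no (λ (_ , minimal) → minimal J J⊂I dep)
  ... | yes dep  | no ¬smaller            = yes (dep , λ J J⊂I dep′ → ¬smaller (J , J⊂I , dep′))

  dependent⇒circuit : ∀ {K} → Dependent K → ∃[ I ] (I ⊆ K × IsCircuit I)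
  dependent⇒circuit {K} = go K (⊂-wellFounded K)
    where
    go : ∀ K → Acc _⊂_ K → Dependent K → ∃[ I ] (I ⊆ K × IsCircuit I)
    go K (acc rec) dep with anySubset? (λ J → (J ⊂? K) ×-dec dependent? J)
    ... | no ¬smaller = K , ⊆-refl , dep , λ J J⊂K dep′ → ¬smaller (J , J⊂K , dep′)
    ... | yes (J , J⊂K , dep′) with go J (rec J⊂K) dep′
    ...   | I , I⊆J , circ = I , ⊆-trans I⊆J (proj₁ J⊂K) , circ

  dependent-nonempty : ∀ {J} → Dependent J → ∃[ i ] i ∈ J
  dependent-nonempty {J} (c , supp , _ , nontriv) with any? (_∈? J)
  ... | yes i     = i
  ... | no ¬∃     = contradiction (λ i → supp i (λ i∈J → ¬∃ (i , i∈J))) nontriv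

  nonvanishing : ∀ i → ∃[ v ] eval i v ≡ 1r
  nonvanishing i with separatedOver-or-inSpanOver {P = λ _ → ⊥} (λ _ → no λ ()) (α i) | α≢0 i
  ... | inj₁ (v , _ , one)     | _         = v , one
  ... | inj₂ (c , supp , span) | m , αim≢0 = contradiction
    (trans (span m) (∑-zero n (λ j → trans (cong (_* α j m) (supp j λ ())) (*-zeroˡ _)))) αim≢0

  nonproportional : ∀ i k → i ≢ k → ∃[ v ] (eval i v ≡ 0r × eval k v ≡ 1r)
  nonproportional i k i≢k with separatedOver-or-inSpanOver (_≟ i) (α k)
  ... | inj₁ (v , vanish , one)  = v , vanish i refl , one
  ... | inj₂ (c , supp , span) = contradiction (c i , λ m → trans (span m)
          (∑-only n i (λ j j≢i → trans (cong (_* α j m) (supp j j≢i)) (*-zeroˡ _)))) (distinct k i (i≢k ∘ sym))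

  -- An expression of `α k` through `α i` and `α j` would make it vanish on the intersection of the
  -- two hyperplanes, against genericity. The other alternative is the required point.
  generic-point : GenericCodim2 → ∀ i j k → i ≢ j → k ≢ i → k ≢ j →
    ∃[ v ] (eval i v ≡ 0r × eval j v ≡ 0r × eval k v ≡ 1r)
  generic-point gen i j k i≢j k≢i k≢j with separatedOver-or-inSpanOver (λ l → (l ≟ i) ⊎-dec (l ≟ j)) (α k)
  ... | inj₁ (v , vanish , one) = v , vanish i (inj₁ refl) , vanish j (inj₂ refl) , one
  ... | inj₂ (c , supp , span) = contradiction vanish (gen i j k i≢j k≢i k≢j)
    where
    vanish : ∀ v → eval i v ≡ 0r → eval j v ≡ 0r → eval k v ≡ 0r
    vanish v iv≡0 jv≡0 = trans (⟪⟫-congˡ span) (trans (⟪⟫-∑ n c α v) (∑-zero n term))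
      where
      term : ∀ l → c l * eval l v ≡ 0r
      term l with l ≟ i | l ≟ j
      ... | yes refl | _        = trans (cong (c l *_) iv≡0) (*-zeroʳ _)
      ... | no _     | yes refl = trans (cong (c l *_) jv≡0) (*-zeroʳ _)
      ... | no l≢i   | no l≢j   = trans (cong (_* eval l v) (supp l [ l≢i , l≢j ]′)) (*-zeroˡ _)

-- Cubes of chambers from lexicographic flags.

module Cubes (𝕣 : RealField) (A : Arrangements.Arrangement 𝕣) where
  open RealLemmas 𝕣
  open Arrangements 𝕣
  open Arrangement A
  open Matroid 𝕣 A
  open Solver using (solve; _:=_; _:+_; _:*_; _:-_; :-_; con)
  open ≡ using (refl; sym; trans; cong; subst)

  orient : ∀ {K} → Maybe (Fin K) → (Fin K → Bool) → Bool
  orient nothing  ε = true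
  orient (just a) ε = ε a

  -- A K-dimensional cube of chambers in which every sign is constant or follows,
  -- up to orientation, a single coordinate of the cube.
  record Cube (K : ℕ) : Set where
    field
      coord  : Fin n → Maybe (Fin K)
      sign   : Fin n → Bool
    corner : (Fin K → Bool) → Fin n → Bool
    corner ε i = orient (coord i) ε ⊛ sign i
    field
      chamber : ∀ ε → IsChamber (corner ε)

  -- A list is read as a point v₀ + δ v₁ + δ² v₂ + ... with δ infinitesimal. The label `just a`
  -- multiplies its vector by the a-th sign of the corner; `nothing` leaves the vector fixed.
  Flag : ℕ → Set
  Flag K = List ((Fin dim → ℝ) × Maybe (Fin K))

  -- First i l (c , b): the first vector of l off the hyperplane i carries the label c and lies on its side b.
  data First {K} (i : Fin n) : Flag K → Maybe (Fin K) × Bool → Set where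
    here  : ∀ {v c b l} → HasSign b (eval i v) → First i ((v , c) ∷ l) (c , b)
    there : ∀ {v c l x} → eval i v ≡ 0r → First i l x → First i ((v , c) ∷ l) x

  First-unique : ∀ {K i x y} {l : Flag K} → First i l x → First i l y → x ≡ y
  First-unique (here p)            (here q)    = cong (_ ,_) (sign-unique p q)
  First-unique (here {b = b} p)    (there e _) = contradiction e (sign⇒≢0 b p)
  First-unique (there e _) (here {b = b} q)    = contradiction e (sign⇒≢0 b q)
  First-unique (there _ p)         (there _ q) = First-unique p q

  First-tabulate : ∀ {K i} m (f : Fin m → (Fin dim → ℝ) × Maybe (Fin K)) {l} a {b} →
    (∀ a′ → a′ ≢ a → eval i (proj₁ (f a′)) ≡ 0r) → HasSign b (eval i (proj₁ (f a))) →
    First i (tabulate f ++ l) (proj₂ (f a) , b)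
  First-tabulate (suc m) f zero    vanish p = here p
  First-tabulate (suc m) f (suc a) vanish p = there (vanish zero λ ())
    (First-tabulate m (f ∘ suc) a (λ a′ a′≢a → vanish (suc a′) (a′≢a ∘ suc-injective)) p)

  First-skip : ∀ {K i} m (f : Fin m → (Fin dim → ℝ) × Maybe (Fin K)) {l x} →
    (∀ a → eval i (proj₁ (f a)) ≡ 0r) → First i l x → First i (tabulate f ++ l) x
  First-skip zero    f vanish p = p
  First-skip (suc m) f vanish p = there (vanish zero) (First-skip m (f ∘ suc) (vanish ∘ suc) p)

  First-exists : ∀ {K i} m (f : Fin m → (Fin dim → ℝ) × Maybe (Fin K)) {l} a →
    eval i (proj₁ (f a)) ≢ 0r → ∃[ a′ ] ∃[ b ] First i (tabulate f ++ l) (proj₂ (f a′) , b)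
  First-exists {i = i} (suc m) f a a≢0 with sign? (eval i (proj₁ (f zero)))
  ... | inj₂ (b , p) = zero , b , here p
  First-exists (suc m) f zero    a≢0 | inj₁ e = contradiction e a≢0
  First-exists (suc m) f (suc a) a≢0 | inj₁ e with First-exists m (f ∘ suc) a a≢0
  ... | a′ , b , p = suc a′ , b , there e p

  First-++ : ∀ {K i x} (l : Flag K) {l′} → First i l′ x → ∃[ y ] First i (l ++ l′) y
  First-++ [] p = _ , p
  First-++ {i = i} ((v , c) ∷ l) p with sign? (eval i v) | First-++ l p
  ... | inj₂ (b , q) | _      = (c , b) , here q
  ... | inj₁ e       | _ , q  = _ , there e q

  -- A point realising the lexicographic signs: earlier vectors are scaled to dominate later ones.
  lexPoint : ∀ {K} (l : Flag K) ε → ∃[ w ] (∀ i {c b} → First i l (c , b) → HasSign (orient c ε ⊛ b) (eval i w))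
  lexPoint []            ε = (λ _ → 0r) , λ i ()
  lexPoint ((v , c) ∷ l) ε with lexPoint l ε
  ... | w , w-signs = w′ , w′-signs
    where
    s = sg (orient c ε)
    threshold : ∀ i → ∃[ M₀ ] (∀ M → M₀ ≤ M → ∀ b → HasSign b (eval i v) →
      HasSign (orient c ε ⊛ b) (M * (s * eval i v) + eval i w))
    threshold i with sign? (eval i v)
    -- A hyperplane through `v` puts no condition on M; the threshold 0 is a placeholder.
    ... | inj₁ e = 0r , λ M _ b p → contradiction e (sign⇒≢0 b p)
    ... | inj₂ (b , p) with dominates (orient c ε ⊛ b) (eval i w) (sign-* (orient c ε) b (sign-sg (orient c ε)) p)
    ...   | M₀ , large = M₀ , λ M M₀≤M b′ p′ →
            subst (λ b → HasSign (orient c ε ⊛ b) (M * (s * eval i v) + eval i w)) (sign-unique p p′) (large M M₀≤M)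
    bound = bounded n (proj₁ ∘ threshold)
    M = proj₁ bound
    w′ = λ m → (M * s) * v m + 1r * w m
    eval-w′ : ∀ i → eval i w′ ≡ M * (s * eval i v) + eval i w
    eval-w′ i = trans (⟪⟫-+ʳ (α i) v w (M * s) 1r)
      (solve 4 (λ M s x y → (M :* s) :* x :+ con (1 , 0) :* y := M :* (s :* x) :+ y) refl M s (eval i v) (eval i w))
    w′-signs : ∀ i {c′ b} → First i ((v , c) ∷ l) (c′ , b) → HasSign (orient c′ ε ⊛ b) (eval i w′)
    w′-signs i {b = b} (here p) = subst (HasSign (orient c ε ⊛ b)) (sym (eval-w′ i)) (proj₂ (threshold i) M (proj₂ bound i) b p)
    w′-signs i {c′} {b} (there e q) = subst (HasSign (orient c′ ε ⊛ b))
      (sym (trans (eval-w′ i) (trans (cong (λ z → M * (s * z) + eval i w) e)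
        (solve 3 (λ M s y → M :* (s :* con (0 , 0)) :+ y := y) refl M s (eval i w)))))
      (w-signs i q)

  -- No `α i` vanishes on the whole standard basis, so after appending it every hyperplane receives
  -- a sign. Coming last, the basis leaves signs already settled unchanged.
  complete : ∀ {K} → Flag K → Flag K
  complete l = l ++ (tabulate (λ m → basis m , nothing) ++ [])

  First-complete : ∀ {K} (l : Flag K) i → ∃[ x ] First i (complete l) x
  First-complete l i with α≢0 i
  ... | m , αim≢0 = First-++ l (proj₂ (proj₂ (First-exists dim (λ m → basis m , nothing) m
        (λ e → αim≢0 (trans (sym (⟪⟫-basis (α i) m)) e)))))

  cube : ∀ {K} → Flag K → Cube K
  cube l = record
    { coord = λ i → proj₁ (proj₁ (First-complete l i))
    ; sign = λ i → proj₂ (proj₁ (First-complete l i))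
    ; chamber = λ ε → let w , w-signs = lexPoint (complete l) ε in w , λ i →
        let p = w-signs i (proj₂ (First-complete l i)) in
        (λ e → subst (λ b → HasSign b (eval i w)) e p) , (λ e → subst (λ b → HasSign b (eval i w)) e p)
    }

  At : ∀ {K} → Cube K → Fin n → Maybe (Fin K) → Bool → Set
  At C i c b = Cube.coord C i ≡ c × Cube.sign C i ≡ b

  cube-at : ∀ {K} (l : Flag K) i {c b} → First i (complete l) (c , b) → At (cube l) i c b
  cube-at l i p with First-unique (proj₂ (First-complete l i)) p
  ... | refl = refl , refl

  -- Duality makes `w a` the first flag vector off `e a`. Since `e zero` is held constant, the k
  -- coordinates belong to the other k hyperplanes: of the products omitting one index, only the one
  -- omitting `zero` uses them all.
  independentCube : ∀ {k} (e : Fin (suc k) → Fin n) (w : Fin (suc k) → Fin dim → ℝ) →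
    (∀ a → eval (e a) (w a) ≡ 1r) → (∀ a b → a ≢ b → eval (e a) (w b) ≡ 0r) →
    ∃[ C ] (At {k} C (e zero) nothing true × (∀ a → At C (e (suc a)) (just a) true))
  independentCube {k} e w one off = cube l ,
    cube-at l (e zero) (here (1>0′ (one zero))) ,
    λ a → cube-at l (e (suc a)) (there (off (suc a) zero λ ())
      (First-tabulate k (λ a → w (suc a) , just a) a (λ a′ a′≢a → off (suc a) (suc a′) (a′≢a ∘ sym ∘ suc-injective)) (1>0′ (one (suc a)))))
    where
    1>0′ : ∀ {x} → x ≡ 1r → 0r < x
    1>0′ refl = 1>0
    l : Flag k
    l = (w zero , nothing) ∷ tabulate (λ a → w (suc a) , just a)

  -- The vector `w zero` heads the flag, so it alone settles the sign of `e zero`, whatever the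
  -- values at later vectors. Thus `e zero` and `e (suc zero)` share a coordinate, and exactly the
  -- products omitting one of these two use every coordinate.
  circuitCube : ∀ {k} (e : Fin (suc (suc k)) → Fin n) (w : Fin (suc k) → Fin dim → ℝ) →
    (∀ a → eval (e (suc a)) (w a) ≡ 1r) → (∀ a b → a ≢ b → eval (e (suc a)) (w b) ≡ 0r) →
    ∀ {b} → HasSign b (eval (e zero) (w zero)) →
    ∃[ C ] (At {suc k} C (e zero) (just zero) b × (∀ a → At C (e (suc a)) (just a) true))
  circuitCube {k} e w one off p = cube l , cube-at l (e zero) (here p) ,
    λ a → cube-at l (e (suc a)) (First-tabulate (suc k) (λ a → w a , just a) a (λ a′ a′≢a → off a a′ (a′≢a ∘ sym))
      (subst (0r <_) (sym (one a)) 1>0))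
    where
    l : Flag (suc k)
    l = tabulate (λ a → w a , just a)

  -- The vectors from `others` come first, with constant labels. They lie on all the hyperplanes
  -- `t a`, and each remaining hyperplane misses one of them, so its sign is fixed before any cube
  -- coordinate enters.
  isolatingCube : ∀ {K} (t : Fin K → Fin n) (w : Fin K → Fin dim → ℝ) →
    (∀ a → eval (t a) (w a) ≡ 1r) → (∀ a b → a ≢ b → eval (t a) (w b) ≡ 0r) →
    (∀ k → (∀ a → k ≢ t a) → ∃[ v ] ((∀ a → eval (t a) v ≡ 0r) × eval k v ≡ 1r)) →
    ∃[ C ] ((∀ a → At {K} C (t a) (just a) true) × (∀ k → (∀ a → k ≢ t a) → Cube.coord C k ≡ nothing))
  isolatingCube {K} t w one off others = cube l , at , constant
    where
    sep : Fin n → Fin dim → ℝ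
    sep k with any? (λ a → k ≟ t a)
    -- For an index in `t` the zero vector fills the slot: it lies on every hyperplane and is
    -- skipped.
    ... | yes _ = λ _ → 0r
    ... | no ¬∃ = proj₁ (others k (λ a e → ¬∃ (a , e)))
    sep-vanish : ∀ k a → eval (t a) (sep k) ≡ 0r
    sep-vanish k a with any? (λ a → k ≟ t a)
    ... | yes _ = ∑-zero dim (λ m → *-zeroʳ _)
    ... | no ¬∃ = proj₁ (proj₂ (others k (λ a e → ¬∃ (a , e)))) a
    sep-one : ∀ k → (∀ a → k ≢ t a) → eval k (sep k) ≡ 1r
    sep-one k k∉t with any? (λ a → k ≟ t a)
    ... | yes (a , e) = contradiction e (k∉t a)
    ... | no ¬∃ = proj₂ (proj₂ (others k (λ a e → ¬∃ (a , e))))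
    l : Flag K
    l = tabulate (λ k → sep k , nothing) ++ tabulate (λ a → w a , just a)
    assoc : complete l ≡ tabulate (λ k → sep k , nothing) ++ complete (tabulate (λ a → w a , just a))
    assoc = ++-assoc (tabulate (λ k → sep k , nothing)) (tabulate (λ a → w a , just a)) _
    at : ∀ a → At (cube l) (t a) (just a) true
    at a = cube-at l (t a) (subst (λ z → First (t a) z (just a , true)) (sym assoc)
      (First-skip n (λ k → sep k , nothing) (λ k → sep-vanish k a)
        (First-tabulate K (λ a → w a , just a) a (λ a′ a′≢a → off a a′ (a′≢a ∘ sym)) (subst (0r <_) (sym (one a)) 1>0))))
    constant : ∀ k → (∀ a → k ≢ t a) → Cube.coord (cube l) k ≡ nothing
    constant k k∉t with First-exists n (λ k → sep k , nothing) {complete (tabulate (λ a → w a , just a))} k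
                          (λ e → 0≢1 (trans (sym e) (sep-one k k∉t)))
    ... | _ , b , p = proj₁ (cube-at l k (subst (λ z → First k z (nothing , b)) (sym assoc) p))

-- Alternating sums over a cube.

module CubeSums {c ℓ} (R : CommutativeRing c ℓ) where
  open CommutativeRing R renaming (Carrier to Rc) hiding (zero)
  open RingLemmas R
  open Solver using (solve; _:=_; _:+_; _:*_; _:-_; :-_; con)

  cons : ∀ {K} → Bool → (Fin K → Bool) → Fin (suc K) → Bool
  cons b ε zero    = b
  cons b ε (suc a) = ε a

  alternating : ∀ K → ((Fin K → Bool) → Rc) → Rc
  alternating zero    F = F λ ()
  alternating (suc K) F = alternating K (λ ε → F (cons true ε)) - alternating K (λ ε → F (cons false ε))

  alternating-cong : ∀ K {F G} → (∀ ε → F ε ≈ G ε) → alternating K F ≈ alternating K G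
  alternating-cong zero    h = h λ ()
  alternating-cong (suc K) h =
    +-cong (alternating-cong K (λ ε → h (cons true ε))) (-‿cong (alternating-cong K (λ ε → h (cons false ε))))

  alternating-0 : ∀ K → alternating K (λ _ → 0#) ≈ 0#
  alternating-0 zero    = refl
  alternating-0 (suc K) = -‿inverseʳ _

  alternating-+ : ∀ K F G → alternating K (λ ε → F ε + G ε) ≈ alternating K F + alternating K G
  alternating-+ zero    F G = refl
  alternating-+ (suc K) F G = trans (+-cong (alternating-+ K _ _) (-‿cong (alternating-+ K _ _)))
    (solve 4 (λ a b c d → (a :+ b) :- (c :+ d) := (a :- c) :+ (b :- d)) refl _ _ _ _)

  alternating-* : ∀ K r F → alternating K (λ ε → r * F ε) ≈ r * alternating K F
  alternating-* zero    r F = refl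
  alternating-* (suc K) r F = trans (+-cong (alternating-* K r _) (-‿cong (alternating-* K r _)))
    (solve 3 (λ r a b → r :* a :- r :* b := r :* (a :- b)) refl _ _ _)

  alternating-∑ : ∀ K m (F : Fin m → (Fin K → Bool) → Rc) →
    alternating K (λ ε → ∑ m (λ i → F i ε)) ≈ ∑ m (λ i → alternating K (F i))
  alternating-∑ K zero    F = alternating-0 K
  alternating-∑ K (suc m) F = trans (alternating-+ K _ _) (+-congˡ (alternating-∑ K m _))

  -- The two faces in direction `j` cancel. Invariance is stated for any two corners agreeing off
  -- `j`, instead of through an update at `j`, because this form passes to the halves obtained by
  -- fixing coordinate `zero`.
  alternating-independent : ∀ K {F} j → (∀ ε ε′ → (∀ a → a ≢ j → ε a ≡ ε′ a) → F ε ≈ F ε′) → alternating K F ≈ 0#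
  alternating-independent (suc K) {F} zero    h = trans
    (+-congʳ (alternating-cong K (λ ε → h (cons true ε) (cons false ε) (λ { zero ne → contradiction ≡.refl ne ; (suc a) _ → ≡.refl }))))
    (-‿inverseʳ _)
  alternating-independent (suc K) {F} (suc j) h = trans (+-cong (half true) (-‿cong (half false))) (-‿inverseʳ 0#)
    where
    half : ∀ b → alternating K (λ ε → F (cons b ε)) ≈ 0#
    half b = alternating-independent K j (λ ε ε′ agree → h (cons b ε) (cons b ε′)
      (λ { zero _ → ≡.refl ; (suc a) ne → agree a (ne ∘ ≡.cong suc) }))

  alternating-∏ : ∀ K (g : Fin K → Bool → Rc) →
    alternating K (λ ε → ∏ K (λ a → g a (ε a))) ≈ ∏ K (λ a → g a true - g a false)
  alternating-∏ zero    g = refl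
  alternating-∏ (suc K) g = trans (+-cong (alternating-* K _ _) (-‿cong (alternating-* K _ _)))
    (trans (solve 3 (λ a b c → a :* c :- b :* c := (a :- b) :* c) refl _ _ _) (*-congˡ (alternating-∏ K (g ∘ suc))))

-- Exponent vectors of small degree.

module Exponents where
  open ≡ using (refl; sym; trans; cong; cong₂)

  ∑ℕ : ∀ n → (Fin n → ℕ) → ℕ
  ∑ℕ = big ℕ._+_ 0

  ∑ℕ-+ : ∀ n f g → ∑ℕ n (λ i → f i ℕ.+ g i) ≡ ∑ℕ n f ℕ.+ ∑ℕ n g
  ∑ℕ-+ zero    f g = refl
  ∑ℕ-+ (suc n) f g rewrite ∑ℕ-+ n (f ∘ suc) (g ∘ suc) = interchange (f zero) (g zero) _ _
    where open import Algebra.Properties.CommutativeSemigroup ℕₚ.+-commutativeSemigroup using (interchange)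

  ∑ℕ-zero : ∀ n {f} → (∀ i → f i ≡ 0) → ∑ℕ n f ≡ 0
  ∑ℕ-zero zero    h = refl
  ∑ℕ-zero (suc n) h = cong₂ ℕ._+_ (h zero) (∑ℕ-zero n (h ∘ suc))

  indicator : ∀ {n} → Fin n → Fin n → ℕ
  indicator k i = if does (i ≟ k) then 1 else 0

  ∑ℕ-indicator : ∀ {n} (k : Fin n) → ∑ℕ n (indicator k) ≡ 1
  ∑ℕ-indicator {suc n} zero    = cong suc (∑ℕ-zero n (λ _ → refl))
  ∑ℕ-indicator {suc n} (suc k) = ∑ℕ-indicator k

  without : ∀ {n} → Fin n → (Fin n → ℕ) → Fin n → ℕ
  without k e i = if does (i ≟ k) then 0 else e i

  ∑ℕ-without : ∀ n k e → ∑ℕ n e ≡ e k ℕ.+ ∑ℕ n (without k e)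
  ∑ℕ-without (suc n) zero    e = refl
  ∑ℕ-without (suc n) (suc k) e rewrite ∑ℕ-without n k (e ∘ suc) = x∙yz≈y∙xz (e zero) (e (suc k)) _
    where open import Algebra.Properties.CommutativeSemigroup ℕₚ.+-commutativeSemigroup using (x∙yz≈y∙xz)

  injection⇒≤∑ℕ : ∀ K n (g : Fin K → Fin n) e → (∀ a b → g a ≡ g b → a ≡ b) → (∀ a → e (g a) ≢ 0) → K ℕ.≤ ∑ℕ n e
  injection⇒≤∑ℕ zero    n g e inj pos = ℕ.z≤n
  injection⇒≤∑ℕ (suc K) n g e inj pos rewrite ∑ℕ-without n (g zero) e =
    ℕₚ.+-mono-≤ (ℕₚ.n≢0⇒n>0 (pos zero))
      (injection⇒≤∑ℕ K n (g ∘ suc) (without (g zero) e) (λ a b q → suc-injective (inj (suc a) (suc b) q)) pos′)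
    where
    pos′ : ∀ a → without (g zero) e (g (suc a)) ≢ 0
    pos′ a with g (suc a) ≟ g zero
    ... | yes q = contradiction (inj (suc a) zero q) λ ()
    ... | no _  = pos (suc a)

  -- Pigeonhole: otherwise each of the K coordinates is followed by a variable of positive exponent.
  -- A variable follows at most one coordinate, so these variables are distinct and the degree is at
  -- least K.
  unused-coordinate : ∀ K n (d : Fin n → Maybe (Fin K)) e → ∑ℕ n e ℕ.< K → ∃[ j ] (∀ i → d i ≡ just j → e i ≡ 0)
  unused-coordinate K n d e small with find K {λ j → ∀ i → d i ≡ just j → e i ≡ 0} {λ j → ∃[ i ] (d i ≡ just j × e i ≢ 0)} split
    where
    split : ∀ j → (∀ i → d i ≡ just j → e i ≡ 0) ⊎ (∃[ i ] (d i ≡ just j × e i ≢ 0))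
    split j with any? (λ i → (Maybeₚ.≡-dec _≟_ (d i) (just j)) ×-dec ¬? (e i ℕ.≟ 0))
    ... | yes w = inj₂ w
    ... | no ¬w = inj₁ λ i q → decidable-stable (e i ℕ.≟ 0) (λ ne → ¬w (i , q , ne))
  ... | inj₁ found = found
  ... | inj₂ used  = contradiction
    (injection⇒≤∑ℕ K n (proj₁ ∘ used) e
      (λ a b q → just-injective (trans (sym (proj₁ (proj₂ (used a)))) (trans (cong d q) (proj₁ (proj₂ (used b))))))
      (λ a → proj₂ (proj₂ (used a))))
    (ℕₚ.<⇒≱ small)
    where open Maybeₚ using (just-injective)

  degree≤1 : ∀ n e → ∑ℕ n e ℕ.≤ 1 → (∀ i → e i ≡ 0) ⊎ (∃[ k ] (e k ≡ 1 × (∀ i → i ≢ k → e i ≡ 0)))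
  degree≤1 zero    e le = inj₁ λ ()
  degree≤1 (suc n) e le with e zero in e₀
  ... | zero with degree≤1 n (e ∘ suc) le
  ...   | inj₁ z = inj₁ λ { zero → e₀ ; (suc i) → z i }
  ...   | inj₂ (k , one , others) = inj₂ (suc k , one , λ { zero _ → e₀ ; (suc i) ne → others i (ne ∘ cong suc) })
  degree≤1 (suc n) e (ℕ.s≤s le) | suc m = inj₂ (zero , trans e₀ (cong suc (ℕₚ.m+n≡0⇒m≡0 m sum≡0)) ,
    λ { zero ne → contradiction refl ne ; (suc i) _ → summand≡0 n (e ∘ suc) (ℕₚ.m+n≡0⇒n≡0 m sum≡0) i })
    where
    sum≡0 = ℕₚ.n≤0⇒n≡0 le
    summand≡0 : ∀ n f → ∑ℕ n f ≡ 0 → ∀ i → f i ≡ 0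
    summand≡0 (suc n) f z zero    = ℕₚ.m+n≡0⇒m≡0 (f zero) z
    summand≡0 (suc n) f z (suc i) = summand≡0 n (f ∘ suc) (ℕₚ.m+n≡0⇒n≡0 (f zero) z) i

-- The filtration, congruence modulo lower degree, and cube functionals.

module Filtration {c ℓ} (R : CommutativeRing c ℓ) (𝕣 : RealField) (A : Arrangements.Arrangement 𝕣) where
  open CommutativeRing R renaming (Carrier to Rc) hiding (zero)
  open import Relation.Binary.Reasoning.Setoid setoid
  open RingLemmas R
  open CubeSums R
  open Exponents
  open Arrangements 𝕣
  open Arrangement A
  open Cubes 𝕣 A
  open VG R 𝕣
  open Solver using (solve; _:=_; _:+_; _:*_; _:-_; :-_; con)

  monomial : ∀ {m} → (Fin m → ℕ) → (Fin m → Rc) → Rc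
  monomial {m} e z = ∏ m (λ i → pow (z i) (e i))

  pow-+ : ∀ x a b → pow x (a ℕ.+ b) ≈ pow x a * pow x b
  pow-+ x zero    b = sym (*-identityˡ _)
  pow-+ x (suc a) b = trans (*-congˡ (pow-+ x a b)) (sym (*-assoc _ _ _))

  pow-zero : ∀ {x e} → e ≡ 0 → pow x e ≈ 1#
  pow-zero ≡.refl = refl

  pow-one : ∀ {x e} → e ≡ 1 → pow x e ≈ x
  pow-one ≡.refl = *-identityʳ _

  monomial-single : ∀ {m} e (z : Fin m → Rc) k → e k ≡ 1 → (∀ i → i ≢ k → e i ≡ 0) → monomial e z ≈ z k
  monomial-single {suc m} e z zero    one others =
    trans (*-cong (pow-one one) (∏-one m (λ i → pow-zero (others (suc i) λ ())))) (*-identityʳ _)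
  monomial-single {suc m} e z (suc k) one others =
    trans (*-cong (pow-zero (others zero λ ())) (monomial-single (e ∘ suc) (z ∘ suc) k one (λ i ne → others (suc i) (ne ∘ suc-injective)))) (*-identityˡ _)

  scalePoly : ∀ {m} → Rc → (Fin m → ℕ) → Poly m → Poly m
  scalePoly a e []             = []
  scalePoly a e ((b , e′) ∷ G) = (a * b , (λ i → e i ℕ.+ e′ i)) ∷ scalePoly a e G

  mulPoly : ∀ {m} → Poly m → Poly m → Poly m
  mulPoly []            H = []
  mulPoly ((a , e) ∷ G) H = scalePoly a e H ++ mulPoly G H

  evalPoly-++ : ∀ {m} (G H : Poly m) z → evalPoly (G ++ H) z ≈ evalPoly G z + evalPoly H z
  evalPoly-++ []      H z = sym (+-identityˡ _)
  evalPoly-++ (_ ∷ G) H z = trans (+-congˡ (evalPoly-++ G H z)) (sym (+-assoc _ _ _))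

  evalPoly-scale : ∀ {m} a e (G : Poly m) z → evalPoly (scalePoly a e G) z ≈ a * monomial e z * evalPoly G z
  evalPoly-scale a e [] z = sym (zeroʳ _)
  evalPoly-scale {m} a e ((b , e′) ∷ G) z = begin
    a * b * monomial (λ i → e i ℕ.+ e′ i) z + evalPoly (scalePoly a e G) z
      ≈⟨ +-cong (*-congˡ (trans (∏-cong m (λ i → pow-+ (z i) (e i) (e′ i))) (∏-* m _ _))) (evalPoly-scale a e G z) ⟩
    a * b * (monomial e z * monomial e′ z) + a * monomial e z * evalPoly G z
      ≈⟨ solve 5 (λ a b x y p → a :* b :* (x :* y) :+ a :* x :* p := a :* x :* (b :* y :+ p)) refl a b _ _ _ ⟩
    a * monomial e z * (b * monomial e′ z + evalPoly G z) ∎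

  evalPoly-mul : ∀ {m} (G H : Poly m) z → evalPoly (mulPoly G H) z ≈ evalPoly G z * evalPoly H z
  evalPoly-mul []            H z = sym (zeroˡ _)
  evalPoly-mul ((a , e) ∷ G) H z = trans (evalPoly-++ (scalePoly a e H) (mulPoly G H) z)
    (trans (+-cong (evalPoly-scale a e H z) (evalPoly-mul G H z)) (sym (distribʳ _ _ _)))

  DegLe-++ : ∀ {m k} (G H : Poly m) → DegLe G k → DegLe H k → DegLe (G ++ H) k
  DegLe-++ []      H _        h = h
  DegLe-++ (_ ∷ G) H (g , gs) h = g , DegLe-++ G H gs h

  DegLe-scale : ∀ {m j k} a e (G : Poly m) → totalDeg e ℕ.≤ j → DegLe G k → DegLe (scalePoly a e G) (j ℕ.+ k)
  DegLe-scale a e [] _ _ = _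
  DegLe-scale {m} {j} {k} a e ((b , e′) ∷ G) le (g , gs) =
    ≡.subst (ℕ._≤ j ℕ.+ k) (≡.sym (∑ℕ-+ m e e′)) (ℕₚ.+-mono-≤ le g) , DegLe-scale a e G le gs

  DegLe-mul : ∀ {m j k} (G H : Poly m) → DegLe G j → DegLe H k → DegLe (mulPoly G H) (j ℕ.+ k)
  DegLe-mul []            H _        h = _
  DegLe-mul ((a , e) ∷ G) H (g , gs) h = DegLe-++ (scalePoly a e H) (mulPoly G H) (DegLe-scale a e H g h) (DegLe-mul G H gs h)

  X : Fin n → VGel A
  X = x⁺ A

  point : (Fin n → Bool) → Fin n → Rc
  point s i = X i s

  pointwise : ∀ {f g : VGel A} → (∀ s → f s ≈ g s) → _≋_ A f g
  pointwise h s _ = h s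

  Fil-cong : ∀ {k f g} → _≋_ A f g → Fil A k f → Fil A k g
  Fil-cong f≋g (G , deg , f≋G) = G , deg , λ s ch → trans (sym (f≋g s ch)) (f≋G s ch)

  Fil-+ : ∀ {k f g} → Fil A k f → Fil A k g → Fil A k (λ s → f s + g s)
  Fil-+ (G , dG , f≋G) (H , dH , g≋H) = G ++ H , DegLe-++ G H dG dH ,
    λ s ch → trans (+-cong (f≋G s ch) (g≋H s ch)) (sym (evalPoly-++ G H (point s)))

  Fil-* : ∀ {j k f g} → Fil A j f → Fil A k g → Fil A (j ℕ.+ k) (λ s → f s * g s)
  Fil-* (G , dG , f≋G) (H , dH , g≋H) = mulPoly G H , DegLe-mul G H dG dH ,
    λ s ch → trans (*-cong (f≋G s ch) (g≋H s ch)) (sym (evalPoly-mul G H (point s)))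

  Fil-const : ∀ {k} r → Fil A k (λ _ → r)
  Fil-const {k} r = (r , λ _ → 0) ∷ [] , (≡.subst (ℕ._≤ k) (≡.sym (∑ℕ-zero n {λ _ → 0} (λ _ → ≡.refl))) ℕ.z≤n , _) ,
    λ s _ → sym (trans (+-identityʳ _) (trans (*-congˡ (∏-one n (λ _ → refl))) (*-identityʳ r)))

  Fil-X : ∀ i → Fil A 1 (X i)
  Fil-X i = (1# , indicator i) ∷ [] , (ℕₚ.≤-reflexive (∑ℕ-indicator i) , _) ,
    λ s _ → sym (trans (+-identityʳ _) (trans (*-identityˡ _)
      (monomial-single (indicator i) (point s) i (on i) off)))
    where
    on : ∀ i → indicator i i ≡ 1
    on i with i ≟ i
    ... | yes _ = ≡.refl
    ... | no ne = contradiction ≡.refl ne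
    off : ∀ j → j ≢ i → indicator i j ≡ 0
    off j j≢i with j ≟ i
    ... | yes e = contradiction e j≢i
    ... | no _  = ≡.refl

  Fil-scale : ∀ {k f} r → Fil A k f → Fil A k (λ s → r * f s)
  Fil-scale r p = Fil-* {0} (Fil-const r) p

  Fil-∑ : ∀ {k} m (f : Fin m → VGel A) → (∀ i → Fil A k (f i)) → Fil A k (λ s → ∑ m (λ i → f i s))
  Fil-∑ zero    f h = Fil-const 0#
  Fil-∑ (suc m) f h = Fil-+ (h zero) (Fil-∑ m (f ∘ suc) (h ∘ suc))

  Fil-∏ : ∀ m (f : Fin m → VGel A) → (∀ i → Fil A 1 (f i)) → Fil A m (λ s → ∏ m (λ i → f i s))
  Fil-∏ zero    f h = Fil-const 1#
  Fil-∏ (suc m) f h = Fil-* (h zero) (Fil-∏ m (f ∘ suc) (h ∘ suc))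

  Fil⁻-cong : ∀ k {f g} → _≋_ A f g → Fil⁻ A k f → Fil⁻ A k g
  Fil⁻-cong zero    f≋g (lift f≋0) = lift λ s ch → trans (sym (f≋g s ch)) (f≋0 s ch)
  Fil⁻-cong (suc k) f≋g p          = Fil-cong f≋g p

  Fil⁻-0 : ∀ k {f} → _≋_ A f (λ _ → 0#) → Fil⁻ A k f
  Fil⁻-0 zero    f≋0 = lift f≋0
  Fil⁻-0 (suc k) f≋0 = Fil-cong (λ s ch → sym (f≋0 s ch)) (Fil-const 0#)

  Fil⁻-+ : ∀ k {f g} → Fil⁻ A k f → Fil⁻ A k g → Fil⁻ A k (λ s → f s + g s)
  Fil⁻-+ zero    (lift f≋0) (lift g≋0) = lift λ s ch → trans (+-cong (f≋0 s ch) (g≋0 s ch)) (+-identityʳ 0#)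
  Fil⁻-+ (suc k) p q                   = Fil-+ p q

  Fil⁻-* : ∀ j k {f g} → Fil⁻ A j f → Fil A k g → Fil⁻ A (j ℕ.+ k) (λ s → f s * g s)
  Fil⁻-* zero    k (lift f≋0) q = Fil⁻-0 k λ s ch → trans (*-congʳ (f≋0 s ch)) (zeroˡ _)
  Fil⁻-* (suc j) k p          q = Fil-* p q

  Fil⁻-*ˡ : ∀ j k {f g} → Fil A j f → Fil⁻ A k g → Fil⁻ A (j ℕ.+ k) (λ s → f s * g s)
  Fil⁻-*ˡ j k {f} {g} p q = ≡.subst (λ i → Fil⁻ A i (λ s → f s * g s)) (ℕₚ.+-comm k j)
    (Fil⁻-cong (k ℕ.+ j) (pointwise λ s → *-comm _ _) (Fil⁻-* k j q p))

  Fil⁻-scale : ∀ k {f} r → Fil⁻ A k f → Fil⁻ A k (λ s → r * f s)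
  Fil⁻-scale k r p = Fil⁻-*ˡ 0 k (Fil-const r) p

  ∼-refl : ∀ k {f g} → (∀ s → f s ≈ g s) → _∼[_]_ A f k g
  ∼-refl k f≈g = Fil⁻-0 k λ s _ → trans (+-congʳ (f≈g s)) (-‿inverseʳ _)

  ∼-sym : ∀ k {f g} → _∼[_]_ A f k g → _∼[_]_ A g k f
  ∼-sym k {f} {g} p = Fil⁻-cong k (pointwise λ s →
    solve 2 (λ f g → (:- con (1 , 0)) :* (f :- g) := g :- f) refl (f s) (g s)) (Fil⁻-scale k (- 1#) p)

  ∼-trans : ∀ k {f g h} → _∼[_]_ A f k g → _∼[_]_ A g k h → _∼[_]_ A f k h
  ∼-trans k {f} {g} {h} p q = Fil⁻-cong k (pointwise λ s →
    solve 3 (λ f g h → (f :- g) :+ (g :- h) := f :- h) refl (f s) (g s) (h s)) (Fil⁻-+ k p q)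

  ∼-+ : ∀ k {f f′ g g′} → _∼[_]_ A f k f′ → _∼[_]_ A g k g′ → _∼[_]_ A (λ s → f s + g s) k (λ s → f′ s + g′ s)
  ∼-+ k {f} {f′} {g} {g′} p q = Fil⁻-cong k (pointwise λ s →
    solve 4 (λ f f′ g g′ → (f :- f′) :+ (g :- g′) := (f :+ g) :- (f′ :+ g′)) refl (f s) (f′ s) (g s) (g′ s)) (Fil⁻-+ k p q)

  ∼-scale : ∀ k r {f f′} → _∼[_]_ A f k f′ → _∼[_]_ A (λ s → r * f s) k (λ s → r * f′ s)
  ∼-scale k r {f} {f′} p = Fil⁻-cong k (pointwise λ s →
    solve 3 (λ r f f′ → r :* (f :- f′) := r :* f :- r :* f′) refl r (f s) (f′ s)) (Fil⁻-scale k r p)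

  ∼-* : ∀ j k {f f′ g g′} → Fil A j f → Fil A k g′ → _∼[_]_ A f j f′ → _∼[_]_ A g k g′ →
    _∼[_]_ A (λ s → f s * g s) (j ℕ.+ k) (λ s → f′ s * g′ s)
  ∼-* j k {f} {f′} {g} {g′} f∈ g′∈ p q = Fil⁻-cong (j ℕ.+ k) (pointwise λ s →
    solve 4 (λ f f′ g g′ → f :* (g :- g′) :+ (f :- f′) :* g′ := f :* g :- f′ :* g′) refl (f s) (f′ s) (g s) (g′ s))
    (Fil⁻-+ (j ℕ.+ k) (Fil⁻-*ˡ j k f∈ q) (Fil⁻-* j k p g′∈))

  ∼0⇒Fil⁻ : ∀ k {f} → _∼[_]_ A f k (λ _ → 0#) → Fil⁻ A k f
  ∼0⇒Fil⁻ k {f} = Fil⁻-cong k (pointwise λ s → solve 1 (λ f → f :- con (0 , 0) := f) refl (f s))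

  Fil⁻⇒∼0 : ∀ k {f} → Fil⁻ A k f → _∼[_]_ A f k (λ _ → 0#)
  Fil⁻⇒∼0 k {f} = Fil⁻-cong k (pointwise λ s → solve 1 (λ f → f := f :- con (0 , 0)) refl (f s))

  monomial-linear : ∀ {m} e → ∑ℕ m e ℕ.≤ 1 → Σ Rc λ b → Σ (Fin m → Rc) λ a →
    ∀ z → monomial e z ≈ b + ∑ m (λ i → a i * z i)
  monomial-linear {m} e le with degree≤1 m e le
  ... | inj₁ e≡0 = 1# , (λ _ → 0#) , λ z → trans (∏-one m (λ i → pow-zero (e≡0 i)))
          (sym (trans (+-congˡ (∑-zero m (λ i → zeroˡ _))) (+-identityʳ 1#)))
  ... | inj₂ (k , one , others) = 0# , (λ i → if does (i ≟ k) then 1# else 0#) , λ z →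
          trans (monomial-single e z k one others) (sym (trans (+-identityˡ _) (trans (∑-only m k (off z)) (on z))))
    where
    off : ∀ z i → i ≢ k → (if does (i ≟ k) then 1# else 0#) * z i ≈ 0#
    off z i i≢k with i ≟ k
    ... | yes q = contradiction q i≢k
    ... | no _  = zeroˡ _
    on : ∀ z → (if does (k ≟ k) then 1# else 0#) * z k ≈ z k
    on z with k ≟ k
    ... | yes _ = *-identityˡ _
    ... | no ne = contradiction ≡.refl ne

  evalPoly-linear : ∀ {m} (G : Poly m) → DegLe G 1 → Σ Rc λ b → Σ (Fin m → Rc) λ a →
    ∀ z → evalPoly G z ≈ b + ∑ m (λ i → a i * z i)
  evalPoly-linear {m} [] _ = 0# , (λ _ → 0#) , λ z → sym (trans (+-congˡ (∑-zero m (λ i → zeroˡ _))) (+-identityʳ 0#))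
  evalPoly-linear {m} ((r , e) ∷ G) (d , dG) with monomial-linear e d | evalPoly-linear G dG
  ... | b , a , mono | b′ , a′ , rest = r * b + b′ , (λ i → r * a i + a′ i) , λ z → begin
    r * monomial e z + evalPoly G z ≈⟨ +-cong (*-congˡ (mono z)) (rest z) ⟩
    r * (b + ∑ m (λ i → a i * z i)) + (b′ + ∑ m (λ i → a′ i * z i))
      ≈⟨ solve 5 (λ r b s b′ s′ → r :* (b :+ s) :+ (b′ :+ s′) := (r :* b :+ b′) :+ (r :* s :+ s′)) refl r b _ b′ _ ⟩
    (r * b + b′) + (r * ∑ m (λ i → a i * z i) + ∑ m (λ i → a′ i * z i))
      ≈⟨ +-congˡ (+-congʳ (∑-*ˡ m r _)) ⟨
    (r * b + b′) + (∑ m (λ i → r * (a i * z i)) + ∑ m (λ i → a′ i * z i))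
      ≈⟨ +-congˡ (∑-+ m _ _) ⟨
    (r * b + b′) + ∑ m (λ i → r * (a i * z i) + a′ i * z i)
      ≈⟨ +-congˡ (∑-cong m (λ i → solve 4 (λ r a a′ z → r :* (a :* z) :+ a′ :* z := (r :* a :+ a′) :* z) refl r (a i) (a′ i) (z i))) ⟩
    (r * b + b′) + ∑ m (λ i → (r * a i + a′ i) * z i) ∎

  linear : (Fin n → Rc) → VGel A
  linear a s = ∑ n (λ i → a i * X i s)

  Fil-linear : ∀ a → Fil A 1 (linear a)
  Fil-linear a = Fil-∑ n (λ i s → a i * X i s) (λ i → Fil-scale (a i) (Fil-X i))

  Fil₁⇒linear : ∀ {f} → Fil A 1 f → Σ (Fin n → Rc) λ a → _∼[_]_ A f 1 (linear a)
  Fil₁⇒linear {f} (G , dG , f≋G) with evalPoly-linear G dG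
  ... | b , a , G-linear = a , Fil-cong (λ s ch → sym (trans (+-congʳ (trans (f≋G s ch) (G-linear (point s))))
          (solve 2 (λ b l → (b :+ l) :- l := b) refl b _))) (Fil-const b)

  functional : ∀ {K} → Cube K → VGel A → Rc
  functional {K} C f = alternating K (λ ε → f (Cube.corner C ε))

  functional-cong : ∀ {K} (C : Cube K) {f g} → _≋_ A f g → functional C f ≈ functional C g
  functional-cong {K} C f≋g = alternating-cong K (λ ε → f≋g (Cube.corner C ε) (Cube.chamber C ε))

  corner-agree : ∀ {K} (C : Cube K) j {ε ε′} → (∀ a → a ≢ j → ε a ≡ ε′ a) → ∀ i → Cube.coord C i ≢ just j →
    Cube.corner C ε i ≡ Cube.corner C ε′ i
  corner-agree C j agree i ne with Cube.coord C i
  ... | nothing = ≡.refl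
  ... | just a  = ≡.cong (_⊛ Cube.sign C i) (agree a (ne ∘ ≡.cong just))

  X-agree : ∀ {s s′ : Fin n → Bool} i → s i ≡ s′ i → X i s ≈ X i s′
  X-agree i e = reflexive (≡.cong (λ b → if b then 1# else 0#) e)

  -- Each monomial has a coordinate that none of its effective variables follows: a variable
  -- following it has exponent 0 and contributes the factor 1. Moving along that coordinate does not
  -- change the monomial, so its corners cancel in pairs.
  functional-poly : ∀ {K} (C : Cube K) G k → DegLe G k → k ℕ.< K → functional C (λ s → evalPoly G (point s)) ≈ 0#
  functional-poly {K} C [] k _ _ = alternating-0 K
  functional-poly {K} C ((r , e) ∷ G) k (d , dG) k<K with unused-coordinate K n (Cube.coord C) e (ℕₚ.≤-<-trans d k<K)
  ... | j , unused = trans (alternating-+ K _ _) (trans (+-cong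
          (trans (alternating-* K r _) (trans (*-congˡ (alternating-independent K j indep)) (zeroʳ r)))
          (functional-poly C G k dG k<K)) (+-identityʳ 0#))
    where
    indep : ∀ ε ε′ → (∀ a → a ≢ j → ε a ≡ ε′ a) →
      monomial e (point (Cube.corner C ε)) ≈ monomial e (point (Cube.corner C ε′))
    indep ε ε′ agree = ∏-cong n factor
      where
      factor : ∀ i → pow (X i (Cube.corner C ε)) (e i) ≈ pow (X i (Cube.corner C ε′)) (e i)
      factor i with Maybeₚ.≡-dec _≟_ (Cube.coord C i) (just j)
      ... | yes q = trans (pow-zero (unused i q)) (sym (pow-zero (unused i q)))
      ... | no ne = reflexive (≡.cong (λ b → pow (if b then 1# else 0#) (e i)) (corner-agree C j agree i ne))

  -- Hence `functional C` is a linear form on degree K of the graded algebra. For K = 0 it is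
  -- evaluation at one chamber, in agreement with `Fil⁻ 0` being the functions that vanish on
  -- chambers.
  functional-Fil⁻ : ∀ {K} (C : Cube K) {f} → Fil⁻ A K f → functional C f ≈ 0#
  functional-Fil⁻ {zero}  C (lift f≋0)     = functional-cong C f≋0
  functional-Fil⁻ {suc K} C (G , dG , f≋G) = trans (functional-cong C f≋G) (functional-poly C G K dG (ℕₚ.n<1+n K))

  product : ∀ {k} → (Fin k → Fin n) → VGel A
  product {k} t s = ∏ k (λ a → X (t a) s)

  functional-missed : ∀ {K k} (C : Cube K) j (t : Fin k → Fin n) → (∀ a → Cube.coord C (t a) ≢ just j) →
    functional C (product t) ≈ 0#
  functional-missed {K} {k} C j t missed = alternating-independent K j (λ ε ε′ agree →
    ∏-cong k (λ a → X-agree {Cube.corner C ε} {Cube.corner C ε′} (t a) (corner-agree C j agree (t a) (missed a))))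

  -- Every factor has a coordinate of its own, so the alternating sum splits into differences along
  -- single edges, each 1 - 0 or 0 - 1.
  functional-hit : ∀ {K} (C : Cube K) (t : Fin K → Fin n) (σ : Fin K → Bool) → (∀ a → At C (t a) (just a) (σ a)) →
    functional C (product t) ≈ ∏ K (sg ∘ σ)
  functional-hit {K} C t σ at = trans
    (alternating-cong K (λ ε → ∏-cong K (λ a → reflexive (≡.cong₂ (λ c b → if orient c ε ⊛ b then 1# else 0#) (proj₁ (at a)) (proj₂ (at a))))))
    (trans (alternating-∏ K (λ a b → if b ⊛ σ a then 1# else 0#)) (∏-cong K (λ a → step (σ a))))
    where
    step : ∀ b → (if true ⊛ b then 1# else 0#) - (if false ⊛ b then 1# else 0#) ≈ sg b
    step true  = solve 0 (con (1 , 0) :- con (0 , 0) := con (1 , 0)) refl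
    step false = solve 0 (con (0 , 0) :- con (1 , 0) := :- con (1 , 0)) refl

  functional-∑ : ∀ {K} (C : Cube K) m (c : Fin m → Rc) (f : Fin m → VGel A) →
    functional C (λ s → ∑ m (λ b → c b * f b s)) ≈ ∑ m (λ b → c b * functional C (f b))
  functional-∑ {K} C m c f = trans (alternating-∑ K m _) (∑-cong m (λ b → alternating-* K (c b) _))

-- Turns a subset into a family over `Fin k`, on which omitting one element is composition with
-- `punchIn`.
record Enumeration {p} {n} (P : Fin n → Set p) (k : ℕ) : Set p where
  field
    at        : Fin k → Fin n
    injective : ∀ a b → at a ≡ at b → a ≡ b
    sound     : ∀ a → P (at a)
    complete  : ∀ i → P i → ∃[ a ] at a ≡ i

enumerate : ∀ {p} n {P : Fin n → Set p} → Decidable P → ∃[ k ] Enumeration P k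
enumerate zero    P? = 0 , record { at = λ () ; injective = λ () ; sound = λ () ; complete = λ () }
enumerate (suc n) P? with enumerate n (P? ∘ suc) | P? zero
... | k , E | no ¬p = k , record
  { at = suc ∘ at ; injective = λ a b q → injective a b (suc-injective q) ; sound = sound
  ; complete = λ { zero p → contradiction p ¬p ; (suc i) p → let a , e = complete i p in a , ≡.cong suc e } }
  where open Enumeration E
... | k , E | yes p = suc k , record
  { at = λ { zero → zero ; (suc a) → suc (at a) }
  ; injective = λ { zero zero _ → ≡.refl ; zero (suc _) () ; (suc _) zero ()
                  ; (suc a) (suc b) q → ≡.cong suc (injective a b (suc-injective q)) }
  ; sound = λ { zero → p ; (suc a) → sound a }
  ; complete = λ { zero _ → zero , ≡.refl ; (suc i) p → let a , e = complete i p in suc a , ≡.cong suc e } }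
  where open Enumeration E

infixr 5 _◂_
_◂_ : ∀ {a k} {A : Set a} → A → (Fin k → A) → Fin (suc k) → A
(x ◂ f) zero    = x
(x ◂ f) (suc a) = f a

-- Puts a distinguished element at index `zero`; used twice, it brings two chosen elements to the
-- positions that `circuitCube` singles out.
prepend : ∀ {p} {n k} {P : Fin n → Set p} {x} → P x → Enumeration (λ i → P i × i ≢ x) k → Enumeration P (suc k)
prepend {x = x} px E = record
  { at = x ◂ at
  ; injective = λ { zero zero _ → ≡.refl
                  ; zero (suc b) q → contradiction (≡.sym q) (proj₂ (sound b))
                  ; (suc a) zero q → contradiction q (proj₂ (sound a))
                  ; (suc a) (suc b) q → ≡.cong suc (injective a b q) }
  ; sound = λ { zero → px ; (suc a) → proj₁ (sound a) }
  ; complete = complete′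
  }
  where
  open Enumeration E
  complete′ : ∀ i → _ → ∃[ a ] (x ◂ at) a ≡ i
  complete′ i pi with i ≟ x
  ... | yes ≡.refl = zero , ≡.refl
  ... | no ne      = let a , e = complete i (pi , ne) in suc a , e

-- The relation in the graded algebra attached to a circuit.

module CircuitRelation {c ℓ} (R : CommutativeRing c ℓ) (𝕣 : RealField) (A : Arrangements.Arrangement 𝕣) where
  open CommutativeRing R renaming (Carrier to Rc) hiding (zero)
  open import Relation.Binary.Reasoning.Setoid setoid
  open RingLemmas R
  open RealLemmas 𝕣 using (HasSign; sign⇒≢0; sign-unique; sign-*; sum-zero-sign)
    renaming (_*_ to _*ℝ_; *-zeroˡ to *ℝ-zeroˡ)
  open Arrangements 𝕣
  open Arrangement A
  open Matroid 𝕣 A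
  open VG R 𝕣
  open Filtration R 𝕣 A
  open Solver using (solve; _:=_; _:+_; _:*_; _:-_; :-_; con)

  -- For families indexed by a circuit this is the boundary of the product.
  leaveOneOut : ∀ {k} → (Fin (suc k) → Rc) → Rc
  leaveOneOut {k} z = ∑ (suc k) (λ b → ∏ k (λ a → z (punchIn b a)))

  leaveOneOut-suc : ∀ {k} (z : Fin (suc (suc k)) → Rc) →
    leaveOneOut z ≈ ∏ (suc k) (z ∘ suc) + z zero * leaveOneOut (z ∘ suc)
  leaveOneOut-suc {k} z = +-congˡ (∑-*ˡ (suc k) (z zero) (λ b → ∏ k (λ a → z (suc (punchIn b a)))))

  Fil-leaveOneOut : ∀ {k} (f : Fin (suc k) → VGel A) → (∀ b → Fil A 1 (f b)) →
    Fil A k (λ s → leaveOneOut (λ b → f b s))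
  Fil-leaveOneOut {k} f f∈ = Fil-∑ (suc k) (λ b s → ∏ k (λ a → f (punchIn b a) s))
    (λ b → Fil-∏ k (f ∘ punchIn b) (f∈ ∘ punchIn b))

  -- The two top orders in the expansion of a product of k + 1 factors `f b - 1`; every other term
  -- has at most k - 1 factors.
  ∏-shift : ∀ k (f : Fin (suc k) → VGel A) → (∀ b → Fil A 1 (f b)) →
    _∼[_]_ A (λ s → ∏ (suc k) (λ b → f b s - 1#)) k (λ s → ∏ (suc k) (λ b → f b s) - leaveOneOut (λ b → f b s))
  ∏-shift zero f f∈ = lift λ s _ →
    solve 1 (λ x → (x :- con (1 , 0)) :* con (1 , 0) :- (x :* con (1 , 0) :- (con (1 , 0) :+ con (0 , 0))) := con (0 , 0)) refl (f zero s)
  ∏-shift (suc k) f f∈ = Fil-cong (pointwise λ s → trans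
      (solve 4 (λ x p l q → l :+ (x :- con (1 , 0)) :* (q :- (p :- l)) := (x :- con (1 , 0)) :* q :- (x :* p :- (p :+ x :* l)))
        refl (f zero s) (∏ (suc k) (λ b → f (suc b) s)) (leaveOneOut (λ b → f (suc b) s)) (∏ (suc k) (λ b → f (suc b) s - 1#)))
      (+-congˡ (-‿cong (+-congˡ (-‿cong (sym (leaveOneOut-suc (λ b → f b s))))))))
    -- Multiplying out `(x - 1) (p - l)` leaves the extra term `l`, which has one factor fewer than
    -- the terms kept and so belongs to the error.
    (Fil-+ (Fil-leaveOneOut (f ∘ suc) (f∈ ∘ suc))
      (Fil⁻-*ˡ 1 k (Fil-+ (f∈ zero) (Fil-const (- 1#))) (∏-shift k (f ∘ suc) (f∈ ∘ suc))))

  ∼-∏ : ∀ k (f g : Fin k → VGel A) → (∀ a → Fil A 1 (f a)) → (∀ a → Fil A 1 (g a)) → (∀ a → _∼[_]_ A (f a) 1 (g a)) →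
    _∼[_]_ A (λ s → ∏ k (λ a → f a s)) k (λ s → ∏ k (λ a → g a s))
  ∼-∏ zero    f g f∈ g∈ h = ∼-refl 0 λ s → refl
  ∼-∏ (suc k) f g f∈ g∈ h = ∼-* 1 k (f∈ zero) (Fil-∏ k (g ∘ suc) (g∈ ∘ suc)) (h zero)
    (∼-∏ k (f ∘ suc) (g ∘ suc) (f∈ ∘ suc) (g∈ ∘ suc) (h ∘ suc))

  ∼-∑ : ∀ k m (f g : Fin m → VGel A) → (∀ a → _∼[_]_ A (f a) k (g a)) →
    _∼[_]_ A (λ s → ∑ m (λ a → f a s)) k (λ s → ∑ m (λ a → g a s))
  ∼-∑ k zero    f g h = ∼-refl k λ s → refl
  ∼-∑ k (suc m) f g h = ∼-+ k (h zero) (∼-∑ k m (f ∘ suc) (g ∘ suc) (h ∘ suc))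

  relator : ∀ {k} → (Fin (suc k) → Rc) → (Fin (suc k) → Fin n) → VGel A
  relator {k} c e s = ∑ (suc k) (λ b → c b * product (e ∘ punchIn b) s)

  -- The indicator of the side `σ` of the hyperplane: `x` or `1 - x`, hence a signed generator
  -- modulo constants.
  heaviside : Bool → Fin n → VGel A
  heaviside σ i s = if σ ⊛ s i then 1# else 0#

  heaviside≈ : ∀ σ i s → heaviside σ i s ≈ sg σ * X i s + (if σ then 0# else 1#)
  heaviside≈ true i s = solve 1 (λ x → x := con (1 , 0) :* x :+ con (0 , 0)) refl _
  heaviside≈ false i s with s i
  ... | true  = solve 1 (λ o → con (0 , 0) := :- o :* con (1 , 0) :+ o) refl 1#
  ... | false = solve 1 (λ o → o := :- o :* con (0 , 0) :+ o) refl 1#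

  signedX : Bool → Fin n → VGel A
  signedX σ i s = sg σ * X i s

  Fil-signedX : ∀ σ i → Fil A 1 (signedX σ i)
  Fil-signedX σ i = Fil-scale (sg σ) (Fil-X i)

  Fil-heaviside : ∀ σ i → Fil A 1 (heaviside σ i)
  Fil-heaviside σ i = Fil-cong (pointwise λ s → sym (heaviside≈ σ i s)) (Fil-+ (Fil-signedX σ i) (Fil-const (if σ then 0# else 1#)))

  heaviside∼ : ∀ σ i → _∼[_]_ A (heaviside σ i) 1 (signedX σ i)
  heaviside∼ σ i = Fil-cong (pointwise λ s → sym (trans (+-congʳ (heaviside≈ σ i s))
    (solve 2 (λ x c → (x :+ c) :- x := c) refl _ _))) (Fil-const (if σ then 0# else 1#))

  -- On every chamber some factor of ∏ h_b and some factor of ∏ (h_b - 1) vanishes,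
  -- so expanding the second product leaves the boundary of the first in lower degree.
  unsatisfiable⇒relation : ∀ {k} (e : Fin (suc k) → Fin n) (σ : Fin (suc k) → Bool) →
    (∀ s → IsChamber s → ∀ β → ∃[ b ] σ b ⊛ s (e b) ≡ β) →
    Fil⁻ A k (relator (λ b → ∏ k (sg ∘ σ ∘ punchIn b)) e)
  unsatisfiable⇒relation {k} e σ both = Fil⁻-cong k boundary≋
    (∼0⇒Fil⁻ k (∼-trans k (∼-sym k boundary∼) (Fil⁻⇒∼0 k (Fil⁻-cong k vanish (∏-shift k h (λ b → Fil-heaviside (σ b) (e b)))))))
    where
    h : Fin (suc k) → VGel A
    h b = heaviside (σ b) (e b)
    boundary∼ : _∼[_]_ A (λ s → leaveOneOut (λ b → h b s)) k (λ s → leaveOneOut (λ b → signedX (σ b) (e b) s))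
    boundary∼ = ∼-∑ k (suc k) (λ b s → ∏ k (λ a → h (punchIn b a) s)) (λ b s → ∏ k (λ a → signedX (σ (punchIn b a)) (e (punchIn b a)) s))
      (λ b → ∼-∏ k (h ∘ punchIn b) (λ a → signedX (σ (punchIn b a)) (e (punchIn b a)))
        (λ a → Fil-heaviside (σ (punchIn b a)) (e (punchIn b a))) (λ a → Fil-signedX (σ (punchIn b a)) (e (punchIn b a))) (λ a → heaviside∼ (σ (punchIn b a)) (e (punchIn b a))))
    boundary≋ : _≋_ A (λ s → leaveOneOut (λ b → signedX (σ b) (e b) s)) (relator (λ b → ∏ k (sg ∘ σ ∘ punchIn b)) e)
    boundary≋ s _ = ∑-cong (suc k) (λ b → ∏-* k (sg ∘ σ ∘ punchIn b) (λ a → X (e (punchIn b a)) s))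
    vanish : _≋_ A (λ s → ∏ (suc k) (λ b → h b s - 1#) - (∏ (suc k) (λ b → h b s) - leaveOneOut (λ b → h b s)))
                   (λ s → leaveOneOut (λ b → h b s))
    vanish s ch with both s ch true | both s ch false
    ... | b , hb | b′ , hb′ = trans
      (+-cong (∏-zero (suc k) {λ b → h b s - 1#} b (trans (+-congʳ (value hb)) (-‿inverseʳ 1#))) (-‿cong (+-congʳ (∏-zero (suc k) {λ b → h b s} b′ (value hb′)))))
      (solve 1 (λ l → con (0 , 0) :- (con (0 , 0) :- l) := l) refl _)
      where
      value : ∀ {b β} → σ b ⊛ s (e b) ≡ β → h b s ≈ (if β then 1# else 0#)
      value q = reflexive (≡.cong (λ β → if β then 1# else 0#) q)

  -- At a point of a chamber the terms of the relation sum to zero and none of those indexed by `I`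
  -- vanishes, so both signs occur among them. Hence the chamber lies neither in all the sides
  -- prescribed by `σ` nor in all the opposite ones.
  circuit-relation : ∀ {I μ k} → Relation I μ → (E : Enumeration (_∈ I) (suc k)) (σ : Fin (suc k) → Bool) →
    (∀ b → HasSign (σ b) (μ (Enumeration.at E b))) →
    Fil⁻ A k (relator (λ b → ∏ k (sg ∘ σ ∘ punchIn b)) (Enumeration.at E))
  circuit-relation {I} {μ} rel E σ σ-sign = unsatisfiable⇒relation at σ both
    where
    open Enumeration E
    both : ∀ s → IsChamber s → ∀ β → ∃[ b ] σ b ⊛ s (at b) ≡ β
    both s (v , v∈s) β = choose β (σ zero ⊛ s (at zero)) ≡.refl opposite
      where
      sign-s : ∀ i → HasSign (s i) (eval i v)
      sign-s i with s i in q
      ... | true  = proj₁ (v∈s i) q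
      ... | false = proj₂ (v∈s i) q
      term : ∀ b → HasSign (σ b ⊛ s (at b)) (μ (at b) *ℝ eval (at b) v)
      term b = sign-* (σ b) (s (at b)) (σ-sign b) (sign-s (at b))
      opposite : ∃[ b ] σ b ⊛ s (at b) ≡ not (σ zero ⊛ s (at zero))
      opposite with sum-zero-sign n (σ zero ⊛ s (at zero)) (at zero) (relation-eval rel v) (term zero)
      ... | j , neg with j ∈? I
      ...   | no j∉I = contradiction (≡.trans (≡.cong (_*ℝ eval j v) (proj₁ rel j j∉I)) (*ℝ-zeroˡ _))
                         (sign⇒≢0 (not (σ zero ⊛ s (at zero))) neg)
      ...   | yes j∈I with complete j j∈I
      ...     | b , ≡.refl = b , sign-unique (term b) neg
      choose : ∀ β γ → σ zero ⊛ s (at zero) ≡ γ → (∃[ b ] σ b ⊛ s (at b) ≡ not γ) → ∃[ b ] σ b ⊛ s (at b) ≡ β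
      choose true  true  q _  = zero , q
      choose true  false q q′ = q′
      choose false true  q q′ = q′
      choose false false q _  = zero , q

-- Nonzero products and signs in an integral domain.

module DomainLemmas {c ℓ} (R : CommutativeRing c ℓ) (domain : IsIntegralDomain R) where
  open CommutativeRing R renaming (Carrier to Rc) hiding (zero)
  open import Algebra.Properties.Ring ring using (-‿involutive; -0#≈0#)
  open RingLemmas R
  open Solver using (solve; _:=_; _:+_; _:*_; _:-_; :-_; con)

  1≉0 : ¬ (1# ≈ 0#)
  1≉0 = proj₁ domain

  *-≉0 : ∀ {x y} → ¬ (x ≈ 0#) → ¬ (y ≈ 0#) → ¬ (x * y ≈ 0#)
  *-≉0 x≉0 y≉0 xy≈0 = [ x≉0 , y≉0 ]′ (proj₂ domain _ _ xy≈0)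

  ∏-≉0 : ∀ n {f} → (∀ i → ¬ (f i ≈ 0#)) → ¬ (∏ n f ≈ 0#)
  ∏-≉0 zero    h = 1≉0
  ∏-≉0 (suc n) h = *-≉0 (h zero) (∏-≉0 n (h ∘ suc))

  *-cancel-≉0 : ∀ {x y} → ¬ (y ≈ 0#) → x * y ≈ 0# → x ≈ 0#
  *-cancel-≉0 y≉0 xy≈0 = [ (λ e → e) , (λ e → contradiction e y≉0) ]′ (proj₂ domain _ _ xy≈0)

  sg-≉0 : ∀ b → ¬ (sg b ≈ 0#)
  sg-≉0 true  = 1≉0
  sg-≉0 false e = 1≉0 (trans (sym (-‿involutive 1#)) (trans (-‿cong e) -0#≈0#))

  sg-⊛ : ∀ a b → sg (a ⊛ b) ≈ sg a * sg b
  sg-⊛ true  b     = sym (*-identityˡ _)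
  sg-⊛ false true  = sym (*-identityʳ _)
  sg-⊛ false false = solve 1 (λ o → o := :- con (1 , 0) :* :- o) refl 1#

  sg-not : ∀ b → sg (not b) ≈ - sg b
  sg-not true  = refl
  sg-not false = sym (-‿involutive 1#)

  sg-square : ∀ b → sg b * sg b ≈ 1#
  sg-square true  = *-identityʳ 1#
  sg-square false = solve 1 (λ o → :- con (1 , 0) :* :- o := o) refl 1#

-- Transporting circuits and their signs along a rescaled bijection.

module Transfer {c ℓ} (R : CommutativeRing c ℓ) (𝕣 : RealField) (domain : IsIntegralDomain R)
  (A B : Arrangements.Arrangement 𝕣) where
  open CommutativeRing R renaming (Carrier to Rc) hiding (zero)
  open import Relation.Binary.Reasoning.Setoid setoid
  open RingLemmas R
  open DomainLemmas R domain
  open RealLemmas 𝕣 using (0r; 1r; HasSign; sign⇒≢0; sign-unique; sign-*; sum-zero-sign; ≢0⇒sign; *-idʳ)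
    renaming (_*_ to _*ℝ_; *-zeroˡ to *ℝ-zeroˡ; *-zeroʳ to *ℝ-zeroʳ)
  open Arrangements 𝕣
  open VG R 𝕣
  open Solver using (solve; _:=_; _:+_; _:*_; _:-_; :-_; con)
  private
    module A = Arrangement A
    module B = Arrangement B
    module MA = Matroid 𝕣 A
    module MB = Matroid 𝕣 B
    module CB = Cubes 𝕣 B
    module FB = Filtration R 𝕣 B
    module RA = CircuitRelation R 𝕣 A
    module RB = CircuitRelation R 𝕣 B

  -- All that is kept of the isomorphism: sending `x_i` to `u_i x_(π i)` preserves relations among
  -- products that omit one index. The roles of `A` and `B` are open, so both directions of the
  -- isomorphism can use it.
  Transports : (Fin A.n → Fin B.n) → (Fin A.n → Rc) → Set _
  Transports π u = ∀ k (e : Fin (suc k) → Fin A.n) (x : Fin (suc k) → Rc) → Fil⁻ A k (RA.relator x e) →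
    Fil⁻ B k (RB.relator (λ b → x b * ∏ k (u ∘ e ∘ punchIn b)) (π ∘ e))

  module _ (π : Fin A.n → Fin B.n) (π-injective : ∀ i j → π i ≡ π j → i ≡ j)
           (u : Fin A.n → Rc) (u≉0 : ∀ i → ¬ (u i ≈ 0#)) (transports : Transports π u) where

    private
      Coefficient : ∀ {k} → (Fin (suc k) → Bool) → (Fin (suc k) → Fin A.n) → Fin (suc k) → Rc
      Coefficient {k} σ e b = ∏ k (sg ∘ σ ∘ punchIn b) * ∏ k (u ∘ e ∘ punchIn b)

      transported-circuit : ∀ {I μ k} → A.Relation I μ → (E : Enumeration (_∈ I) (suc k)) (σ : Fin (suc k) → Bool) →
        (∀ b → HasSign (σ b) (μ (Enumeration.at E b))) → (C : CB.Cube k) →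
        ∑ (suc k) (λ b → Coefficient σ (Enumeration.at E) b * FB.functional C (FB.product (π ∘ Enumeration.at E ∘ punchIn b))) ≈ 0#
      transported-circuit {k = k} rel E σ σ-sign C = trans
        (sym (FB.functional-∑ C (suc k) (Coefficient σ at) (λ b → FB.product (π ∘ at ∘ punchIn b))))
        (FB.functional-Fil⁻ C (transports k at (λ b → ∏ k (sg ∘ σ ∘ punchIn b)) (RA.circuit-relation rel E σ σ-sign)))
        where open Enumeration E

    -- If `J` were independent, its dual vectors would give a cube on which only the term omitting
    -- `i₀` of the transported relation survives. Its coefficient is a product of signs and nonzero
    -- `u`'s, which cannot vanish in a domain.
    circuit⇒dependent : ∀ {I J} → A.IsCircuit I → (∀ i → i ∈ I → π i ∈ J) → B.Dependent J
    circuit⇒dependent {I} {J} circ@((μ , rel) , _) πI⊆J with MB.dependent-or-dualVectors J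
    ... | inj₁ dep   = dep
    ... | inj₂ duals with MA.dependent-nonempty (μ , rel)
    ...   | i₀ , i₀∈I with enumerate A.n (λ i → (i ∈? I) ×-dec ¬? (i ≟ i₀))
    ...     | k , E₀ = contradiction coefficient≈0 (*-≉0 (∏-≉0 k (sg-≉0 ∘ σ ∘ suc)) (∏-≉0 k (u≉0 ∘ at ∘ suc)))
      where
      E = prepend {P = _∈ I} i₀∈I E₀
      open Enumeration E
      signed : ∀ b → ∃[ β ] HasSign β (μ (at b))
      signed b = ≢0⇒sign (MA.circuit-support circ rel (at b) (sound b))
      σ = proj₁ ∘ signed
      dual : ∀ b → ∃[ w ] ((∀ i → i ∈ J × i ≢ π (at b) → B.eval i w ≡ 0r) × B.eval (π (at b)) w ≡ 1r)
      dual b = duals (π (at b)) (πI⊆J (at b) (sound b))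
      found = CB.independentCube (π ∘ at) (proj₁ ∘ dual) (λ b → proj₂ (proj₂ (dual b)))
        (λ a b a≢b → proj₁ (proj₂ (dual b)) (π (at a)) (πI⊆J (at a) (sound a) , λ q → a≢b (injective a b (π-injective _ _ q))))
      C = proj₁ found
      missed : ∀ b → b ≢ zero → Coefficient σ at b * FB.functional C (FB.product (π ∘ at ∘ punchIn b)) ≈ 0#
      missed zero    ne = contradiction ≡.refl ne
      missed (suc j) _  = trans (*-congˡ (FB.functional-missed C j (π ∘ at ∘ punchIn (suc j))
        (λ a → avoids (punchIn (suc j) a) (punchInᵢ≢i (suc j) a)))) (zeroʳ _)
        where
        avoids : ∀ x → x ≢ suc j → CB.Cube.coord C (π (at x)) ≢ just j
        avoids zero    _  q = case ≡.trans (≡.sym (proj₁ (proj₁ (proj₂ found)))) q of λ ()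
        avoids (suc a) ne q = ne (≡.cong suc (Maybeₚ.just-injective (≡.trans (≡.sym (proj₁ (proj₂ (proj₂ found) a))) q)))
      coefficient≈0 : Coefficient σ at zero ≈ 0#
      coefficient≈0 = begin
        Coefficient σ at zero ≈⟨ *-identityʳ _ ⟨
        Coefficient σ at zero * 1# ≈⟨ *-congˡ (trans (FB.functional-hit C (π ∘ at ∘ suc) (λ _ → true) (proj₂ (proj₂ found))) (∏-one k (λ _ → refl))) ⟨
        Coefficient σ at zero * FB.functional C (FB.product (π ∘ at ∘ suc)) ≈⟨ ∑-only (suc k) zero missed ⟨
        ∑ (suc k) (λ b → Coefficient σ at b * FB.functional C (FB.product (π ∘ at ∘ punchIn b)))
          ≈⟨ transported-circuit rel E σ (proj₂ ∘ signed) C ⟩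
        0# ∎

    -- On a suitable cube only the terms omitting `i` and `j` survive. Cancelling their common
    -- factor leaves `σⱼ uⱼ + β σᵢ uᵢ = 0`, where `β` is the sign of `π i` at the dual vector of
    -- `π j`. The relation `ν` at that vector gives `β = - τᵢ τⱼ`.
    circuit-signs : ∀ {I J μ ν} → A.IsCircuit I → A.Relation I μ → B.IsCircuit J → B.Relation J ν →
      (∀ i → i ∈ I → π i ∈ J) →
      ∀ {i j} → i ∈ I → j ∈ I → ∀ {σᵢ σⱼ τᵢ τⱼ} →
      HasSign σᵢ (μ i) → HasSign σⱼ (μ j) → HasSign τᵢ (ν (π i)) → HasSign τⱼ (ν (π j)) →
      sg (σᵢ ⊛ τᵢ) * u i ≈ sg (σⱼ ⊛ τⱼ) * u j
    circuit-signs {I} {J} {μ} {ν} circ rel circ′ rel′ πI⊆J {i} {j} i∈I j∈I {σᵢ} {σⱼ} {τᵢ} {τⱼ} σᵢ-sign σⱼ-sign τᵢ-sign τⱼ-sign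
      with i ≟ j
    ... | yes ≡.refl = reflexive (≡.cong₂ (λ a b → sg (a ⊛ b) * u i) (sign-unique {σᵢ} {σⱼ} {μ i} σᵢ-sign σⱼ-sign) (sign-unique {τᵢ} {τⱼ} {ν (π i)} τᵢ-sign τⱼ-sign))
    ... | no i≢j with MB.dependent-or-dualVectors (J ∖ π i)
    ...   | inj₁ dep   = contradiction dep (proj₂ circ′ (J ∖ π i) (x∈p⇒p-x⊂p (πI⊆J i i∈I)))
    ...   | inj₂ duals with enumerate A.n (λ l → ((l ∈? I) ×-dec ¬? (l ≟ i)) ×-dec ¬? (l ≟ j))
    ...     | k , E₀ = conclusion
      where
      E = prepend {P = _∈ I} i∈I (prepend {P = λ l → l ∈ I × l ≢ i} (j∈I , i≢j ∘ ≡.sym) E₀)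
      open Enumeration E
      signed : ∀ b → ∃[ β ] HasSign β (μ (at b))
      signed zero          = σᵢ , σᵢ-sign
      signed (suc zero)    = σⱼ , σⱼ-sign
      signed b@(suc (suc _)) = ≢0⇒sign (MA.circuit-support circ rel (at b) (sound b))
      σ = proj₁ ∘ signed
      suc∈ : ∀ a → π (at (suc a)) ∈ J ∖ π i
      suc∈ a = x∈p∧x≢y⇒x∈p-y (πI⊆J (at (suc a)) (sound (suc a))) (λ q → case injective (suc a) zero (π-injective _ _ q) of λ ())
      dual : ∀ a → ∃[ w ] ((∀ l → l ∈ J ∖ π i × l ≢ π (at (suc a)) → B.eval l w ≡ 0r) × B.eval (π (at (suc a))) w ≡ 1r)
      dual a = duals (π (at (suc a))) (suc∈ a)
      w₀ = proj₁ (dual zero)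

      -- In Σ ν_l β_l(w₀) = 0 only the terms of π i and π j survive, so they have opposite signs.
      opposite : ∃[ β ] (HasSign β (B.eval (π i) w₀) × τᵢ ⊛ β ≡ not τⱼ)
      opposite with sum-zero-sign B.n τⱼ (π j) (MB.relation-eval rel′ w₀)
                      (≡.subst (HasSign τⱼ) (≡.sym (≡.trans (≡.cong (ν (π j) *ℝ_) (proj₂ (proj₂ (dual zero)))) (*-idʳ _))) τⱼ-sign)
      ... | l , neg with l ∈? J
      ...   | no l∉J = contradiction (≡.trans (≡.cong (_*ℝ B.eval l w₀) (proj₁ rel′ l l∉J)) (*ℝ-zeroˡ _)) (sign⇒≢0 (not τⱼ) neg)
      ...   | yes l∈J with l ≟ π i
      ...     | yes ≡.refl with ≢0⇒sign (λ e → sign⇒≢0 (not τⱼ) neg (≡.trans (≡.cong (ν (π i) *ℝ_) e) (*ℝ-zeroʳ _)))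
      ...       | β , p = β , p , sign-unique (sign-* τᵢ β τᵢ-sign p) neg
      opposite | l , neg | yes l∈J | no l≢πi with l ≟ π j
      ... | yes ≡.refl = contradiction
              (sign-unique neg (≡.subst (HasSign τⱼ) (≡.sym (≡.trans (≡.cong (ν (π j) *ℝ_) (proj₂ (proj₂ (dual zero)))) (*-idʳ _))) τⱼ-sign))
              (not≢ τⱼ)
        where
        not≢ : ∀ b → not b ≢ b
        not≢ true ()
        not≢ false ()
      ... | no l≢πj = contradiction
              (≡.trans (≡.cong (ν l *ℝ_) (proj₁ (proj₂ (dual zero)) l (x∈p∧x≢y⇒x∈p-y l∈J l≢πi , l≢πj))) (*ℝ-zeroʳ _))
              (sign⇒≢0 (not τⱼ) neg)

      β = proj₁ opposite
      -- Both `π i` and `π j` are off the leading vector `w₀`, so they follow the same coordinate,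
      -- with relative orientation `β`.
      found = CB.circuitCube (π ∘ at) (proj₁ ∘ dual) (λ a → proj₂ (proj₂ (dual a)))
        (λ a b a≢b → proj₁ (proj₂ (dual b)) (π (at (suc a))) (suc∈ a , λ q → a≢b (suc-injective (injective (suc a) (suc b) (π-injective _ _ q)))))
        (proj₁ (proj₂ opposite))
      C = proj₁ found
      value : Fin (suc (suc k)) → Rc
      value b = FB.functional C (FB.product (π ∘ at ∘ punchIn b))
      value₀ : value zero ≈ 1#
      value₀ = trans (FB.functional-hit C (π ∘ at ∘ suc) (λ _ → true) (proj₂ (proj₂ found))) (∏-one (suc k) (λ _ → refl))
      value₁ : value (suc zero) ≈ sg β
      value₁ = trans (FB.functional-hit C (π ∘ at ∘ punchIn (suc zero)) (β ◂ (λ _ → true))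
          (λ { zero → proj₁ (proj₂ found) ; (suc a) → proj₂ (proj₂ found) (suc a) }))
        (trans (*-congˡ (∏-one k (λ _ → refl))) (*-identityʳ _))
      missed : ∀ b → value (suc (suc b)) ≈ 0#
      missed b = FB.functional-missed C (suc b) (π ∘ at ∘ punchIn (suc (suc b)))
        (λ a → avoids (punchIn (suc (suc b)) a) (punchInᵢ≢i (suc (suc b)) a))
        where
        avoids : ∀ x → x ≢ suc (suc b) → CB.Cube.coord C (π (at x)) ≢ just (suc b)
        avoids zero    _  q = case ≡.trans (≡.sym (proj₁ (proj₁ (proj₂ found)))) q of λ ()
        avoids (suc a) ne q = ne (≡.cong suc (Maybeₚ.just-injective (≡.trans (≡.sym (proj₁ (proj₂ (proj₂ found) a))) q)))
      σ⁺ u⁺ : Fin k → Rc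
      σ⁺ a = sg (σ (suc (suc a)))
      u⁺ a = u (at (suc (suc a)))
      rest = ∏ k σ⁺ * ∏ k u⁺
      rest≉0 : ¬ (rest ≈ 0#)
      rest≉0 = *-≉0 (∏-≉0 k (λ a → sg-≉0 (σ (suc (suc a))))) (∏-≉0 k (λ a → u≉0 (at (suc (suc a)))))
      balance : (sg σⱼ * u j + sg σᵢ * u i * sg β) * rest ≈ 0#
      balance = begin
        (sg σⱼ * u j + sg σᵢ * u i * sg β) * rest
          ≈⟨ solve 7 (λ s v s′ v′ b p q → (s :* v :+ s′ :* v′ :* b) :* (p :* q) :=
                (s :* p) :* (v :* q) :* con (1 , 0) :+ ((s′ :* p) :* (v′ :* q) :* b :+ con (0 , 0)))
              refl (sg σⱼ) (u j) (sg σᵢ) (u i) (sg β) (∏ k σ⁺) (∏ k u⁺) ⟩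
        Coefficient σ at zero * 1# + (Coefficient σ at (suc zero) * sg β + 0#)
          ≈⟨ +-cong (*-congˡ value₀) (+-cong (*-congˡ value₁) (∑-zero k (λ b → trans (*-congˡ (missed b)) (zeroʳ _)))) ⟨
        ∑ (suc (suc k)) (λ b → Coefficient σ at b * value b)
          ≈⟨ transported-circuit rel E σ (proj₂ ∘ signed) C ⟩
        0# ∎
      balance′ : sg σⱼ * u j + sg σᵢ * u i * sg β ≈ 0#
      balance′ = *-cancel-≉0 rest≉0 balance
      τᵢβ : sg τᵢ * sg β ≈ - sg τⱼ
      τᵢβ = trans (sym (sg-⊛ τᵢ β)) (trans (reflexive (≡.cong sg (proj₂ (proj₂ opposite)))) (sg-not τⱼ))
      conclusion : sg (σᵢ ⊛ τᵢ) * u i ≈ sg (σⱼ ⊛ τⱼ) * u j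
      conclusion = begin
        sg (σᵢ ⊛ τᵢ) * u i ≈⟨ *-congʳ (sg-⊛ σᵢ τᵢ) ⟩
        sg σᵢ * sg τᵢ * u i ≈⟨ *-identityʳ _ ⟨
        -- The square of `sg β` is inserted to expose the sum that vanishes by `balance′`.
        sg σᵢ * sg τᵢ * u i * 1# ≈⟨ *-congˡ (sg-square β) ⟨
        sg σᵢ * sg τᵢ * u i * (sg β * sg β)
          ≈⟨ solve 6 (λ s t v b s′ v′ → s :* t :* v :* (b :* b) := (t :* b) :* (s′ :* v′ :+ s :* v :* b) :- (t :* b) :* (s′ :* v′))
               refl (sg σᵢ) (sg τᵢ) (u i) (sg β) (sg σⱼ) (u j) ⟩
        (sg τᵢ * sg β) * (sg σⱼ * u j + sg σᵢ * u i * sg β) - (sg τᵢ * sg β) * (sg σⱼ * u j)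
          ≈⟨ +-cong (*-congˡ balance′) (-‿cong (*-congʳ τᵢβ)) ⟩
        (sg τᵢ * sg β) * 0# - (- sg τⱼ) * (sg σⱼ * u j)
          ≈⟨ solve 4 (λ x t s v → x :* con (0 , 0) :- (:- t) :* (s :* v) := s :* t :* v) refl (sg τᵢ * sg β) (sg τⱼ) (sg σⱼ) (u j) ⟩
        sg σⱼ * sg τⱼ * u j ≈⟨ *-congʳ (sg-⊛ σⱼ τⱼ) ⟨
        sg (σⱼ ⊛ τⱼ) * u j ∎

-- Degrees one and two, seen by cubes around one or two hyperplanes.

module LowDegree {c ℓ} (R : CommutativeRing c ℓ) (𝕣 : RealField) (domain : IsIntegralDomain R)
  (A : Arrangements.Arrangement 𝕣) where
  open CommutativeRing R renaming (Carrier to Rc) hiding (zero)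
  open import Relation.Binary.Reasoning.Setoid setoid
  open RingLemmas R
  open DomainLemmas R domain
  open Arrangements 𝕣
  open Arrangement A
  open Matroid 𝕣 A
  open Cubes 𝕣 A
  open Filtration R 𝕣 A
  open VG R 𝕣
  open Solver using (solve; _:=_; _:+_; _:*_; _:-_; :-_; con)

  Isolating : ∀ {K} → (Fin K → Fin n) → Set
  Isolating {K} t = ∃[ C ] ((∀ a → At {K} C (t a) (just a) true) × (∀ k → (∀ a → k ≢ t a) → Cube.coord C k ≡ nothing))

  single : Fin n → Fin 1 → Fin n
  single i _ = i

  -- An edge that crosses hyperplane `i` and no other. As the hyperplanes are distinct, each of the
  -- others misses some point of hyperplane `i`.
  lineCube-exists : ∀ i → Isolating (single i)
  lineCube-exists i = isolatingCube {1} (single i) (λ _ → proj₁ (nonvanishing i)) (λ _ → proj₂ (nonvanishing i))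
    (λ { zero zero ne → contradiction ≡.refl ne })
    (λ k k≢i → let v , v∈i , one = nonproportional i k (k≢i zero ∘ ≡.sym) in v , (λ _ → v∈i) , one)

  abstract
    lineCube : ∀ i → Isolating (single i)
    lineCube = lineCube-exists

  module _ (i : Fin n) where
    private C = proj₁ (lineCube i)

    functional-X-on : functional C (X i) ≈ 1#
    functional-X-on = begin
      functional C (X i) ≈⟨ functional-cong C (pointwise {X i} {product {1} (λ _ → i)} λ s → sym (*-identityʳ _)) ⟩
      functional C (product {1} (λ _ → i)) ≈⟨ functional-hit C (single i) (λ _ → true) (proj₁ (proj₂ (lineCube i))) ⟩
      1# * 1# ≈⟨ *-identityʳ 1# ⟩
      1# ∎

    functional-X-off : ∀ k → k ≢ i → functional C (X k) ≈ 0#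
    functional-X-off k k≢i = trans (functional-cong C (pointwise {X k} {product {1} (λ _ → k)} λ s → sym (*-identityʳ _)))
      (functional-missed C zero (λ (_ : Fin 1) → k)
        (λ _ q → case ≡.trans (≡.sym (proj₂ (proj₂ (lineCube i)) k (λ _ → k≢i))) q of λ ()))

    lineFunctional : VGel A → Rc
    lineFunctional = functional C

    lineFunctional-Fil⁻ : ∀ {f} → Fil⁻ A 1 f → lineFunctional f ≈ 0#
    lineFunctional-Fil⁻ = functional-Fil⁻ C

    lineFunctional-∑ : ∀ m (b : Fin m → Rc) (f : Fin m → VGel A) →
      lineFunctional (λ s → ∑ m (λ l → b l * f l s)) ≈ ∑ m (λ l → b l * lineFunctional (f l))
    lineFunctional-∑ = functional-∑ C

  X-nonzero : ∀ i → ¬ Fil⁻ A 1 (X i)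
  X-nonzero i p = 1≉0 (trans (sym (functional-X-on i)) (lineFunctional-Fil⁻ i p))

  -- The line functionals form a dual basis to the classes of the `X i`.
  linear-independent : ∀ a → Fil⁻ A 1 (linear a) → ∀ i → a i ≈ 0#
  linear-independent a p i = begin
    a i ≈⟨ *-identityʳ _ ⟨
    a i * 1# ≈⟨ *-congˡ (functional-X-on i) ⟨
    a i * lineFunctional i (X i) ≈⟨ ∑-only n i (λ k k≢i → trans (*-congˡ (functional-X-off i k k≢i)) (zeroʳ _)) ⟨
    ∑ n (λ k → a k * lineFunctional i (X k)) ≈⟨ lineFunctional-∑ i n a X ⟨
    lineFunctional i (linear a) ≈⟨ lineFunctional-Fil⁻ i p ⟩
    0# ∎

  pair : Fin n → Fin n → Fin 2 → Fin n
  pair i j = i ◂ j ◂ λ ()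

  -- The four chambers around the intersection of hyperplanes `i` and `j`. By genericity each other
  -- hyperplane misses a point of that intersection, so its sign is the same on all four.
  planeCube-exists : GenericCodim2 → ∀ i j → i ≢ j → Isolating (pair i j)
  planeCube-exists gen i j i≢j = isolatingCube {2} (pair i j) (proj₁ wⱼ ◂ proj₁ wᵢ ◂ λ ())
    (λ { zero → proj₂ (proj₂ wⱼ) ; (suc zero) → proj₂ (proj₂ wᵢ) })
    (λ { zero zero ne → contradiction ≡.refl ne ; zero (suc zero) _ → proj₁ (proj₂ wᵢ)
       ; (suc zero) zero _ → proj₁ (proj₂ wⱼ) ; (suc zero) (suc zero) ne → contradiction ≡.refl ne })
    (λ k k∉ → let v , v∈i , v∈j , one = generic-point gen i j k i≢j (k∉ zero) (k∉ (suc zero)) in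
      v , (λ { zero → v∈i ; (suc zero) → v∈j }) , one)
    where
    -- A vector on hyperplane `j` and off `i`: it is the direction of the coordinate that belongs to
    -- `i`, and `wᵢ` the reverse.
    wⱼ = nonproportional j i (i≢j ∘ ≡.sym)
    wᵢ = nonproportional i j i≢j

  abstract
    planeCube : GenericCodim2 → ∀ i j → i ≢ j → Isolating (pair i j)
    planeCube = planeCube-exists

  -- On the square around hyperplanes `i` and `j`, every product `X k · X l` other than `X i · X j`
  -- and its transpose misses a coordinate, the diagonal ones included. The functional is therefore
  -- `2 aᵢ aⱼ`, and 2 cancels.
  square-zero : GenericCodim2 → CharNot2 R → ∀ a → Fil⁻ A 2 (λ s → linear a s * linear a s) →
    ∀ i j → i ≢ j → a i * a j ≈ 0#
  square-zero gen char≢2 a p i j i≢j = [ (λ e → contradiction e char≢2) , (λ e → e) ]′ (proj₂ domain (1# + 1#) (a i * a j) (begin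
    (1# + 1#) * (a i * a j)
      ≈⟨ solve 2 (λ x y → (con (1 , 0) :+ con (1 , 0)) :* (x :* y) := x :* y :+ y :* x) refl (a i) (a j) ⟩
    a i * a j + a j * a i
      ≈⟨ +-cong (*-congˡ row-i) (*-congˡ row-j) ⟨
    a i * row i + a j * row j ≈⟨ ∑-two n i j i≢j (λ k k≢i k≢j → trans (*-congˡ (row-other k k≢i k≢j)) (zeroʳ _)) ⟨
    ∑ n (λ k → a k * row k) ≈⟨ ∑-cong n (λ k → *-congˡ (functional-∑ C n a (λ l → product (pair k l)))) ⟨
    ∑ n (λ k → a k * functional C (λ s → ∑ n (λ l → a l * product (pair k l) s)))
      ≈⟨ functional-∑ C n a (λ k s → ∑ n (λ l → a l * product (pair k l) s)) ⟨
    functional C (λ s → ∑ n (λ k → a k * ∑ n (λ l → a l * product (pair k l) s)))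
      ≈⟨ functional-cong C (pointwise {λ s → linear a s * linear a s} expand) ⟨
    functional C (λ s → linear a s * linear a s) ≈⟨ functional-Fil⁻ C p ⟩
    0# ∎))
    where
    found = planeCube gen i j i≢j
    C = proj₁ found
    entry : Fin n → Fin n → Rc
    entry k l = functional C (product (pair k l))
    row : Fin n → Rc
    row k = ∑ n (λ l → a l * entry k l)
    expand : ∀ s → linear a s * linear a s ≈ ∑ n (λ k → a k * ∑ n (λ l → a l * product (pair k l) s))
    expand s = begin
      linear a s * linear a s ≈⟨ *-comm _ _ ⟩
      linear a s * linear a s ≈⟨ ∑-*ˡ n (linear a s) (λ k → a k * X k s) ⟨
      ∑ n (λ k → linear a s * (a k * X k s)) ≈⟨ ∑-cong n (λ k → trans
        (solve 3 (λ l b x → l :* (b :* x) := b :* (x :* l)) refl (linear a s) (a k) (X k s))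
        (*-congˡ (trans (sym (∑-*ˡ n (X k s) (λ l → a l * X l s)))
          (∑-cong n (λ l → solve 3 (λ x b y → x :* (b :* y) := b :* (x :* (y :* con (1 , 0)))) refl (X k s) (a l) (X l s)))))) ⟩
      ∑ n (λ k → a k * ∑ n (λ l → a l * product (pair k l) s)) ∎
    coord≢ : ∀ k b → k ≢ pair i j b → Cube.coord C k ≢ just b
    coord≢ k b k≢ q with any? (λ a → k ≟ pair i j a)
    ... | no ¬∃ = case ≡.trans (≡.sym (proj₂ (proj₂ found) k (λ a e → ¬∃ (a , e)))) q of λ ()
    ... | yes (a , ≡.refl) = k≢ (≡.cong (pair i j) (Maybeₚ.just-injective (≡.trans (≡.sym (proj₁ (proj₁ (proj₂ found) a))) q)))
    entry-0 : ∀ k l b → k ≢ pair i j b → l ≢ pair i j b → entry k l ≈ 0#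
    entry-0 k l b k≢ l≢ = functional-missed C b (pair k l) (λ { zero → coord≢ k b k≢ ; (suc zero) → coord≢ l b l≢ })
    entry-ij : entry i j ≈ 1#
    entry-ij = trans (functional-hit C (pair i j) (λ _ → true) (proj₁ (proj₂ found))) (∏-one 2 (λ _ → refl))
    entry-ji : entry j i ≈ 1#
    entry-ji = trans (functional-cong C (pointwise {product (pair j i)} {product (pair i j)}
      (λ s → solve 2 (λ x y → x :* (y :* con (1 , 0)) := y :* (x :* con (1 , 0))) refl (X j s) (X i s)))) entry-ij
    row-i : row i ≈ a j
    row-i = trans (∑-only n j (λ l l≢j → trans (*-congˡ (entry-0 i l (suc zero) i≢j l≢j)) (zeroʳ _)))
      (trans (*-congˡ entry-ij) (*-identityʳ _))
    row-j : row j ≈ a i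
    row-j = trans (∑-only n i (λ l l≢i → trans (*-congˡ (entry-0 j l zero (i≢j ∘ ≡.sym) l≢i)) (zeroʳ _)))
      (trans (*-congˡ entry-ji) (*-identityʳ _))
    row-other : ∀ k → k ≢ i → k ≢ j → row k ≈ 0#
    row-other k k≢i k≢j = ∑-zero n term
      where
      term : ∀ l → a l * entry k l ≈ 0#
      term l with l ≟ i
      ... | yes ≡.refl = trans (*-congˡ (entry-0 k l (suc zero) k≢j i≢j)) (zeroʳ _)
      ... | no l≢i     = trans (*-congˡ (entry-0 k l zero k≢i l≢i)) (zeroʳ _)

-- Matching the generators under the graded isomorphism.

module Generators {c ℓ} (R : CommutativeRing c ℓ) (𝕣 : RealField) (domain : IsIntegralDomain R) (char≢2 : CharNot2 R)
  (A₁ A₂ : Arrangements.Arrangement 𝕣) (generic : Arrangements.Arrangement.GenericCodim2 A₁)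
  (Φ : VG.GradedIso R 𝕣 A₁ A₂) where
  open CommutativeRing R renaming (Carrier to Rc) hiding (zero)
  open import Relation.Binary.Reasoning.Setoid setoid
  open RingLemmas R
  open DomainLemmas R domain
  open Arrangements 𝕣
  open VG R 𝕣
  open VG.GradedIso Φ
  open Solver using (solve; _:=_; _:+_; _:*_; _:-_; :-_; con)
  private
    module A₁ = Arrangement A₁
    module A₂ = Arrangement A₂
    module F₁ = Filtration R 𝕣 A₁
    module F₂ = Filtration R 𝕣 A₂
    module L₁ = LowDegree R 𝕣 domain A₁
    module L₂ = LowDegree R 𝕣 domain A₂
    module C₁ = CircuitRelation R 𝕣 A₁
    module C₂ = CircuitRelation R 𝕣 A₂

  -- An `f` of lower degree is congruent to `0# * f`, and linearity sends the latter to `0#` times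
  -- an image.
  φ-zero : ∀ k {f} (p : Fil A₁ k f) → Fil⁻ A₁ k f → Fil⁻ A₂ k (φ k f p)
  φ-zero k {f} p f∼0 = F₂.∼0⇒Fil⁻ k (F₂.∼-trans k
    (φ-cong k f (λ s → 0# * f s) p q (F₁.∼-trans k (F₁.Fil⁻⇒∼0 k f∼0) (F₁.∼-refl k λ s → sym (zeroˡ _))))
    (F₂.∼-trans k (φ-· k 0# f p q) (F₂.∼-refl k λ s → zeroˡ _)))
    where q = F₁.Fil-scale 0# p

  φ-reflects : ∀ k {f g} (p : Fil A₁ k f) (q : Fil A₁ k g) → _∼[_]_ A₂ (φ k f p) k (φ k g q) → _∼[_]_ A₁ f k g
  φ-reflects k {f} {g} p q φf∼φg = F₁.Fil⁻-cong k (F₁.pointwise λ s →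
      solve 2 (λ x y → (x :+ (:- con (1 , 0)) :* y) :- con (0 , 0) := x :- y) refl (f s) (g s))
    (φ-inj k h h∈ (F₂.∼-trans k (φ-+ k f (λ s → - 1# * g s) p -g∈ h∈)
      (F₂.∼-trans k (F₂.∼-+ k φf∼φg (φ-· k (- 1#) g q -g∈))
        (F₂.∼-refl k λ s → solve 1 (λ x → x :+ (:- con (1 , 0)) :* x := con (0 , 0)) refl (φ k g q s)))))
    where
    -g∈ = F₁.Fil-scale (- 1#) q
    h = λ s → f s + - 1# * g s
    h∈ = F₁.Fil-+ p -g∈

  φ-∑ : ∀ k m (x : Fin m → Rc) (f : Fin m → VGel A₁) (g : Fin m → VGel A₂) (f∈ : ∀ b → Fil A₁ k (f b)) →
    (∀ b → _∼[_]_ A₂ (φ k (f b) (f∈ b)) k (g b)) → (p : Fil A₁ k (λ s → ∑ m (λ b → x b * f b s))) →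
    _∼[_]_ A₂ (φ k (λ s → ∑ m (λ b → x b * f b s)) p) k (λ s → ∑ m (λ b → x b * g b s))
  φ-∑ k zero    x f g f∈ φf∼g p = F₂.Fil⁻⇒∼0 k (φ-zero k p (F₁.Fil⁻-0 k λ _ _ → refl))
  φ-∑ k (suc m) x f g f∈ φf∼g p = F₂.∼-trans k (φ-+ k (λ s → x zero * f zero s) (λ s → ∑ m (λ b → x (suc b) * f (suc b) s)) head∈ tail∈ p)
    (F₂.∼-+ k (F₂.∼-trans k (φ-· k (x zero) (f zero) (f∈ zero) head∈) (F₂.∼-scale k (x zero) (φf∼g zero)))
      (φ-∑ k m (x ∘ suc) (f ∘ suc) (g ∘ suc) (f∈ ∘ suc) (φf∼g ∘ suc) tail∈))
    where
    head∈ = F₁.Fil-scale (x zero) (f∈ zero)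
    tail∈ = F₁.Fil-∑ m (λ b s → x (suc b) * f (suc b) s) (λ b → F₁.Fil-scale (x (suc b)) (f∈ (suc b)))

  φ-∏ : ∀ k (f : Fin k → VGel A₁) (g : Fin k → VGel A₂) (f∈ : ∀ a → Fil A₁ 1 (f a)) → (∀ a → Fil A₂ 1 (g a)) →
    (∀ a → _∼[_]_ A₂ (φ 1 (f a) (f∈ a)) 1 (g a)) → (p : Fil A₁ k (λ s → ∏ k (λ a → f a s))) →
    _∼[_]_ A₂ (φ k (λ s → ∏ k (λ a → f a s)) p) k (λ s → ∏ k (λ a → g a s))
  φ-∏ zero    f g f∈ g∈ φf∼g p = φ-unit p
  φ-∏ (suc k) f g f∈ g∈ φf∼g p = F₂.∼-trans (suc k) (φ-mult 1 k (f zero) (λ s → ∏ k (λ a → f (suc a) s)) (f∈ zero) tail∈ p)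
    (F₂.∼-* 1 k (φ-Fil 1 (f zero) (f∈ zero)) (F₂.Fil-∏ k (g ∘ suc) (g∈ ∘ suc)) (φf∼g zero)
      (φ-∏ k (f ∘ suc) (g ∘ suc) (f∈ ∘ suc) (g∈ ∘ suc) (φf∼g ∘ suc) tail∈))
    where tail∈ = F₁.Fil-∏ k (f ∘ suc) (f∈ ∘ suc)

  preimage : ∀ i → Σ (Fin A₁.n → Rc) λ a → _∼[_]_ A₂ (φ 1 (F₁.linear a) (F₁.Fil-linear a)) 1 (F₂.X i)
  preimage i = let f , f∈ , φf∼X = φ-surj 1 (F₂.X i) (F₂.Fil-X i)
                   a , f∼a = F₁.Fil₁⇒linear f∈
               in a , F₂.∼-trans 1 (φ-cong 1 (F₁.linear a) f (F₁.Fil-linear a) f∈ (F₁.∼-sym 1 f∼a)) φf∼X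

  -- X i is idempotent, so its class in degree one squares to zero.
  preimage-square : ∀ i {a} → _∼[_]_ A₂ (φ 1 (F₁.linear a) (F₁.Fil-linear a)) 1 (F₂.X i) →
    Fil⁻ A₁ 2 (λ s → F₁.linear a s * F₁.linear a s)
  preimage-square i {a} φa∼X = F₁.∼0⇒Fil⁻ 2 (φ-inj 2 (λ s → F₁.linear a s * F₁.linear a s) a²∈
    (F₂.∼-trans 2 (φ-mult 1 1 (F₁.linear a) (F₁.linear a) a∈ a∈ a²∈)
      (F₂.∼-trans 2 (F₂.∼-* 1 1 (φ-Fil 1 (F₁.linear a) a∈) (F₂.Fil-X i) φa∼X φa∼X)
        (F₂.Fil⁻⇒∼0 2 (F₂.Fil-cong (F₂.pointwise λ s → idempotent (s i)) (F₂.Fil-X i))))))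
    where
    a∈ = F₁.Fil-linear a
    a²∈ = F₁.Fil-* a∈ a∈
    idempotent : ∀ b → (if b then 1# else 0#) ≈ (if b then 1# else 0#) * (if b then 1# else 0#)
    idempotent true  = sym (*-identityʳ 1#)
    idempotent false = sym (zeroˡ 0#)

  Generator : Fin A₂.n → Set _
  Generator i = ∃[ j ] Σ Rc λ u → ¬ (u ≈ 0#) × Σ (Fil A₁ 1 (λ s → u * F₁.X j s)) λ p →
    _∼[_]_ A₂ (φ 1 (λ s → u * F₁.X j s) p) 1 (F₂.X i)

  -- Elements of R are not tested for zero. Each vanishing product says which of its factors
  -- vanishes, and the nested uses of `find` assemble these answers.
  at-most-one-nonzero : ∀ m (a : Fin m → Rc) → (∀ j k → j ≢ k → a j * a k ≈ 0#) →
    (∃[ j ] (∀ k → k ≢ j → a k ≈ 0#)) ⊎ (∀ k → a k ≈ 0#)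
  at-most-one-nonzero m a products≈0 = find m split
    where
    split : ∀ j → (∀ k → k ≢ j → a k ≈ 0#) ⊎ a j ≈ 0#
    split j = [ (λ (_ , e) → inj₂ e) , inj₁ ]′ (find m {λ _ → a j ≈ 0#} {λ k → k ≢ j → a k ≈ 0#} choose)
      where
      choose : ∀ k → a j ≈ 0# ⊎ (k ≢ j → a k ≈ 0#)
      choose k with k ≟ j
      ... | yes k≡j = inj₂ λ k≢j → contradiction k≡j k≢j
      ... | no k≢j  = [ inj₁ , (λ e → inj₂ λ _ → e) ]′ (proj₂ domain (a j) (a k) (products≈0 j k (k≢j ∘ ≡.sym)))

  image-nonzero : ∀ i {f} (p : Fil A₁ 1 f) → _∼[_]_ A₂ (φ 1 f p) 1 (F₂.X i) → ¬ Fil⁻ A₁ 1 f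
  image-nonzero i p φf∼X f∼0 = L₂.X-nonzero i
    (F₂.∼0⇒Fil⁻ 1 (F₂.∼-trans 1 (F₂.∼-sym 1 φf∼X) (F₂.Fil⁻⇒∼0 1 (φ-zero 1 p f∼0))))

  generator-exists : ∀ i → Generator i
  generator-exists i = let a , φa∼X = preimage i in
    [ (λ (j , others≈0) → build a φa∼X j others≈0)
    , (λ a≈0 → contradiction (F₁.Fil⁻-0 1 λ s _ → ∑-zero A₁.n (λ k → trans (*-congʳ (a≈0 k)) (zeroˡ _)))
                 (image-nonzero i (F₁.Fil-linear a) φa∼X))
    ]′ (at-most-one-nonzero A₁.n a (L₁.square-zero generic char≢2 a (preimage-square i φa∼X)))
    where
    build : ∀ a → _∼[_]_ A₂ (φ 1 (F₁.linear a) (F₁.Fil-linear a)) 1 (F₂.X i) →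
      ∀ j → (∀ k → k ≢ j → a k ≈ 0#) → Generator i
    build a φa∼X j others≈0 = j , a j , aj≉0 , p , φX
      where
      p = F₁.Fil-scale (a j) (F₁.Fil-X j)
      φX : _∼[_]_ A₂ (φ 1 (λ s → a j * F₁.X j s) p) 1 (F₂.X i)
      φX = F₂.∼-trans 1 (φ-cong 1 (λ s → a j * F₁.X j s) (F₁.linear a) p (F₁.Fil-linear a)
        (F₁.∼-refl 1 λ s → sym (∑-only A₁.n j (λ k k≢j → trans (*-congʳ (others≈0 k k≢j)) (zeroˡ _))))) φa∼X
      aj≉0 : ¬ (a j ≈ 0#)
      aj≉0 e = image-nonzero i p φX (F₁.Fil⁻-0 1 λ s _ → trans (*-congʳ e) (zeroˡ _))

  abstract
    generator : ∀ i → Generator i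
    generator = generator-exists

  -- The direction is forced: the square-zero criterion holds in the generic `A₁`, so it is the
  -- preimages of the generators of `A₂` that are recognised.
  π : Fin A₂.n → Fin A₁.n
  π i = proj₁ (generator i)

  u : Fin A₂.n → Rc
  u i = proj₁ (proj₂ (generator i))

  u≉0 : ∀ i → ¬ (u i ≈ 0#)
  u≉0 i = proj₁ (proj₂ (proj₂ (generator i)))

  Y : Fin A₂.n → VGel A₁
  Y i s = u i * F₁.X (π i) s

  Fil-Y : ∀ i → Fil A₁ 1 (Y i)
  Fil-Y i = proj₁ (proj₂ (proj₂ (proj₂ (generator i))))

  φ-Y : ∀ i → _∼[_]_ A₂ (φ 1 (Y i) (Fil-Y i)) 1 (F₂.X i)
  φ-Y i = proj₂ (proj₂ (proj₂ (proj₂ (generator i))))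

  combination : ∀ {m k} → (Fin m → Rc) → (Fin m → Fin k → Fin A₂.n) → VGel A₁
  combination {m} {k} x t s = ∑ m (λ b → x b * ∏ k (λ a → Y (t b a) s))

  Fil-combination : ∀ {m k} x (t : Fin m → Fin k → Fin A₂.n) → Fil A₁ k (combination x t)
  Fil-combination {m} {k} x t = F₁.Fil-∑ m (λ b s → x b * ∏ k (λ a → Y (t b a) s))
    (λ b → F₁.Fil-scale (x b) (F₁.Fil-∏ k (Y ∘ t b) (Fil-Y ∘ t b)))

  φ-combination : ∀ {m k} x (t : Fin m → Fin k → Fin A₂.n) →
    _∼[_]_ A₂ (φ k (combination x t) (Fil-combination x t)) k (λ s → ∑ m (λ b → x b * F₂.product (t b) s))
  φ-combination {m} {k} x t = φ-∑ k m x (λ b s → ∏ k (λ a → Y (t b a) s)) (λ b → F₂.product (t b))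
    (λ b → F₁.Fil-∏ k (Y ∘ t b) (Fil-Y ∘ t b))
    (λ b → φ-∏ k (Y ∘ t b) (F₂.X ∘ t b) (Fil-Y ∘ t b) (F₂.Fil-X ∘ t b) (φ-Y ∘ t b) (F₁.Fil-∏ k (Y ∘ t b) (Fil-Y ∘ t b)))
    (Fil-combination x t)

  φ-linear : ∀ (b : Fin A₂.n → Rc) (p : Fil A₁ 1 (λ s → ∑ A₂.n (λ i → b i * Y i s))) →
    _∼[_]_ A₂ (φ 1 (λ s → ∑ A₂.n (λ i → b i * Y i s)) p) 1 (F₂.linear b)
  φ-linear b = φ-∑ 1 A₂.n b Y F₂.X Fil-Y φ-Y

  Fil-∑Y : ∀ (b : Fin A₂.n → Rc) → Fil A₁ 1 (λ s → ∑ A₂.n (λ i → b i * Y i s))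
  Fil-∑Y b = F₁.Fil-∑ A₂.n (λ i s → b i * Y i s) (λ i → F₁.Fil-scale (b i) (Fil-Y i))

  -- If `π i = π j`, then `u j · Y i - u i · Y j` is zero, and so is its image
  -- `u j · X i - u i · X j`. Independence of the generators of `A₂` then contradicts `u j ≠ 0`.
  π-injective : ∀ i j → π i ≡ π j → i ≡ j
  π-injective i j πi≡πj with i ≟ j
  ... | yes i≡j = i≡j
  ... | no i≢j  = contradiction (trans (sym b-i) (L₂.linear-independent b (F₂.∼0⇒Fil⁻ 1
          (F₂.∼-trans 1 (F₂.∼-sym 1 (φ-linear b (Fil-∑Y b))) (F₂.Fil⁻⇒∼0 1 (φ-zero 1 (Fil-∑Y b) vanish)))) i)) (u≉0 j)
    where
    b : Fin A₂.n → Rc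
    b k = if does (k ≟ i) then u j else if does (k ≟ j) then - u i else 0#
    b-i : b i ≈ u j
    b-i with i ≟ i
    ... | yes _ = refl
    ... | no ne = contradiction ≡.refl ne
    b-j : b j ≈ - u i
    b-j with j ≟ i | j ≟ j
    ... | yes e | _     = contradiction (≡.sym e) i≢j
    ... | no _  | yes _ = refl
    ... | no _  | no ne = contradiction ≡.refl ne
    b-other : ∀ k → k ≢ i → k ≢ j → b k ≈ 0#
    b-other k k≢i k≢j with k ≟ i | k ≟ j
    ... | yes e | _     = contradiction e k≢i
    ... | no _  | yes e = contradiction e k≢j
    ... | no _  | no _  = refl
    vanish : Fil⁻ A₁ 1 (λ s → ∑ A₂.n (λ k → b k * Y k s))
    vanish = F₁.Fil⁻-0 1 λ s _ → begin
      ∑ A₂.n (λ k → b k * Y k s)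
        ≈⟨ ∑-two A₂.n i j i≢j (λ k k≢i k≢j → trans (*-congʳ (b-other k k≢i k≢j)) (zeroˡ _)) ⟩
      b i * Y i s + b j * Y j s
        ≈⟨ +-cong (*-congʳ b-i) (*-cong b-j (*-congˡ (reflexive (≡.cong (λ l → F₁.X l s) (≡.sym πi≡πj))))) ⟩
      u j * (u i * F₁.X (π i) s) + - u i * (u j * F₁.X (π i) s)
        ≈⟨ solve 3 (λ a b x → a :* (b :* x) :+ :- b :* (a :* x) := con (0 , 0)) refl (u j) (u i) (F₁.X (π i) s) ⟩
      0# ∎

  Inverse : Fin A₁.n → Set _
  Inverse j = ∃[ i ] (π i ≡ j × Σ Rc λ v → u i * v ≈ 1#)

  -- The image of `X j` expands in the generators of `A₂`; pulled back, `X j` is the sum of the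
  -- `b i · u i · X (π i)`. The edge crossing hyperplane `j` reads off 1 as the sum of `b i · u i`
  -- over `π i = j`. This yields an index over `j` and the invertibility of its `u i` at once.
  π-surjective : ∀ j → Inverse j
  π-surjective j = inverse
    where
    expansion = F₂.Fil₁⇒linear (φ-Fil 1 (F₁.X j) (F₁.Fil-X j))
    b = proj₁ expansion
    φX∼b = proj₂ expansion
    X∼ : _∼[_]_ A₁ (F₁.X j) 1 (λ s → ∑ A₂.n (λ i → b i * Y i s))
    X∼ = φ-reflects 1 (F₁.Fil-X j) (Fil-∑Y b) (F₂.∼-trans 1 φX∼b (F₂.∼-sym 1 (φ-linear b (Fil-∑Y b))))
    coefficient : ∀ i → Rc
    coefficient i = b i * (u i * L₁.lineFunctional j (F₁.X (π i)))
    1≈∑ : 1# ≈ ∑ A₂.n coefficient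
    1≈∑ = begin
      1# ≈⟨ solve 2 (λ x y → x := (x :+ (:- con (1 , 0)) :* y) :+ y) refl 1# (∑ A₂.n coefficient) ⟩
      (1# + - 1# * ∑ A₂.n coefficient) + ∑ A₂.n coefficient ≈⟨ +-congʳ difference≈0 ⟩
      0# + ∑ A₂.n coefficient ≈⟨ +-identityˡ _ ⟩
      ∑ A₂.n coefficient ∎
      where
      open CubeSums R
      -- `X j` and the terms of its expansion form one family, so that a single linear combination
      -- represents the difference.
      f : Fin (suc A₂.n) → VGel A₁
      f = F₁.X j ◂ (F₁.X ∘ π)
      x : Fin (suc A₂.n) → Rc
      x = 1# ◂ (λ i → - 1# * (b i * u i))
      difference≈0 : 1# + - 1# * ∑ A₂.n coefficient ≈ 0#
      difference≈0 = begin
        1# + - 1# * ∑ A₂.n coefficient ≈⟨ +-cong (trans (*-identityˡ _) (L₁.functional-X-on j)) (∑-*ˡ A₂.n (- 1#) coefficient) ⟨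
        1# * L₁.lineFunctional j (F₁.X j) + ∑ A₂.n (λ i → - 1# * coefficient i)
          ≈⟨ +-congˡ (∑-cong A₂.n (λ i → solve 4 (λ o b u l → o :* (b :* (u :* l)) := (o :* (b :* u)) :* l) refl (- 1#) (b i) (u i) (L₁.lineFunctional j (F₁.X (π i))))) ⟩
        ∑ (suc A₂.n) (λ i → x i * L₁.lineFunctional j (f i)) ≈⟨ L₁.lineFunctional-∑ j (suc A₂.n) x f ⟨
        L₁.lineFunctional j (λ s → ∑ (suc A₂.n) (λ i → x i * f i s))
          ≈⟨ L₁.lineFunctional-Fil⁻ j (F₁.Fil⁻-cong 1 (F₁.pointwise regroup) X∼) ⟩
        0# ∎
        where
        regroup : ∀ s → F₁.X j s - ∑ A₂.n (λ i → b i * Y i s) ≈ ∑ (suc A₂.n) (λ i → x i * f i s)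
        regroup s = begin
          F₁.X j s - ∑ A₂.n (λ i → b i * Y i s)
            ≈⟨ solve 2 (λ x y → x :- y := con (1 , 0) :* x :+ (:- con (1 , 0)) :* y) refl (F₁.X j s) (∑ A₂.n (λ i → b i * Y i s)) ⟩
          1# * F₁.X j s + - 1# * ∑ A₂.n (λ i → b i * Y i s) ≈⟨ +-congˡ (∑-*ˡ A₂.n (- 1#) (λ i → b i * Y i s)) ⟨
          1# * F₁.X j s + ∑ A₂.n (λ i → - 1# * (b i * Y i s))
            ≈⟨ +-congˡ (∑-cong A₂.n (λ i → solve 4 (λ o b u l → o :* (b :* (u :* l)) := (o :* (b :* u)) :* l) refl (- 1#) (b i) (u i) (F₁.X (π i) s))) ⟩
          ∑ (suc A₂.n) (λ i → x i * f i s) ∎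
    off : ∀ i → π i ≢ j → coefficient i ≈ 0#
    off i πi≢j = trans (*-congˡ (trans (*-congˡ (L₁.functional-X-off j (π i) πi≢j)) (zeroʳ _))) (zeroʳ _)
    inverse : Inverse j
    inverse with any? (λ i → π i ≟ j)
    ... | no ¬∃ = contradiction (trans 1≈∑ (∑-zero A₂.n (λ i → off i (λ e → ¬∃ (i , e))))) 1≉0
    ... | yes (i , πi≡j) = i , πi≡j , b i , (begin
      u i * b i ≈⟨ *-comm _ _ ⟩
      b i * u i ≈⟨ *-congˡ (*-identityʳ _) ⟨
      b i * (u i * 1#) ≈⟨ *-congˡ (*-congˡ (trans (reflexive (≡.cong (λ l → L₁.lineFunctional j (F₁.X l)) πi≡j)) (L₁.functional-X-on j))) ⟨
      coefficient i ≈⟨ ∑-only A₂.n i (λ k k≢i → off k (λ πk≡j → k≢i (π-injective k i (≡.trans πk≡j (≡.sym πi≡j))))) ⟨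
      ∑ A₂.n coefficient ≈⟨ 1≈∑ ⟨
      1# ∎)

  ρ : Fin A₁.n → Fin A₂.n
  ρ j = proj₁ (π-surjective j)

  πρ : ∀ j → π (ρ j) ≡ j
  πρ j = proj₁ (proj₂ (π-surjective j))

  ρπ : ∀ i → ρ (π i) ≡ i
  ρπ i = π-injective (ρ (π i)) i (πρ (π i))

  v : Fin A₁.n → Rc
  v j = proj₁ (proj₂ (proj₂ (π-surjective j)))

  uv≈1 : ∀ j → u (ρ j) * v j ≈ 1#
  uv≈1 j = proj₂ (proj₂ (proj₂ (π-surjective j)))

  v≉0 : ∀ j → ¬ (v j ≈ 0#)
  v≉0 j v≈0 = 1≉0 (trans (sym (uv≈1 j)) (trans (*-congˡ v≈0) (zeroʳ _)))

  -- A relation in `A₂` is the image of the same combination of products of the `Y`'s; injectivity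
  -- of the isomorphism pulls its vanishing back to `A₁`.
  transports₂₁ : Transfer.Transports R 𝕣 domain A₂ A₁ π u
  transports₂₁ k e x relation = F₁.Fil⁻-cong k (F₁.pointwise rescale)
    (F₁.∼0⇒Fil⁻ k (φ-inj k (combination x t) (Fil-combination x t)
      (F₂.∼-trans k (φ-combination x t) (F₂.Fil⁻⇒∼0 k relation))))
    where
    t : Fin (suc k) → Fin k → Fin A₂.n
    t b = e ∘ punchIn b
    rescale : ∀ s → combination x t s ≈ C₁.relator (λ b → x b * ∏ k (u ∘ e ∘ punchIn b)) (π ∘ e) s
    rescale s = ∑-cong (suc k) (λ b → trans (*-congˡ (∏-* k (u ∘ t b) (λ a → F₁.X (π (t b a)) s)))
      (sym (*-assoc (x b) (∏ k (u ∘ t b)) (F₁.product (π ∘ t b) s))))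

  -- Invertibility of the `u`'s turns `X j` into `v j · Y (ρ j)`, so a relation in `A₁` is a
  -- combination of products of the `Y`'s and can be pushed forward.
  transports₁₂ : Transfer.Transports R 𝕣 domain A₁ A₂ ρ v
  transports₁₂ k e x relation = F₂.∼0⇒Fil⁻ k (F₂.∼-trans k (F₂.∼-sym k (φ-combination y t))
    (F₂.Fil⁻⇒∼0 k (φ-zero k (Fil-combination y t) (F₁.Fil⁻-cong k (F₁.pointwise rescale) relation))))
    where
    t : Fin (suc k) → Fin k → Fin A₂.n
    t b = ρ ∘ e ∘ punchIn b
    y : Fin (suc k) → Rc
    y b = x b * ∏ k (v ∘ e ∘ punchIn b)
    rescale : ∀ s → C₁.relator x e s ≈ combination y t s
    rescale s = ∑-cong (suc k) (λ b → begin
      x b * F₁.product (e ∘ punchIn b) s ≈⟨ *-congˡ (∏-cong k (λ a → cancel (e (punchIn b a)))) ⟩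
      x b * ∏ k (λ a → v (e (punchIn b a)) * Y (t b a) s) ≈⟨ *-congˡ (∏-* k (v ∘ e ∘ punchIn b) (λ a → Y (t b a) s)) ⟩
      x b * (∏ k (v ∘ e ∘ punchIn b) * ∏ k (λ a → Y (t b a) s)) ≈⟨ *-assoc _ _ _ ⟨
      y b * ∏ k (λ a → Y (t b a) s) ∎)
      where
      cancel : ∀ j → F₁.X j s ≈ v j * Y (ρ j) s
      cancel j = begin
        F₁.X j s ≈⟨ *-identityˡ _ ⟨
        1# * F₁.X j s ≈⟨ *-cong (uv≈1 j) (reflexive (≡.cong (λ l → F₁.X l s) (πρ j))) ⟨
        (u (ρ j) * v j) * F₁.X (π (ρ j)) s ≈⟨ solve 3 (λ u v x → (u :* v) :* x := v :* (u :* x)) refl (u (ρ j)) (v j) _ ⟩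
        v j * Y (ρ j) s ∎

-- Circuits under a bijection of the ground sets.

comap : ∀ {m n} → (Fin m → Fin n) → Subset n → Subset m
comap f p = Vec.tabulate (λ x → Vec.lookup p (f x))

∈-comap⁺ : ∀ {m n} (f : Fin m → Fin n) {p x} → f x ∈ p → x ∈ comap f p
∈-comap⁺ f {p} {x} fx∈p = Vecₚ.lookup⇒[]= x _ (≡.trans (Vecₚ.lookup∘tabulate _ x) (Vecₚ.[]=⇒lookup fx∈p))

∈-comap⁻ : ∀ {m n} (f : Fin m → Fin n) {p x} → x ∈ comap f p → f x ∈ p
∈-comap⁻ f {p} {x} x∈ = Vecₚ.lookup⇒[]= (f x) p (≡.trans (≡.sym (Vecₚ.lookup∘tabulate _ x)) (Vecₚ.[]=⇒lookup x∈))

module CircuitMap (𝕣 : RealField) (A B : Arrangements.Arrangement 𝕣) where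
  private
    module A = Arrangements.Arrangement A
    module B = Arrangements.Arrangement B

  -- The image of `I` under `π` is written as `comap ρ I`. The hypotheses carry over circuits only,
  -- so for minimality a dependent proper subset `K` of the image is first shrunk to a circuit;
  -- transported back, that circuit makes a proper subset of `I` dependent.
  circuit-map : (π : Fin A.n → Fin B.n) (ρ : Fin B.n → Fin A.n) → (∀ i → ρ (π i) ≡ i) → (∀ j → π (ρ j) ≡ j) →
    (∀ {I J} → A.IsCircuit I → (∀ i → i ∈ I → π i ∈ J) → B.Dependent J) →
    (∀ {J I} → B.IsCircuit J → (∀ j → j ∈ J → ρ j ∈ I) → A.Dependent I) →
    ∀ {I} → A.IsCircuit I → B.IsCircuit (comap ρ I)
  circuit-map π ρ ρπ πρ forth back {I} circ = forth circ (λ i i∈I → ∈-comap⁺ ρ (≡.subst (_∈ I) (≡.sym (ρπ i)) i∈I)) , minimal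
    where
    minimal : ∀ K → K ⊂ comap ρ I → ¬ B.Dependent K
    minimal K (K⊆ , j , j∈ , j∉K) dep with Matroid.dependent⇒circuit 𝕣 B dep
    ... | K′ , K′⊆K , circ′ = proj₂ circ (comap π K) (⊆I , ρ j , ∈-comap⁻ ρ j∈ , ρj∉)
      (back circ′ (λ l l∈K′ → ∈-comap⁺ π (≡.subst (_∈ K) (≡.sym (πρ l)) (K′⊆K l∈K′))))
      where
      ⊆I : comap π K ⊆ I
      ⊆I {i} i∈ = ≡.subst (_∈ I) (ρπ i) (∈-comap⁻ ρ (K⊆ (∈-comap⁻ π i∈)))
      ρj∉ : ρ j ∉ comap π K
      ρj∉ ρj∈ = j∉K (≡.subst (_∈ K) (πρ j) (∈-comap⁻ π ρj∈))

-- Signs that make the scaling factors coherent.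

module SignChoice {c ℓ} (R : CommutativeRing c ℓ) (domain : IsIntegralDomain R) where
  open CommutativeRing R renaming (Carrier to Rc) hiding (zero)
  open import Relation.Binary.Reasoning.Setoid setoid
  open RingLemmas R
  open DomainLemmas R domain
  open Solver using (solve; _:=_; _:+_; _:*_; _:-_; :-_; con)

  sg-transpose : ∀ a b {x y} → sg a * x ≈ sg b * y → x ≈ sg (a ⊛ b) * y
  sg-transpose a b {x} {y} e = begin
    x ≈⟨ *-identityˡ x ⟨
    1# * x ≈⟨ *-congʳ (sg-square a) ⟨
    (sg a * sg a) * x ≈⟨ *-assoc _ _ _ ⟩
    sg a * (sg a * x) ≈⟨ *-congˡ e ⟩
    sg a * (sg b * y) ≈⟨ *-assoc _ _ _ ⟨
    (sg a * sg b) * y ≈⟨ *-congʳ (sg-⊛ a b) ⟨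
    sg (a ⊛ b) * y ∎

  sg-scale : ∀ γ a {x} → sg (γ ⊛ a) * x ≈ sg γ * (sg a * x)
  sg-scale γ a = trans (*-congʳ (sg-⊛ γ a)) (*-assoc _ _ _)

  module _ {n} (u : Fin n → Rc) where

    -- A union-find state: equality in R is not decidable, so the classes of u_i = ± u_j are
    -- not available, only those generated by the pairs joined so far.
    record Signing : Set (c ⊔ ℓ) where
      field
        label    : Fin n → Fin n
        ε        : Fin n → Bool
        coherent : ∀ i j → label i ≡ label j → sg (ε i) * u i ≈ sg (ε j) * u j

    open Signing

    Coarsens : Signing → Signing → Set
    Coarsens S S′ = ∀ a b → label S a ≡ label S b → label S′ a ≡ label S′ b

    join : ∀ (S : Signing) i j β → u i ≈ sg β * u j → Σ Signing λ S′ → Coarsens S S′ × label S′ i ≡ label S′ j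
    join S i j β uᵢ≈βuⱼ = record { label = label′ ; ε = ε′ ; coherent = coherent′ } , coarsens , joined
      where
      γ : Bool
      -- The factor by which the class of `j` must be re-signed: `γ · ε_j · u_j = ε_i · β · u_j =
      -- ε_i · u_i`.
      γ = (ε S i ⊛ β) ⊛ ε S j
      relabel : ∀ k → Dec (label S k ≡ label S j) → Fin n
      relabel k d = if does d then label S i else label S k
      resign : ∀ k → Dec (label S k ≡ label S j) → Bool
      resign k d = if does d then γ ⊛ ε S k else ε S k
      label′ : Fin n → Fin n
      label′ k = relabel k (label S k ≟ label S j)
      ε′ : Fin n → Bool
      ε′ k = resign k (label S k ≟ label S j)
      move : ∀ k → label S k ≡ label S j → sg (γ ⊛ ε S k) * u k ≈ sg (ε S i) * u i
      move k q = begin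
        sg (γ ⊛ ε S k) * u k ≈⟨ sg-scale γ (ε S k) ⟩
        sg γ * (sg (ε S k) * u k) ≈⟨ *-congˡ (coherent S k j q) ⟩
        sg γ * (sg (ε S j) * u j) ≈⟨ *-congʳ (trans (sg-⊛ (ε S i ⊛ β) (ε S j)) (*-congʳ (sg-⊛ (ε S i) β))) ⟩
        sg (ε S i) * sg β * sg (ε S j) * (sg (ε S j) * u j)
          ≈⟨ solve 4 (λ e b f v → e :* b :* f :* (f :* v) := (f :* f) :* (e :* (b :* v))) refl (sg (ε S i)) (sg β) (sg (ε S j)) (u j) ⟩
        sg (ε S j) * sg (ε S j) * (sg (ε S i) * (sg β * u j))
          ≈⟨ *-cong (sg-square (ε S j)) (*-congˡ (sym uᵢ≈βuⱼ)) ⟩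
        1# * (sg (ε S i) * u i) ≈⟨ *-identityˡ _ ⟩
        sg (ε S i) * u i ∎
      coherent″ : ∀ a b (d : Dec (label S a ≡ label S j)) (d′ : Dec (label S b ≡ label S j)) →
        relabel a d ≡ relabel b d′ → sg (resign a d) * u a ≈ sg (resign b d′) * u b
      coherent″ a b (yes p) (yes q) _ = trans (move a p) (sym (move b q))
      coherent″ a b (yes p) (no _)  e = trans (move a p) (coherent S i b e)
      coherent″ a b (no _)  (yes q) e = trans (coherent S a i e) (sym (move b q))
      coherent″ a b (no _)  (no _)  e = coherent S a b e
      coherent′ : ∀ a b → label′ a ≡ label′ b → sg (ε′ a) * u a ≈ sg (ε′ b) * u b
      coherent′ a b = coherent″ a b (label S a ≟ label S j) (label S b ≟ label S j)
      coarsens : ∀ a b → label S a ≡ label S b → label′ a ≡ label′ b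
      coarsens a b e with label S a ≟ label S j | label S b ≟ label S j
      ... | yes _ | yes _ = ≡.refl
      ... | yes p | no ¬q = contradiction (≡.trans (≡.sym e) p) ¬q
      ... | no ¬p | yes q = contradiction (≡.trans e q) ¬p
      ... | no _  | no _  = e
      joined : label′ i ≡ label′ j
      joined with label S i ≟ label S j | label S j ≟ label S j
      ... | yes _ | yes _ = ≡.refl
      ... | no _  | yes _ = ≡.refl
      ... | _     | no ne = contradiction ≡.refl ne

    module _ (Related : Fin n → Fin n → Set) (related? : ∀ i j → Dec (Related i j))
             (ratio : ∀ {i j} → Related i j → ∃[ β ] u i ≈ sg β * u j) where

      joinAll : ∀ m (edge : Fin m → Fin n × Fin n) (S : Signing) → Σ Signing λ S′ → Coarsens S S′ ×
        (∀ a → Related (proj₁ (edge a)) (proj₂ (edge a)) → label S′ (proj₁ (edge a)) ≡ label S′ (proj₂ (edge a)))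
      joinAll zero    edge S = S , (λ _ _ e → e) , λ ()
      joinAll (suc m) edge S =
        let S₁ , S⇒S₁ , first = step
            S₂ , S₁⇒S₂ , rest = joinAll m (edge ∘ suc) S₁
        in S₂ , (λ a b e → S₁⇒S₂ a b (S⇒S₁ a b e)) , λ { zero r → S₁⇒S₂ _ _ (first r) ; (suc a) r → rest a r }
        where
        i = proj₁ (edge zero)
        j = proj₂ (edge zero)
        step : Σ Signing λ S′ → Coarsens S S′ × (Related i j → label S′ i ≡ label S′ j)
        step with related? i j
        ... | no ¬r = S , (λ _ _ e → e) , λ r → contradiction r ¬r
        ... | yes r = let β , e = ratio r
                          S′ , S⇒S′ , joined = join S i j β e
                      in S′ , S⇒S′ , λ _ → joined

      coherentSigns : Σ (Fin n → Bool) λ ε → ∀ i j → Related i j → sg (ε i) * u i ≈ sg (ε j) * u j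
      coherentSigns = ε S , λ i j r → coherent S i j (≡.subst (λ p → Related (proj₁ p) (proj₂ p) → label S (proj₁ p) ≡ label S (proj₂ p))
          (remQuot-combine i j) (proj₂ (proj₂ all) (combine i j)) r)
        where
        discrete : Signing
        discrete = record { label = λ i → i ; ε = λ _ → true ; coherent = λ { _ _ ≡.refl → refl } }
        all = joinAll (n ℕ.* n) (remQuot n) discrete
        S = proj₁ all

  -- The second use of characteristic different from 2: signs can be read back from R because 1 and
  -- -1 differ there, also after scaling by a nonzero element.
  sg-injective : CharNot2 R → ∀ a b {y} → ¬ (y ≈ 0#) → sg a * y ≈ sg b * y → a ≡ b
  sg-injective char≢2 true  true  _   _ = ≡.refl
  sg-injective char≢2 false false _   _ = ≡.refl
  sg-injective char≢2 true  false y≉0 e = contradiction e (1≉-1 char≢2 y≉0)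
    where
    1≉-1 : CharNot2 R → ∀ {y} → ¬ (y ≈ 0#) → ¬ (1# * y ≈ - 1# * y)
    1≉-1 char≢2 {y} y≉0 e = *-≉0 char≢2 y≉0 (begin
      (1# + 1#) * y ≈⟨ solve 1 (λ y → (con (1 , 0) :+ con (1 , 0)) :* y := con (1 , 0) :* y :+ con (1 , 0) :* y) refl y ⟩
      1# * y + 1# * y ≈⟨ +-congˡ e ⟩
      1# * y + - 1# * y ≈⟨ solve 1 (λ y → con (1 , 0) :* y :+ :- con (1 , 0) :* y := con (0 , 0)) refl y ⟩
      0# ∎)
  sg-injective char≢2 false true  y≉0 e = ≡.sym (sg-injective char≢2 true false y≉0 (sym e))

  -- Both equations present `x` as a signed `y`, with signs `a ⊛ b` and `a′ ⊛ b′`. These agree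
  -- because `y` is nonzero, and the factors are then regrouped.
  sg-compare : CharNot2 R → ∀ a b a′ b′ {x y} → ¬ (y ≈ 0#) → sg a * x ≈ sg b * y → sg a′ * x ≈ sg b′ * y → a ⊛ a′ ≡ b ⊛ b′
  sg-compare char≢2 a b a′ b′ {x} {y} y≉0 e e′ = sg-injective char≢2 (a ⊛ a′) (b ⊛ b′) y≉0 (begin
    sg (a ⊛ a′) * y ≈⟨ sg-scale a a′ ⟩
    sg a * (sg a′ * y) ≈⟨ *-identityˡ _ ⟨
    1# * (sg a * (sg a′ * y)) ≈⟨ *-congʳ (sg-square b) ⟨
    sg b * sg b * (sg a * (sg a′ * y))
      ≈⟨ solve 4 (λ a b c y → b :* b :* (a :* (c :* y)) := b :* (c :* (a :* b :* y))) refl (sg a) (sg b) (sg a′) y ⟩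
    sg b * (sg a′ * (sg a * sg b * y)) ≈⟨ *-congˡ (*-congˡ (*-congʳ (sg-⊛ a b))) ⟨
    sg b * (sg a′ * (sg (a ⊛ b) * y)) ≈⟨ *-congˡ (*-congˡ (sg-transpose a b e)) ⟨
    sg b * (sg a′ * x) ≈⟨ *-congˡ e′ ⟩
    sg b * (sg b′ * y) ≈⟨ sg-scale b b′ ⟨
    sg (b ⊛ b′) * y ∎)

-- Boolean signs, sign vectors and global sign changes.

module SignLemmas (𝕣 : RealField) where
  open RealLemmas 𝕣
  open Arrangements 𝕣
  open ≡ using (refl; trans; cong)

  toSign : Bool → Sign
  toSign true  = plus
  toSign false = minus

  HasSign⇒SgnOf : ∀ b {x} → HasSign b x → SgnOf x (toSign b)
  HasSign⇒SgnOf true  = sgn+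
  HasSign⇒SgnOf false = sgn-

  SgnOf⇒toSign : ∀ b {x s} → HasSign b x → SgnOf x s → s ≡ toSign b
  SgnOf⇒toSign true  p (sgn+ _) = refl
  SgnOf⇒toSign false p (sgn- _) = refl
  SgnOf⇒toSign true  p (sgn- q) = case sign-unique {true} {false} p q of λ ()
  SgnOf⇒toSign false p (sgn+ q) = case sign-unique {false} {true} p q of λ ()
  SgnOf⇒toSign b     p (sgn0 e) = contradiction e (sign⇒≢0 b p)

  SgnOf⇒nil : ∀ {x s} → x ≡ 0r → SgnOf x s → s ≡ nil
  SgnOf⇒nil e (sgn+ p) = contradiction e (>⇒≢ p)
  SgnOf⇒nil e (sgn- p) = contradiction e (<⇒≢ p)
  SgnOf⇒nil e (sgn0 _) = refl

  ·-nil : ∀ b → b · nil ≡ nil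
  ·-nil true  = refl
  ·-nil false = refl

  ·-toSign : ∀ a b → a · toSign b ≡ toSign (a ⊛ b)
  ·-toSign true  b     = refl
  ·-toSign false true  = refl
  ·-toSign false false = refl

  ·-involutive : ∀ b s → b · (b · s) ≡ s
  ·-involutive true  s     = refl
  ·-involutive false plus  = refl
  ·-involutive false minus = refl
  ·-involutive false nil   = refl

  flip : Bool → ℝ → ℝ
  flip κ x = if κ then x else - x

  HasSign-flip : ∀ κ b {x} → HasSign b x → HasSign (κ ⊛ b) (flip κ x)
  HasSign-flip true  b p = p
  HasSign-flip false b p = sign-neg b p

  flip-0 : ∀ κ {x} → x ≡ 0r → flip κ x ≡ 0r
  flip-0 true  e = e
  flip-0 false e = trans (cong -_ e) -0≡0

  relation-flip : ∀ (A : Arrangement) {J c} κ → Arrangement.Relation A J c → Arrangement.Relation A J (flip κ ∘ c)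
  relation-flip A true  rel = rel
  relation-flip A false rel = Matroid.relation-neg 𝕣 A rel

  -- With `κ = ε σ τ` this reads `κ τ = ε σ`: flipping a relation with signs `τ` by `κ` gives it the
  -- required signs.
  ⊛-solve-τ : ∀ ε σ τ → (ε ⊛ (σ ⊛ τ)) ⊛ τ ≡ ε ⊛ σ
  ⊛-solve-τ true  true  true  = refl
  ⊛-solve-τ true  true  false = refl
  ⊛-solve-τ true  false true  = refl
  ⊛-solve-τ true  false false = refl
  ⊛-solve-τ false true  true  = refl
  ⊛-solve-τ false true  false = refl
  ⊛-solve-τ false false true  = refl
  ⊛-solve-τ false false false = refl

  ⊛-solve-σ : ∀ ε σ τ → (ε ⊛ (σ ⊛ τ)) ⊛ σ ≡ ε ⊛ τ
  ⊛-solve-σ true  true  true  = refl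
  ⊛-solve-σ true  true  false = refl
  ⊛-solve-σ true  false true  = refl
  ⊛-solve-σ true  false false = refl
  ⊛-solve-σ false true  true  = refl
  ⊛-solve-σ false true  false = refl
  ⊛-solve-σ false false true  = refl
  ⊛-solve-σ false false false = refl

-- Recovering the signed circuits.

module Recovery {c ℓ} (R : CommutativeRing c ℓ) (𝕣 : RealField) (domain : IsIntegralDomain R) (char≢2 : CharNot2 R)
  (A₁ A₂ : Arrangements.Arrangement 𝕣) (generic : Arrangements.Arrangement.GenericCodim2 A₁)
  (Φ : VG.GradedIso R 𝕣 A₁ A₂) where
  open CommutativeRing R using (_≈_; _*_)
  open RingLemmas R using (sg)
  open SignChoice R domain
  open SignLemmas 𝕣
  open RealLemmas 𝕣 using (HasSign; ≢0⇒sign)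
  open Arrangements 𝕣
  open Generators R 𝕣 domain char≢2 A₁ A₂ generic Φ using (π; ρ; πρ; ρπ; u; u≉0; v; v≉0; π-injective; transports₂₁; transports₁₂)
  open ≡ using (refl; sym; trans; cong; subst)
  private
    module A₁ = Arrangement A₁
    module A₂ = Arrangement A₂
    module M₁ = Matroid 𝕣 A₁
    module M₂ = Matroid 𝕣 A₂
    module T₂₁ = Transfer R 𝕣 domain A₂ A₁
    module T₁₂ = Transfer R 𝕣 domain A₁ A₂

  ρ-injective : ∀ i j → ρ i ≡ ρ j → i ≡ j
  ρ-injective i j e = trans (sym (πρ i)) (trans (cong π e) (πρ j))

  forth : ∀ {I J} → A₂.IsCircuit I → (∀ i → i ∈ I → π i ∈ J) → A₁.Dependent J
  forth = T₂₁.circuit⇒dependent π π-injective u u≉0 transports₂₁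

  back : ∀ {J I} → A₁.IsCircuit J → (∀ j → j ∈ J → ρ j ∈ I) → A₂.Dependent I
  back = T₁₂.circuit⇒dependent ρ ρ-injective v v≉0 transports₁₂

  circuit-image : ∀ {I} → A₂.IsCircuit I → A₁.IsCircuit (comap ρ I)
  circuit-image = CircuitMap.circuit-map 𝕣 A₂ A₁ π ρ ρπ πρ forth back

  circuit-preimage : ∀ {J} → A₁.IsCircuit J → A₂.IsCircuit (comap π J)
  circuit-preimage = CircuitMap.circuit-map 𝕣 A₁ A₂ ρ π πρ ρπ back forth

  π∈image : ∀ {I i} → i ∈ I → π i ∈ comap ρ I
  π∈image {I} {i} i∈I = ∈-comap⁺ ρ (subst (_∈ I) (sym (ρπ i)) i∈I)

  Related : Fin A₂.n → Fin A₂.n → Set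
  Related i j = ∃[ I ] (A₂.IsCircuit I × i ∈ I × j ∈ I)

  related? : ∀ i j → Dec (Related i j)
  related? i j = anySubset? (λ I → M₂.circuit? I ×-dec ((i ∈? I) ×-dec (j ∈? I)))

  ratio : ∀ {i j} → Related i j → ∃[ β ] u i ≈ sg β * u j
  ratio {i} {j} (I , circ , i∈I , j∈I) =
    let (λ′ , rel) = proj₁ circ
        circ′ = circuit-image circ
        (μ , rel′) = proj₁ circ′
        σᵢ , pᵢ = ≢0⇒sign (M₂.circuit-support circ rel i i∈I)
        σⱼ , pⱼ = ≢0⇒sign (M₂.circuit-support circ rel j j∈I)
        τᵢ , qᵢ = ≢0⇒sign (M₁.circuit-support circ′ rel′ (π i) (π∈image i∈I))
        τⱼ , qⱼ = ≢0⇒sign (M₁.circuit-support circ′ rel′ (π j) (π∈image j∈I))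
    in (σᵢ ⊛ τᵢ) ⊛ (σⱼ ⊛ τⱼ) , sg-transpose (σᵢ ⊛ τᵢ) (σⱼ ⊛ τⱼ)
         (T₂₁.circuit-signs π π-injective u u≉0 transports₂₁ circ rel circ′ rel′ (λ _ → π∈image) i∈I j∈I {σᵢ} {σⱼ} {τᵢ} {τⱼ} pᵢ pⱼ qᵢ qⱼ)

  signs : Σ (Fin A₂.n → Bool) λ ε → ∀ i j → Related i j → sg (ε i) * u i ≈ sg (ε j) * u j
  signs = coherentSigns u Related related? ratio

  ε : Fin A₂.n → Bool
  ε = proj₁ signs

  -- Along the circuit both `σ_i τ_i u_i` and `ε_i u_i` are constant. Dividing out the nonzero `u_i`
  -- leaves the constant sign `κ`, by which the two relations differ after twisting with `ε`.
  sign-invariant : ∀ {I J λ′ μ} → A₂.IsCircuit I → A₂.Relation I λ′ → A₁.IsCircuit J → A₁.Relation J μ →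
    (∀ i → i ∈ I → π i ∈ J) →
    ∃[ κ ] (∀ i → i ∈ I → ∀ {σ τ} → HasSign σ (λ′ i) → HasSign τ (μ (π i)) → ε i ⊛ (σ ⊛ τ) ≡ κ)
  sign-invariant {I} {J} {λ′} {μ} circ rel circ′ rel′ πI⊆J =
    let i₀ , i₀∈I = M₂.dependent-nonempty (λ′ , rel)
        σ₀ , p₀ = ≢0⇒sign (M₂.circuit-support circ rel i₀ i₀∈I)
        τ₀ , q₀ = ≢0⇒sign (M₁.circuit-support circ′ rel′ (π i₀) (πI⊆J i₀ i₀∈I))
    in ε i₀ ⊛ (σ₀ ⊛ τ₀) , λ i i∈I {σ} {τ} p q →
      sg-compare char≢2 (ε i) (ε i₀) (σ ⊛ τ) (σ₀ ⊛ τ₀) (u≉0 i₀)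
        (proj₂ signs i i₀ (I , circ , i∈I , i₀∈I))
        (T₂₁.circuit-signs π π-injective u u≉0 transports₂₁ circ rel circ′ rel′ πI⊆J i∈I i₀∈I {σ} {σ₀} {τ} {τ₀} p p₀ q q₀)

  signedCircuit-image : ∀ σ → SignedCircuit A₂ σ → SignedCircuit A₁ (λ j → ε (ρ j) · σ (ρ j))
  signedCircuit-image σ (I , circ , λ′ , rel , λ-signs) =
    -- The relation coming with the image circuit has an arbitrary overall sign; `κ` corrects it.
    J , circ′ , flip κ ∘ μ , relation-flip A₁ κ rel′ , μ-signs
    where
    J = comap ρ I
    circ′ = circuit-image circ
    μ = proj₁ (proj₁ circ′)
    rel′ = proj₂ (proj₁ circ′)
    invariant = sign-invariant circ rel circ′ rel′ (λ _ → π∈image)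
    κ = proj₁ invariant
    μ-signs : ∀ j → SgnOf (flip κ (μ j)) (ε (ρ j) · σ (ρ j))
    μ-signs j = case (j ∈? J) of λ
      { (no j∉J) → subst (SgnOf (flip κ (μ j)))
          (sym (trans (cong (ε (ρ j) ·_) (SgnOf⇒nil (proj₁ rel (ρ j) (λ ρj∈I → j∉J (∈-comap⁺ ρ ρj∈I))) (λ-signs (ρ j)))) (·-nil (ε (ρ j)))))
          (sgn0 (flip-0 κ (proj₁ rel′ j j∉J)))
      ; (yes j∈J) →
          let ρj∈I = ∈-comap⁻ ρ j∈J
              s , p = ≢0⇒sign (M₂.circuit-support circ rel (ρ j) ρj∈I)
              t , q = ≢0⇒sign (M₁.circuit-support circ′ rel′ j j∈J)
              same = proj₂ invariant (ρ j) ρj∈I {s} {t} p (subst (λ l → HasSign t (μ l)) (sym (πρ j)) q)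
          in subst (SgnOf (flip κ (μ j)))
               (sym (trans (cong (ε (ρ j) ·_) (SgnOf⇒toSign s p (λ-signs (ρ j)))) (·-toSign (ε (ρ j)) s)))
               (HasSign⇒SgnOf (ε (ρ j) ⊛ s)
                 (subst (λ b → HasSign b (flip κ (μ j))) (trans (cong (_⊛ t) (sym same)) (⊛-solve-τ (ε (ρ j)) s t)) (HasSign-flip κ t {μ j} q)))
      }

  signedCircuit-preimage : ∀ σ → SignedCircuit A₁ (λ j → ε (ρ j) · σ (ρ j)) → SignedCircuit A₂ σ
  signedCircuit-preimage σ (J , circ′ , μ , rel′ , μ-signs) =
    I , circ , flip κ ∘ λ′ , relation-flip A₂ κ rel , λ-signs
    where
    I = comap π J
    circ = circuit-preimage circ′
    λ′ = proj₁ (proj₁ circ)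
    rel = proj₂ (proj₁ circ)
    invariant = sign-invariant circ rel circ′ rel′ (λ _ → ∈-comap⁻ π)
    κ = proj₁ invariant
    μ-sign : ∀ i → SgnOf (μ (π i)) (ε i · σ i)
    μ-sign i = subst (λ l → SgnOf (μ (π i)) (ε l · σ l)) (ρπ i) (μ-signs (π i))
    σ-from : ∀ i {s} → ε i · σ i ≡ s → ε i · s ≡ σ i
    σ-from i refl = ·-involutive (ε i) (σ i)
    λ-signs : ∀ i → SgnOf (flip κ (λ′ i)) (σ i)
    λ-signs i = case (i ∈? I) of λ
      { (no i∉I) → subst (SgnOf (flip κ (λ′ i)))
          (trans (sym (·-nil (ε i))) (σ-from i (SgnOf⇒nil (proj₁ rel′ (π i) (λ πi∈J → i∉I (∈-comap⁺ π πi∈J))) (μ-sign i))))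
          (sgn0 (flip-0 κ (proj₁ rel i i∉I)))
      ; (yes i∈I) →
          let s , p = ≢0⇒sign (M₂.circuit-support circ rel i i∈I)
              t , q = ≢0⇒sign (M₁.circuit-support circ′ rel′ (π i) (∈-comap⁻ π i∈I))
              same = proj₂ invariant i i∈I {s} {t} p q
          in subst (SgnOf (flip κ (λ′ i)))
               (trans (sym (·-toSign (ε i) t)) (σ-from i (SgnOf⇒toSign t q (μ-sign i))))
               (HasSign⇒SgnOf (ε i ⊛ t)
                 (subst (λ b → HasSign b (flip κ (λ′ i))) (trans (cong (_⊛ s) (sym same)) (⊛-solve-σ (ε i) s t)) (HasSign-flip κ s {λ′ i} p)))
      }

  circuitsIso : CircuitsIso A₁ A₂
  -- The permutation and signs of `CircuitsIso` are indexed by `A₁`, hence `ρ` in place of `π` and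
  -- the signs pulled back along it.
  circuitsIso = mk↔ₛ′ ρ π ρπ πρ , ε ∘ ρ , λ σ → signedCircuit-image σ , signedCircuit-preimage σ

theorem5p3 : ∀ {c ℓ} (R : CommutativeRing c ℓ) (𝕣 : RealField) →
    IsIntegralDomain R → CharNot2 R →
    (A₁ A₂ : Arrangements.Arrangement 𝕣) →
    Arrangements.Arrangement.GenericCodim2 A₁ →
    VG.GradedIso R 𝕣 A₁ A₂ →
    Arrangements.CircuitsIso 𝕣 A₁ A₂
theorem5p3 R 𝕣 domain char≢2 A₁ A₂ generic Φ = Recovery.circuitsIso R 𝕣 domain char≢2 A₁ A₂ generic Φ
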